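{- Let $T(n)=n^{ -1}\,|\{1\le m\le n: m \text{ has two } m\text{ -good pairs}\}|$. For $n\ge1$ write $n=\frac{1}{\sqrt5}c\phi^p$ with $p$ an integer and $\frac1{\sqrt5}\le c<\frac{1}{\sqrt5}\phi$. Then \[ T(n)=\begin{cases} \frac{1}{2\sqrt5\,\phi^4 c}+O(n^{ -1/2}) & p \text{ odd},\\ \frac{\sqrt5}{2}c+\frac{1+\phi^{ -5}}{2\sqrt5 c}-1+O(n^{ -1/2}) & p \text{ even},\ c\le \frac{1+\phi^{ -3}}{\sqrt5},\\ 1-\frac{\sqrt5}{2}\phi^{ -1}c-\frac{1+\phi^{ -2}}{2\sqrt5 c}+O(n^{ -1/2}) & p\text{ even},\ c\ge\frac{1+\phi^{ -3}}{\sqrt5}. \end{cases} \]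
   Context: $f_k$ denotes the Fibonacci numbers, $f_1=f_2=1$, $f_{k+2}=f_{k+1}+f_k$, and $\phi=(1+\sqrt5)/2$. For positive integers $a_1,a_2$, the $(a_1,a_2)$-Fibonacci walk is $w_k=w_k(a_1,a_2)$ with $w_1=a_1$, $w_2=a_2$, $w_{k+2}=w_{k+1}+w_k$. Let $s(n;a_1,a_2)$ be the integer $s$ with $w_s(a_1,a_2)=n$ ($-\infty$ if none), and $s(n)=\max_{a_1,a_2\ge1}s(n;a_1,a_2)$. A pair $(a_1,a_2)$ is $n$-good if $a_1,a_2\ge1$ and $s(n;a_1,a_2)=s(n)$. The implied constants in $O(\cdot)$ are absolute. -}

module Defs where

open import Data.Nat as ℕ using (ℕ; zero; suc; _≤_)
open import Data.Nat.Divisibility using (_∣_)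
open import Data.Integer as ℤ using (ℤ; +_; -[1+_]; ∣_∣)
open import Data.Rational as ℚ using (ℚ; 0ℚ; 1ℚ; ≢-nonZero)
open import Data.Rational.Properties using (_≟_)
open import Data.Product using (Σ; _×_; _,_; proj₁; proj₂)
open import Data.Sum using (_⊎_)
open import Relation.Nullary using (¬_; yes; no)
open import Relation.Binary.PropositionalEquality using (_≡_; _≢_)

-- Fibonacci walks (indices start at 1; index 0 is a junk value 0)

walk : ℕ → ℕ → ℕ → ℕ
walk a₁ a₂ zero                  = 0
walk a₁ a₂ (suc zero)            = a₁
walk a₁ a₂ (suc (suc zero))      = a₂
walk a₁ a₂ (suc (suc (suc k)))   = walk a₁ a₂ (suc (suc k)) ℕ.+ walk a₁ a₂ (suc k)

-- (a₁ , a₂) is n-good: a₁,a₂ ≥ 1 and s(n;a₁,a₂) = s(n), i.e. the walk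
-- hits n at some index k ≥ 1 (k = s(n;a₁,a₂), the largest such index), and
-- no walk with positive starting values hits n at an index larger than k
-- (so k = s(n) = max over all pairs).
Good : ℕ → ℕ × ℕ → Set
Good n (a₁ , a₂) =
  1 ≤ a₁ × 1 ≤ a₂ ×
  Σ ℕ λ k → 1 ≤ k × walk a₁ a₂ k ≡ n ×
    (∀ b₁ b₂ j → 1 ≤ b₁ → 1 ≤ b₂ → 1 ≤ j → walk b₁ b₂ j ≡ n → j ≤ k)

HasTwoGood : ℕ → Set
HasTwoGood m =
  Σ (ℕ × ℕ) λ P → Σ (ℕ × ℕ) λ Q →
    P ≢ Q × Good m P × Good m Q × (∀ R → Good m R → R ≡ P ⊎ R ≡ Q)

-- The ordered field ℚ(√5): (a , b) represents a + b√5

K : Set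
K = ℚ × ℚ

infixl 6 _+K_ _-K_
infixl 7 _*K_

ι : ℚ → K
ι q = q , 0ℚ

ιℕ : ℕ → K
ιℕ n = ι ((+ n) ℚ./ 1)

_+K_ : K → K → K
(a , b) +K (c , d) = (a ℚ.+ c) , (b ℚ.+ d)

-K_ : K → K
-K (a , b) = ℚ.- a , ℚ.- b

_-K_ : K → K → K
x -K y = x +K (-K y)

_*K_ : K → K → K
(a , b) *K (c , d) = (a ℚ.* c ℚ.+ five ℚ.* (b ℚ.* d)) , (a ℚ.* d ℚ.+ b ℚ.* c)
  where five = (+ 5) ℚ./ 1

normK : K → ℚ
normK (a , b) = a ℚ.* a ℚ.- ((+ 5) ℚ./ 1) ℚ.* (b ℚ.* b)

-- multiplicative inverse (conj x / N(x)); convention 0⁻¹ = 0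
invK : K → K
invK (a , b) with normK (a , b) ≟ 0ℚ
... | yes _ = 0ℚ , 0ℚ
... | no ne = (a ℚ.* r) , (ℚ.- b ℚ.* r)
  where r = ℚ.1/_ (normK (a , b)) {{≢-nonZero ne}}

NonNegK : K → Set
NonNegK (a , b) =
  (0ℚ ℚ.≤ a × 0ℚ ℚ.≤ b)
  ⊎ (0ℚ ℚ.≤ a × b ℚ.< 0ℚ × ((+ 5) ℚ./ 1) ℚ.* (b ℚ.* b) ℚ.≤ a ℚ.* a)
  ⊎ (a ℚ.< 0ℚ × 0ℚ ℚ.< b × a ℚ.* a ℚ.≤ ((+ 5) ℚ./ 1) ℚ.* (b ℚ.* b))

_≤K_ : K → K → Set
x ≤K y = NonNegK (y -K x)

_<K_ : K → K → Set
x <K y = x ≤K y × ¬ (y ≤K x)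

√5 : K
√5 = 0ℚ , 1ℚ

φ : K
φ = ((+ 1) ℚ./ 2) , ((+ 1) ℚ./ 2)

φ⁻¹ : K
φ⁻¹ = φ -K ι 1ℚ

powK : K → ℕ → K
powK x zero    = ι 1ℚ
powK x (suc k) = x *K powK x k

φ^ : ℤ → K
φ^ (+ n)      = powK φ n
φ^ -[1+ n ]   = powK φ⁻¹ (suc n)

Even : ℤ → Set
Even p = 2 ∣ ∣ p ∣

Tval : ℕ → ℕ → K
Tval size n = ιℕ size *K invK (ιℕ n)

-- |x| ≤ C · n^{-1/2}, expressed as n·x² ≤ C² (C ≥ 0)
ErrBound : ℕ → ℕ → K → Set
ErrBound C n x = (ιℕ n *K x *K x) ≤K ιℕ (C ℕ.* C)

half : ℚ
half = (+ 1) ℚ./ 2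

mainOdd : K → K
mainOdd c = invK (ιℕ 2 *K √5 *K φ^ (+ 4) *K c)

mainEven₁ : K → K
mainEven₁ c = ι half *K √5 *K c
          +K (ι 1ℚ +K φ^ (ℤ.- (+ 5))) *K invK (ιℕ 2 *K √5 *K c)
          -K ι 1ℚ

mainEven₂ : K → K
mainEven₂ c = ι 1ℚ
          -K ι half *K √5 *K φ^ (ℤ.- (+ 1)) *K c
          -K (ι 1ℚ +K φ^ (ℤ.- (+ 2))) *K invK (ιℕ 2 *K √5 *K c)

threshold : K
threshold = (ι 1ℚ +K φ^ (ℤ.- (+ 3))) *K invK √5

{-# OPTIONS --safe #-}
-- A walk reaches n at index l+3 from (a, b) iff n = F(l+1) a + F(l+2) b, and the index is maximal iff every
-- positive solution has b ≤ a. Shifting a solution by (F(l+2), -F(l+1)), one finds that n has two good pairs iff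
--   n = F(l+1) F(l+3) + F(l+1) x + F(l+2) y   for some 1 ≤ y ≤ x ≤ F(l),
-- and then l, x, y are unique. The points of level l fill the window φ^(2l+4)/5 ≤ n ≤ φ^(2l+5)/5, so for odd p
-- the count is a sum of full levels F(l)(F(l)+1)/2, while for even p one level is cut by a line. Depending on
-- the side of the threshold, the included or the excluded part of that level is a lattice triangle
-- α u + β v < M, whose number t of points satisfies M² ≤ 2αβ t ≤ (M+α+β)². The Binet formula then turns
-- the Fibonacci products into powers of φ up to bounded errors.
module Submission where

-- Passing between conditions on c and integer inequalities loses nothing: 5 times each Fibonacci
-- product that bounds a window lies within 4 of its multiple of a power of φ, and an error below 5
-- cannot move an integer across the bound. The threshold is where the cutting line passes through
-- the vertex x = F(l), y = 0 of level l, that is n = 2 F(l+1) F(l+2); it has this form because 1 +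
-- φ⁻³ = 2 φ⁻¹. Below it the bound x ≤ F(l) is automatic for the included points, above it y ≥ 1 is
-- automatic for the excluded ones, so in both cases only the cutting line and two sides remain.
-- Comparisons are made after multiplication by 10 n, where the error is at most a constant times a
-- power φʲ with φ²ʲ ≤ 5 n. The order of ℚ(√5) is a case distinction on rationals, so the analysis
-- runs over an abstract ring whose nonnegative elements are closed under sums, products and
-- cancellation of positive integers; an inequality is proved by an identity that writes the
-- difference as such a combination.

module WalkCounting where
  open import Defs
  open import Data.Empty using (⊥; ⊥-elim)
  open import Data.List using (List; []; _∷_; length; map; _++_; upTo)
  open import Data.List.Membership.Propositional using (_∈_)
  open import Data.List.Membership.Propositional.Properties using (∈-map⁺; ∈-map⁻; ∈-++⁺ˡ; ∈-++⁺ʳ; ∈-++⁻; ∈-upTo⁺; ∈-upTo⁻)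
  open import Data.List.Membership.Propositional.Properties.WithK using (unique∧set⇒bag)
  open import Data.List.Properties using (length-map; length-++; length-upTo)
  open import Data.List.Relation.Binary.BagAndSetEquality using (∼bag⇒↭)
  open import Data.List.Relation.Binary.Permutation.Propositional.Properties using (↭-length)
  open import Data.List.Relation.Unary.All as All using (All)
  import Data.List.Relation.Unary.All.Properties as All
  open import Data.List.Relation.Unary.AllPairs using ([]; _∷_)
  open import Data.List.Relation.Unary.Any using (here; there)
  open import Data.List.Relation.Unary.Unique.Propositional using (Unique)
  open import Data.List.Relation.Unary.Unique.Propositional.Properties using (map⁺; ++⁺; upTo⁺)
  open import Data.Nat using (ℕ; zero; suc; pred; _+_; _*_; _∸_; _≤_; _<_; _/_; z≤n; s≤s; s≤s⁻¹; NonZero; >-nonZero)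
  open import Data.Nat.Coprimality as Coprimality using (Coprime; coprime-divisor; coprime-+; 1-coprimeTo)
  open import Data.Nat.DivMod using (m/n*n≤m; m%n<n; m≡m%n+[m/n]*n)
  open import Data.Nat.Divisibility using (_∣_; divides)
  open import Data.Nat.Properties
  open import Data.Nat.Tactic.RingSolver using (solve-∀)
  open import Data.Product using (∃; _×_; _,_; proj₁; proj₂)
  open import Data.Sum using (_⊎_; inj₁; inj₂; swap; [_,_]′)
  open import Function.Bundles using (mk⇔)
  open import Relation.Binary.Definitions using (tri<; tri≈; tri>)
  open import Relation.Binary.PropositionalEquality using (_≡_; _≢_; refl; sym; trans; cong; cong₂; subst; subst₂)
  open import Relation.Nullary using (¬_; yes; no)

  -- Walks as linear forms with Fibonacci coefficients

  fib : ℕ → ℕ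
  fib zero          = 0
  fib (suc zero)    = 1
  fib (suc (suc n)) = fib (suc n) + fib n

  fib-pos : ∀ n → 1 ≤ fib (suc n)
  fib-pos zero    = ≤-refl
  fib-pos (suc n) = ≤-trans (fib-pos n) (m≤m+n _ _)

  fib-coprime : ∀ n → Coprime (fib (suc n)) (fib n)
  fib-coprime zero    = 1-coprimeTo 0
  fib-coprime (suc n) = coprime-+ (Coprimality.sym (fib-coprime n))

  fib-mono : ∀ n → fib n ≤ fib (suc n)
  fib-mono zero    = z≤n
  fib-mono (suc n) = m≤m+n _ _

  walk-fib : ∀ a b l → walk a b (2 + l) ≡ fib l * a + fib (suc l) * b
  walk-fib a b zero          = sym (+-identityʳ b)
  walk-fib a b (suc zero)    = eq a b
    where
    eq : ∀ a b → b + a ≡ 1 * a + 1 * b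
    eq = solve-∀
  walk-fib a b (suc (suc l))
    rewrite walk-fib a b (suc l) | walk-fib a b l = eq (fib (suc l)) (fib l) a b
    where
    eq : ∀ u v a b → u * a + (u + v) * b + (v * a + u * b) ≡ (u + v) * a + (u + v + u) * b
    eq = solve-∀

  walk-shift : ∀ a b j → walk a b (2 + j) ≡ walk b (b + a) (suc j)
  walk-shift a b zero          = refl
  walk-shift a b (suc zero)    = refl
  walk-shift a b (suc (suc j)) = cong₂ _+_ (walk-shift a b (suc j)) (walk-shift a b j)

  -- Dropping leading terms keeps the starting values positive, so a hit at any late index can be
  -- compared with one at a prescribed index.
  walk-descend : ∀ d j a b → 1 ≤ a → 1 ≤ b →
    ∃ λ a′ → ∃ λ b′ → 1 ≤ a′ × 1 ≤ b′ × walk a b (d + suc j) ≡ walk a′ b′ (suc j)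
  walk-descend zero    j a b pa pb = a , b , pa , pb , refl
  walk-descend (suc d) j a b pa pb
    with walk-descend d j b (b + a) pb (≤-trans pb (m≤m+n b a))
  ... | a′ , b′ , pa′ , pb′ , eq = a′ , b′ , pa′ , pb′ , trans shift eq
    where
    shift : walk a b (suc d + suc j) ≡ walk b (b + a) (d + suc j)
    shift rewrite +-suc d j = walk-shift a b (d + j)

  -- Cancelling the common part leaves `B * c ≡ A * d`, and coprimality makes `B` divide `d`; the
  -- solutions thus form one progression with step `(B , -A)`. Ordering the first coordinates keeps
  -- every difference a natural number.
  linear-solutions : ∀ {A B a b a′ b′} .{{_ : NonZero B}} → Coprime B A → a ≤ a′ →
    A * a + B * b ≡ A * a′ + B * b′ → ∃ λ t → a′ ≡ a + B * t × b ≡ b′ + A * t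
  linear-solutions {A} {B} {a} {b} {a′} {b′} cop a≤a′ eq
    with m≤n⇒∃[o]m+o≡n a≤a′
  ... | d , refl = t , cong (a +_) (trans d≡ (*-comm t B)) , trans (sym c≡) (cong (b′ +_) c≡At)
    where
    shuffle : ∀ A B a d b′ → A * (a + d) + B * b′ ≡ A * a + (B * b′ + A * d)
    shuffle = solve-∀
    Bb : B * b ≡ B * b′ + A * d
    Bb = +-cancelˡ-≡ (A * a) _ _ (trans eq (shuffle A B a d b′))
    b′≤b : b′ ≤ b
    b′≤b = *-cancelˡ-≤ B (≤-trans (m≤m+n _ _) (≤-reflexive (sym Bb)))
    c : ℕ
    c = proj₁ (m≤n⇒∃[o]m+o≡n b′≤b)
    c≡ : b′ + c ≡ b
    c≡ = proj₂ (m≤n⇒∃[o]m+o≡n b′≤b)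
    Bc : B * c ≡ A * d
    Bc = +-cancelˡ-≡ (B * b′) _ _
      (trans (sym (*-distribˡ-+ B b′ c)) (trans (cong (B *_) c≡) Bb))
    B∣d : B ∣ d
    B∣d = coprime-divisor cop (divides c (trans (sym Bc) (*-comm B c)))
    t : ℕ
    t = _∣_.quotient B∣d
    d≡ : d ≡ t * B
    d≡ = _∣_.equality B∣d
    rotate : ∀ A t B → A * (t * B) ≡ B * (A * t)
    rotate = solve-∀
    c≡At : c ≡ A * t
    c≡At = *-cancelˡ-≡ c (A * t) B (trans Bc (trans (cong (A *_) d≡) (rotate A t B)))

  -- Coordinates are counted from 0: (x , y) stands for the lattice point (x + 1, y + 1).
  point : ℕ → ℕ × ℕ → ℕ
  point l (x , y) = fib (1 + l) * fib (3 + l) + fib (1 + l) * suc x + fib (2 + l) * suc y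

  InTriangle : ℕ → ℕ × ℕ → Set
  InTriangle g (x , y) = y ≤ x × x < g

  -- Numbers with two good pairs as lattice points of triangles

  module Level (l : ℕ) where
    A B : ℕ
    A = fib (1 + l)
    B = fib (2 + l)

    instance
      B-nonZero : NonZero B
      B-nonZero = >-nonZero (fib-pos (1 + l))

    solve-level : ∀ {a b a′ b′} → a ≤ a′ → A * a + B * b ≡ A * a′ + B * b′ →
      ∃ λ t → a′ ≡ a + B * t × b ≡ b′ + A * t
    solve-level = linear-solutions (fib-coprime (1 + l))

    same-first : ∀ {a b b′} → A * a + B * b ≡ A * a + B * b′ → b ≡ b′
    same-first {a} eq = *-cancelˡ-≡ _ _ B (+-cancelˡ-≡ (A * a) _ _ eq)

    -- Distinct solutions differ by at least `B` in the first coordinate, so from `a ≤ B` a step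
    -- down leaves the positive range.
    no-smaller : ∀ {a b a′ b′} → 1 ≤ a′ → a ≤ B → a′ < a → ¬ (A * a + B * b ≡ A * a′ + B * b′)
    no-smaller {a} {b} {a′} {b′} pa′ a≤B a′<a eq with solve-level (<⇒≤ a′<a) (sym eq)
    ... | zero  , a≡ , _ = <-irrefl (sym (trans a≡ (trans (cong (a′ +_) (*-zeroʳ B)) (+-identityʳ a′)))) a′<a
    ... | suc t , a≡ , _ = <⇒≱ (≤-trans (+-mono-≤ pa′ (m≤m*n B (suc t))) (≤-reflexive (sym a≡))) a≤B

    -- A hit beyond index `3 + l` can be cut down to index `4 + l`, and dropping one more term gives
    -- a solution `(c₂ , c₂ + c₁)` whose second entry exceeds the first. This cannot be: no positive
    -- solution starts below `a`, and from `a` on the second entry is at most `b ≤ a`.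
    maximal : ∀ {a b m} → 1 ≤ a → b ≤ a → a ≤ B → A * a + B * b ≡ m →
      ∀ b₁ b₂ j → 1 ≤ b₁ → 1 ≤ b₂ → 1 ≤ j → walk b₁ b₂ j ≡ m → j ≤ 3 + l
    maximal {a} {b} {m} pa b≤a a≤B refl b₁ b₂ j p₁ p₂ _ hit with j ≤? 3 + l
    ... | yes j≤ = j≤
    ... | no j≰ with m≤n⇒∃[o]m+o≡n (≰⇒> j≰)
    ... | d , refl with walk-descend d (3 + l) b₁ b₂ p₁ p₂
    ... | c₁ , c₂ , q₁ , q₂ , eq = ⊥-elim (absurd (<-cmp c₂ a))
      where
      rep : A * a + B * b ≡ A * c₂ + B * (c₂ + c₁)
      rep = trans (sym hit) (trans (cong (walk b₁ b₂) (+-comm (4 + l) d))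
        (trans eq (trans (walk-shift c₁ c₂ (2 + l)) (walk-fib c₂ (c₂ + c₁) (1 + l)))))
      c₂<b : a ≤ c₂ → ⊥
      c₂<b a≤c₂ with solve-level a≤c₂ rep
      ... | t , _ , b≡ = <⇒≱ (≤-trans (≤-trans (≤-reflexive (+-comm 1 c₂)) (+-monoʳ-≤ c₂ q₁))
                            (≤-trans (m≤m+n _ _) (≤-reflexive (sym b≡)))) (≤-trans b≤a a≤c₂)
      absurd : _ → ⊥
      absurd (tri< lt _ _)   = no-smaller {b = b} {b′ = c₂ + c₁} q₂ a≤B lt rep
      absurd (tri≈ _ refl _) = c₂<b ≤-refl
      absurd (tri> _ _ gt)   = c₂<b (<⇒≤ gt)

  module _ (l : ℕ) {x y : ℕ} (tri : InTriangle (fib l) (x , y)) where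
    open Level l

    private
      m = point l (x , y)
      y≤x = proj₁ tri
      x<g = proj₂ tri
      a = A + suc x
      b = A + suc y

      a≤B : a ≤ B
      a≤B = +-monoʳ-≤ A x<g
      b≤a : b ≤ a
      b≤a = +-monoʳ-≤ A (s≤s y≤x)
      pos-+suc : ∀ u v → 1 ≤ u + suc v
      pos-+suc u v = ≤-trans (s≤s z≤n) (m≤n+m (suc v) u)

      -- `A + g` is `B` unfolded by the recurrence, which lets the ring solver see how the three
      -- Fibonacci numbers are related.
      expand : ∀ A g x y → A * (A + suc x) + (A + g) * (A + suc y)
                         ≡ A * (A + g + A) + A * suc x + (A + g) * suc y
      expand = solve-∀
      shift : ∀ A B x y → A * (A + suc x + B) + B * suc y ≡ A * (A + suc x) + B * (A + suc y)
      shift = solve-∀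

      rep₁ : A * a + B * b ≡ m
      rep₁ = expand A (fib l) x y
      rep₂ : A * (a + B) + B * suc y ≡ m
      rep₂ = trans (shift A B x y) rep₁

    point-maximal : ∀ b₁ b₂ j → 1 ≤ b₁ → 1 ≤ b₂ → 1 ≤ j → walk b₁ b₂ j ≡ m → j ≤ 3 + l
    point-maximal = maximal (pos-+suc A x) b≤a a≤B rep₁

    -- Two neighbours on the progression of solutions: `x < g` rules out a positive solution before
    -- the first, and `suc y ≥ 1` makes the second positive.
    firstPair secondPair : ℕ × ℕ
    firstPair  = a , b
    secondPair = a + B , suc y

    good-first : Good m firstPair
    good-first = pos-+suc A x , pos-+suc A y , 3 + l , s≤s z≤n , trans (walk-fib a b (1 + l)) rep₁ , point-maximal

    good-second : Good m secondPair
    good-second = ≤-trans (pos-+suc A x) (m≤m+n _ _) , s≤s z≤n , 3 + l , s≤s z≤n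
                , trans (walk-fib (a + B) (suc y) (1 + l)) rep₂ , point-maximal

    good-index : ∀ {a₁ a₂ k} → 1 ≤ a₁ → 1 ≤ a₂ → 1 ≤ k → walk a₁ a₂ k ≡ m →
      (∀ b₁ b₂ j → 1 ≤ b₁ → 1 ≤ b₂ → 1 ≤ j → walk b₁ b₂ j ≡ m → j ≤ k) → k ≡ 3 + l
    good-index p₁ p₂ pk hit max =
      ≤-antisym (point-maximal _ _ _ p₁ p₂ pk hit)
        (max a b (3 + l) (pos-+suc A x) (pos-+suc A y) (s≤s z≤n) (trans (walk-fib a b (1 + l)) rep₁))

    -- All good pairs share the index `3 + l`, hence solve the same equation. Going back from `a` is
    -- impossible, and two steps forward would need `2A < b`, whereas `b ≤ a ≤ B ≤ 2A`.
    good-only : ∀ R → Good m R → R ≡ firstPair ⊎ R ≡ secondPair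
    good-only (c , d) (pc , pd , k , pk , hit , max) with good-index pc pd pk hit max
    ... | refl = cases (<-cmp c a)
      where
      rep : A * a + B * b ≡ A * c + B * d
      rep = trans rep₁ (trans (sym hit) (walk-fib c d (1 + l)))
      cases : _ → (c , d) ≡ firstPair ⊎ (c , d) ≡ secondPair
      cases (tri< lt _ _)   = ⊥-elim (no-smaller {b = b} {b′ = d} pc a≤B lt rep)
      cases (tri≈ _ refl _) = inj₁ (cong (c ,_) (sym (same-first {a} {b} {d} rep)))
      cases (tri> _ _ gt) with solve-level {b = b} {b′ = d} (<⇒≤ gt) rep
      ... | zero , c≡ , _ = ⊥-elim (<-irrefl
              (sym (trans c≡ (trans (cong (a +_) (*-zeroʳ B)) (+-identityʳ a)))) gt)
      ... | suc zero , c≡ , b≡ = inj₂ (cong₂ _,_ (trans c≡ (cong (a +_) (*-identityʳ B)))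
              (sym (+-cancelˡ-≡ A _ _ (trans b≡ (trans (cong (d +_) (*-identityʳ A)) (+-comm d A))))))
      ... | suc (suc t) , _ , b≡ = ⊥-elim (<⇒≱ 2A<b (≤-trans b≤a (≤-trans a≤B (+-monoʳ-≤ A (fib-mono l)))))
        where
        split : ∀ A d t → A * suc (suc t) ≡ A + A + A * t
        split = solve-∀
        2A<b : A + A < b
        2A<b = ≤-trans (+-mono-≤ pd (≤-trans (m≤m+n (A + A) (A * t)) (≤-reflexive (sym (split A d t)))))
                 (≤-reflexive (sym b≡))

    point-hasTwoGood : HasTwoGood m
    point-hasTwoGood = firstPair , secondPair , distinct , good-first , good-second , good-only
      where
      distinct : firstPair ≢ secondPair
      distinct eq = <-irrefl (cong proj₁ eq) (m<m+n a (fib-pos (1 + l)))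

  private
    -- The level is recoverable from the number, since `3 + l` is the largest index at which any
    -- walk reaches it.
    level-≤ : ∀ {l l′ x y x′ y′} (tri : InTriangle (fib l) (x , y)) (tri′ : InTriangle (fib l′) (x′ , y′)) →
      point l (x , y) ≡ point l′ (x′ , y′) → l ≤ l′
    level-≤ {l} {l′} tri tri′ eq =
      let p₁ , p₂ , k , pk , hit , _ = good-first l tri
      in +-cancelˡ-≤ 3 _ _ (point-maximal l′ tri′ _ _ k p₁ p₂ pk (trans hit eq))

    -- The first pair of the other lattice point is good for the same number, so it is one of the
    -- two known pairs; being the second would force `x′ ≥ B`, outside the triangle.
    point-injective-level : ∀ {l P P′} → InTriangle (fib l) P → InTriangle (fib l) P′ →
      point l P ≡ point l P′ → P ≡ P′
    point-injective-level {l} {x , y} {x′ , y′} tri tri′ eq =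
      [ same , (λ shifted → ⊥-elim (absurd shifted)) ]′
        (good-only l tri (firstPair l tri′) (subst (λ m → Good m (firstPair l tri′)) (sym eq) (good-first l tri′)))
      where
      open Level l
      same : firstPair l tri′ ≡ firstPair l tri → (x , y) ≡ (x′ , y′)
      same e = cong₂ _,_ (suc-injective (+-cancelˡ-≡ A _ _ (cong proj₁ (sym e))))
                         (suc-injective (+-cancelˡ-≡ A _ _ (cong proj₂ (sym e))))
      absurd : ¬ (firstPair l tri′ ≡ secondPair l tri)
      absurd e = <⇒≱ (≤-reflexive (sym x′≡)) (≤-trans (proj₂ tri′) (≤-trans (m≤n+m (fib l) A) (m≤n+m B x)))
        where
        x′≡ : suc x′ ≡ suc x + B
        x′≡ = +-cancelˡ-≡ A _ _ (trans (cong proj₁ e) (+-assoc A (suc x) B))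

  point-injective : ∀ {l l′ P P′} → InTriangle (fib l) P → InTriangle (fib l′) P′ →
    point l P ≡ point l′ P′ → (l , P) ≡ (l′ , P′)
  point-injective {l} {l′} {P} {P′} tri tri′ eq =
    glue (≤-antisym (level-≤ {l} {l′} tri tri′ eq) (level-≤ {l′} {l} tri′ tri (sym eq))) tri′ eq
    where
    glue : ∀ {l′} → l ≡ l′ → InTriangle (fib l′) P′ → point l P ≡ point l′ P′ → (l , P) ≡ (l′ , P′)
    glue refl tri′ eq = cong (l ,_) (point-injective-level {l} tri tri′ eq)

  private
    third : ∀ {X : Set} {P Q : X} {R S T : X} → R ≢ S → S ≢ T → R ≢ T →
      R ≡ P ⊎ R ≡ Q → S ≡ P ⊎ S ≡ Q → T ≡ P ⊎ T ≡ Q → ⊥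
    third rs st rt (inj₁ refl) (inj₁ refl) _           = rs refl
    third rs st rt (inj₁ refl) (inj₂ refl) (inj₁ refl) = rt refl
    third rs st rt (inj₁ refl) (inj₂ refl) (inj₂ refl) = st refl
    third rs st rt (inj₂ refl) (inj₂ refl) _           = rs refl
    third rs st rt (inj₂ refl) (inj₁ refl) (inj₁ refl) = st refl
    third rs st rt (inj₂ refl) (inj₁ refl) (inj₂ refl) = rt refl

    -- For `m ≥ 2` the walk from `(m - 1 , 1)` has third term `m`, so index two is not maximal; for
    -- `m = 1` every `(a , 1)` is good, and three of these already exceed the two allowed.
    index-two : ∀ m {P Q} → 1 ≤ m →
      (∀ b₁ b₂ j → 1 ≤ b₁ → 1 ≤ b₂ → 1 ≤ j → walk b₁ b₂ j ≡ m → j ≤ 2) →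
      (∀ R → Good m R → R ≡ P ⊎ R ≡ Q) → ⊥
    index-two (suc (suc c)) _ max _ with max (suc c) 1 3 (s≤s z≤n) ≤-refl (s≤s z≤n) refl
    ... | s≤s (s≤s ())
    index-two (suc zero) _ max only =
      third {R = 1 , 1} {S = 2 , 1} {T = 3 , 1} (λ ()) (λ ()) (λ ())
        (only _ (all-good 0)) (only _ (all-good 1)) (only _ (all-good 2))
      where
      all-good : ∀ i → Good 1 (suc i , 1)
      all-good i = s≤s z≤n , ≤-refl , 2 , s≤s z≤n , refl , max

  IsPoint : ℕ → Set
  IsPoint m = ∃ λ l → ∃ λ P → InTriangle (fib l) P × point l P ≡ m

  module _ {m l : ℕ} (max : ∀ b₁ b₂ j → 1 ≤ b₁ → 1 ≤ b₂ → 1 ≤ j → walk b₁ b₂ j ≡ m → j ≤ 3 + l) where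
    open Level l

    -- If `b` exceeded `a`, the walk could be extended to the left by the positive term `b - a` and
    -- would reach `m` one index later.
    second≤first : ∀ {a b} → 1 ≤ a → A * a + B * b ≡ m → b ≤ a
    second≤first {a} {b} pa rep with b ≤? a
    ... | yes b≤a = b≤a
    ... | no b≰a with m≤n⇒∃[o]m+o≡n (≰⇒> b≰a)
    ... | d , refl = ⊥-elim (<-irrefl refl (max (suc d) a (4 + l) (s≤s z≤n) pa (s≤s z≤n) hit))
      where
      hit : walk (suc d) a (4 + l) ≡ m
      hit = trans (walk-shift (suc d) a (2 + l)) (trans (walk-fib a (a + suc d) (1 + l))
        (trans (cong (λ z → A * a + B * z) (+-suc a d)) rep))

    solution-good : ∀ {a b} → 1 ≤ a → 1 ≤ b → A * a + B * b ≡ m → Good m (a , b)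
    solution-good {a} {b} pa pb rep = pa , pb , 3 + l , s≤s z≤n , trans (walk-fib a b (1 + l)) rep , max

    -- The step between the two solutions gives `b > A`, and `b ≤ a` then gives `a > A`; the
    -- remainders beyond `A` are the lattice coordinates.
    two-good-isPoint : ∀ {a b a′ b′} → 1 ≤ a → 1 ≤ b′ → a < a′ →
      A * a + B * b ≡ m → A * a′ + B * b′ ≡ m →
      (∀ R → Good m R → R ≡ (a , b) ⊎ R ≡ (a′ , b′)) → IsPoint m
    two-good-isPoint {a} {b} {a′} {b′} pa pb′ a<a′ rep rep′ only
      with solve-level {b = b} {b′ = b′} (<⇒≤ a<a′) (trans rep (sym rep′))
    ... | zero , a′≡ , _ = ⊥-elim (<-irrefl
            (sym (trans a′≡ (trans (cong (a +_) (*-zeroʳ B)) (+-identityʳ a)))) a<a′)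
    ... | suc t , a′≡ , b≡ with m≤n⇒∃[o]m+o≡n A<b | m≤n⇒∃[o]m+o≡n (≤-trans A<b (second≤first pa rep))
      where
      A<b : A < b
      A<b = ≤-trans (+-mono-≤ pb′ (m≤m*n A (suc t))) (≤-reflexive (sym b≡))
    ... | y , refl | x , refl = l , (x , y) , (+-cancelˡ-≤ (suc A) _ _ (second≤first pa rep) , x<g) , rep″
      where
      x<g : x < fib l
      x<g with suc A + x ≤? B
      ... | yes a≤B = +-cancelˡ-≤ A _ _ (≤-trans (≤-reflexive (+-suc A x)) a≤B)
      ... | no a≰B with m≤n⇒∃[o]m+o≡n (≰⇒> a≰B)
      -- If `a > B`, then `(a - B , b + A)`, with `a - B` equal to `suc o`, is still positive and
      -- would be a third good pair.
      ... | o , eqo = ⊥-elim (absurd (only (suc o , b + A)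
                         (solution-good (s≤s z≤n) (≤-trans (s≤s z≤n) (m≤m+n b A)) rep-o)))
        where
        move : ∀ A B o b → A * suc o + B * (b + A) ≡ A * (suc B + o) + B * b
        move = solve-∀
        rep-o : A * suc o + B * (b + A) ≡ m
        rep-o = trans (move A B o b) (trans (cong (λ z → A * z + B * b) eqo) rep)
        o<a : suc o < a
        o<a = ≤-trans (+-monoˡ-≤ o (s≤s (fib-pos (suc l)))) (≤-reflexive eqo)
        absurd : _ → ⊥
        absurd (inj₁ e) = <-irrefl (cong proj₁ e) o<a
        absurd (inj₂ e) = <-irrefl (cong proj₁ e) (<-trans o<a a<a′)
      expand : ∀ A g x y → A * (A + g + A) + A * suc x + (A + g) * suc y ≡ A * (suc A + x) + (A + g) * (suc A + y)
      expand = solve-∀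
      rep″ : point l (x , y) ≡ m
      rep″ = trans (expand A (fib l) x y) rep

  hasTwoGood-isPoint : ∀ {m} → 1 ≤ m → HasTwoGood m → IsPoint m
  hasTwoGood-isPoint {m} pm
    ((a , b) , (a′ , b′) , P≢Q , (pa , pb , k , pk , hit , max) , (pa′ , pb′ , k′ , pk′ , hit′ , max′) , only)
    with ≤-antisym (max′ a b k pa pb pk hit) (max a′ b′ k′ pa′ pb′ pk′ hit′)
  ... | refl = cases k hit hit′ max
    where
    cases : ∀ k → walk a b k ≡ m → walk a′ b′ k ≡ m →
      (∀ b₁ b₂ j → 1 ≤ b₁ → 1 ≤ b₂ → 1 ≤ j → walk b₁ b₂ j ≡ m → j ≤ k) → IsPoint m
    -- Index zero carries the junk value 0, which `1 ≤ m` excludes; index one is beaten by the walk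
    -- from `(1 , m)`.
    cases zero refl _ _ = ⊥-elim (n≮0 pm)
    cases (suc zero) _ _ max with max 1 m 2 ≤-refl pm (s≤s z≤n) refl
    ... | s≤s ()
    cases (suc (suc zero)) _ _ max = ⊥-elim (index-two m pm max only)
    cases (suc (suc (suc l))) hit hit′ max with <-cmp a a′
    ... | tri< lt _ _ = two-good-isPoint {l = l} max pa pb′ lt rep rep′ only
      where
      rep  = trans (sym (walk-fib a b (1 + l))) hit
      rep′ = trans (sym (walk-fib a′ b′ (1 + l))) hit′
    ... | tri> _ _ gt = two-good-isPoint {l = l} max pa′ pb gt rep′ rep (λ R g → swap (only R g))
      where
      rep  = trans (sym (walk-fib a b (1 + l))) hit
      rep′ = trans (sym (walk-fib a′ b′ (1 + l))) hit′
    ... | tri≈ _ refl _ = ⊥-elim (P≢Q (cong (a ,_) (Level.same-first l {a} {b} {b′} (trans rep (sym rep′)))))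
      where
      rep  = trans (sym (walk-fib a b (1 + l))) hit
      rep′ = trans (sym (walk-fib a b′ (1 + l))) hit′

  -- Counting with duplicate-free lists

  m<n∸o⇒m+o<n : ∀ {m n o} → m < n ∸ o → m + o < n
  m<n∸o⇒m+o<n {m} {n} {o} p with o ≤? n
  ... | yes o≤n = m≤o∸n⇒m+n≤o (suc m) o≤n p
  ... | no o≰n  = ⊥-elim (n≮0 (≤-trans p (≤-reflexive (m≤n⇒m∸n≡0 (<⇒≤ (≰⇒> o≰n))))))

  -- Injectivity is asked on the members only: `point l` separates the lattice points of a triangle,
  -- not all pairs of naturals.
  unique-map-on : ∀ {X Y : Set} (f : X → Y) {xs} → Unique xs →
    (∀ {x y} → x ∈ xs → y ∈ xs → f x ≡ f y → x ≡ y) → Unique (map f xs)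
  unique-map-on f []            inj = []
  unique-map-on f (x∉xs ∷ uniq) inj =
    All.map⁺ (All.tabulate (λ {y} y∈ e → All.lookup x∉xs y∈ (inj (here refl) (there y∈) e)))
    ∷ unique-map-on f uniq (λ p q → inj (there p) (there q))

  -- The set to be counted is known only through membership, so its size is found by comparison:
  -- duplicate-free lists with the same members are permutations of each other.
  length-bijection : ∀ {X Y : Set} (f : X → Y) {xs ys} → Unique xs → Unique ys →
    (∀ {x y} → x ∈ xs → y ∈ xs → f x ≡ f y → x ≡ y) →
    (∀ {x} → x ∈ xs → f x ∈ ys) → (∀ {y} → y ∈ ys → ∃ λ x → x ∈ xs × f x ≡ y) →
    length xs ≡ length ys
  length-bijection f {xs} {ys} ux uy inj into onto = trans (sym (length-map f xs))
    (↭-length (∼bag⇒↭ (unique∧set⇒bag (unique-map-on f ux inj) uy (mk⇔ to from))))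
    where
    to : ∀ {z} → z ∈ map f xs → z ∈ ys
    to z∈ with ∈-map⁻ f z∈
    ... | x , x∈ , refl = into x∈
    from : ∀ {z} → z ∈ ys → z ∈ map f xs
    from z∈ with onto z∈
    ... | x , x∈ , refl = ∈-map⁺ f x∈

  ∑ : (ℕ → ℕ) → ℕ → ℕ
  ∑ f zero    = 0
  ∑ f (suc n) = f n + ∑ f n

  ∑-cong : ∀ {f g} → (∀ i → f i ≡ g i) → ∀ n → ∑ f n ≡ ∑ g n
  ∑-cong eq zero    = refl
  ∑-cong eq (suc n) = cong₂ _+_ (eq n) (∑-cong eq n)

  module _ {X : Set} (row : ℕ → List X) where
    rows : ℕ → List (ℕ × X)
    rows zero    = []
    rows (suc n) = map (n ,_) (row n) ++ rows n

    length-rows : ∀ n → length (rows n) ≡ ∑ (λ i → length (row i)) n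
    length-rows zero    = refl
    length-rows (suc n) = trans (length-++ (map (n ,_) (row n)))
      (cong₂ _+_ (length-map (n ,_) (row n)) (length-rows n))

    ∈-rows⁺ : ∀ {n i x} → i < n → x ∈ row i → (i , x) ∈ rows n
    ∈-rows⁺ {suc n} {i} i<n x∈ with m≤n⇒m<n∨m≡n (s≤s⁻¹ i<n)
    ... | inj₁ i<n′ = ∈-++⁺ʳ (map (n ,_) (row n)) (∈-rows⁺ i<n′ x∈)
    ... | inj₂ refl = ∈-++⁺ˡ (∈-map⁺ (n ,_) x∈)

    ∈-rows⁻ : ∀ n {i x} → (i , x) ∈ rows n → i < n × x ∈ row i
    ∈-rows⁻ (suc n) ix∈ with ∈-++⁻ (map (n ,_) (row n)) ix∈
    ... | inj₂ later = let i<n , x∈ = ∈-rows⁻ n later in m<n⇒m<1+n i<n , x∈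
    ... | inj₁ now with ∈-map⁻ (n ,_) now
    ... | x , x∈ , refl = ≤-refl , x∈

    unique-rows : (∀ i → Unique (row i)) → ∀ n → Unique (rows n)
    unique-rows u zero    = []
    unique-rows u (suc n) = ++⁺ (map⁺ (cong proj₂) (u n)) (unique-rows u n) disjoint
      where
      disjoint : ∀ {ix} → ¬ (ix ∈ map (n ,_) (row n) × ix ∈ rows n)
      disjoint (now , later) with ∈-map⁻ (n ,_) now
      ... | x , _ , refl = <-irrefl refl (proj₁ (∈-rows⁻ n later))

  triangle : ℕ → List (ℕ × ℕ)
  triangle = rows (λ x → upTo (suc x))

  ∈-triangle⁺ : ∀ {g P} → InTriangle g P → P ∈ triangle g
  ∈-triangle⁺ (y≤x , x<g) = ∈-rows⁺ _ x<g (∈-upTo⁺ (s≤s y≤x))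

  ∈-triangle⁻ : ∀ {g P} → P ∈ triangle g → InTriangle g P
  ∈-triangle⁻ {g} P∈ = let x<g , y∈ = ∈-rows⁻ _ g P∈ in s≤s⁻¹ (∈-upTo⁻ y∈) , x<g

  unique-triangle : ∀ g → Unique (triangle g)
  unique-triangle = unique-rows _ (λ x → upTo⁺ (suc x))

  length-triangle : ∀ g → 2 * length (triangle g) ≡ g * suc g
  length-triangle g = trans (cong (2 *_) (trans (length-rows _ g) (∑-cong (λ x → length-upTo (suc x)) g))) (gauss g)
    where
    step : ∀ g z → 2 * (suc g + z) ≡ 2 * suc g + 2 * z
    step = solve-∀
    merge : ∀ g → 2 * suc g + g * suc g ≡ suc g * suc (suc g)
    merge = solve-∀
    gauss : ∀ g → 2 * ∑ suc g ≡ g * suc g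
    gauss zero    = refl
    gauss (suc g) = trans (step g (∑ suc g)) (trans (cong (2 * suc g +_) (gauss g)) (merge g))

  levels : ℕ → List (ℕ × (ℕ × ℕ))
  levels = rows (λ l → triangle (fib l))

  ∈-levels⁺ : ∀ {i l P} → l < i → InTriangle (fib l) P → (l , P) ∈ levels i
  ∈-levels⁺ l<i tri = ∈-rows⁺ _ l<i (∈-triangle⁺ tri)

  ∈-levels⁻ : ∀ {i l P} → (l , P) ∈ levels i → l < i × InTriangle (fib l) P
  ∈-levels⁻ {i} lP∈ = let l<i , P∈ = ∈-rows⁻ _ i lP∈ in l<i , ∈-triangle⁻ P∈

  unique-levels : ∀ i → Unique (levels i)
  unique-levels = unique-rows _ (λ l → unique-triangle (fib l))

  -- The squares `F(l)²` with `l < i` sum to `F(i) F(i+1) - F(i)²` and the numbers `F(l)` to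
  -- `F(i+1) - 1`; moving the negative terms to the left avoids subtraction.
  length-levels : ∀ i → 2 * length (levels i) + (fib i * fib i + 1) ≡ fib i * fib (1 + i) + fib (1 + i)
  length-levels i = trans (cong (λ z → 2 * z + (fib i * fib i + 1)) (length-rows _ i)) (go i)
    where
    s : ℕ → ℕ
    s = ∑ (λ l → length (triangle (fib l)))
    finish : ∀ a b → a * suc a + (a * b + b) + b * b ≡ b * (b + a) + (b + a) + a * a
    finish = solve-∀
    shuffle : ∀ t z a b → 2 * (t + z) + (b * b + 1) + a * a ≡ 2 * t + (2 * z + (a * a + 1)) + b * b
    shuffle = solve-∀
    go : ∀ i → 2 * s i + (fib i * fib i + 1) ≡ fib i * fib (1 + i) + fib (1 + i)
    go zero    = refl
    go (suc i) = +-cancelʳ-≡ (a * a) _ _ (trans (shuffle (length (triangle a)) (s i) a b)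
      (trans (cong₂ (λ u v → u + v + b * b) (length-triangle a) (go i)) (finish a b)))
      where
      a = fib i
      b = fib (suc i)

  -- Lattice points below a line

  ceil : (β : ℕ) .{{_ : NonZero β}} → ℕ → ℕ
  ceil β M = (M + pred β) / β

  ceil-upper : ∀ β .{{_ : NonZero β}} M → β * ceil β M ≤ M + pred β
  ceil-upper β M = ≤-trans (≤-reflexive (*-comm β (ceil β M))) (m/n*n≤m (M + pred β) β)

  ceil-lower : ∀ β .{{_ : NonZero β}} M → M ≤ β * ceil β M
  ceil-lower (suc β) M = +-cancelʳ-≤ β _ _
    (≤-trans (≤-reflexive (m≡m%n+[m/n]*n (M + β) (suc β)))
      (≤-trans (+-monoˡ-≤ _ (s≤s⁻¹ (m%n<n (M + β) (suc β))))
        (≤-reflexive (trans (+-comm β _) (cong (_+ β) (*-comm _ (suc β)))))))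

  ceil-< : ∀ β .{{_ : NonZero β}} {v M} → v < ceil β M → β * v < M
  ceil-< (suc β) {v} {M} v<c = +-cancelʳ-≤ β _ _
    (≤-trans (≤-trans (≤-reflexive (trans (sym (+-suc (suc β * v) β)) (trans (+-comm _ (suc β)) (sym (*-suc (suc β) v)))))
      (*-monoʳ-≤ (suc β) v<c)) (ceil-upper (suc β) M))

  <-ceil : ∀ β .{{_ : NonZero β}} {v M} → β * v < M → v < ceil β M
  <-ceil β {v} {M} βv<M = *-cancelˡ-< β _ _ (≤-trans βv<M (ceil-lower β M))

  ceil-zero : ∀ β .{{_ : NonZero β}} → ceil β 0 ≡ 0
  ceil-zero β = n<1⇒n≡0 (*-cancelˡ-< β _ _ (≤-trans (s≤s (ceil-upper β 0))
    (≤-reflexive (trans (suc-pred β) (sym (*-identityʳ β))))))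

  module Staircase (α β : ℕ) .{{_ : NonZero α}} .{{_ : NonZero β}} where
    -- `ceil β x` counts the `v ≥ 0` with `β * v < x`; truncated subtraction makes the rows beyond
    -- the hypotenuse empty.
    rowLength : ℕ → ℕ → ℕ
    rowLength M u = ceil β (M ∸ α * u)

    below : ℕ → List (ℕ × ℕ)
    -- Since `α ≥ 1`, every `u` that occurs is less than `M`.
    below M = rows (λ u → upTo (rowLength M u)) M

    ∈-below⁺ : ∀ {M u v} → α * u + β * v < M → (u , v) ∈ below M
    ∈-below⁺ {M} {u} {v} lt = ∈-rows⁺ _
      (≤-<-trans (m≤n*m u α) (≤-<-trans (m≤m+n _ _) lt))
      (∈-upTo⁺ (<-ceil β (m+n≤o⇒m≤o∸n _ (≤-trans (≤-reflexive (cong suc (+-comm (β * v) (α * u)))) lt))))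

    ∈-below⁻ : ∀ {M u v} → (u , v) ∈ below M → α * u + β * v < M
    ∈-below⁻ {M} {u} {v} uv∈ = ≤-trans (≤-reflexive (cong suc (+-comm (α * u) (β * v))))
        (m<n∸o⇒m+o<n (ceil-< β (∈-upTo⁻ (proj₂ (∈-rows⁻ _ M uv∈)))))

    unique-below : ∀ M → Unique (below M)
    unique-below = λ M → unique-rows _ (λ u → upTo⁺ (rowLength M u)) M

    private
      length-below : ∀ M → length (below M) ≡ ∑ (rowLength M) M
      length-below M = trans (length-rows _ M) (∑-cong (λ u → length-upTo (rowLength M u)) M)

      ∸-step : ∀ M U → M ∸ α * suc U ≡ (M ∸ α * U) ∸ α
      ∸-step M U = trans (cong (M ∸_) (trans (*-suc α U) (+-comm α (α * U)))) (sym (∸-+-assoc M (α * U) α))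

      -- One step of a telescoping sum; for `x ≥ α` the two sides differ by exactly `α²`.
      square-step : ∀ x → x * x ≤ 2 * α * x + (x ∸ α) * (x ∸ α)
      square-step x with α ≤? x
      ... | no nle = ≤-trans (*-monoˡ-≤ x (≤-trans (<⇒≤ (≰⇒> nle)) (m≤m+n α (1 * α)))) (m≤m+n _ _)
      ... | yes le with m≤n⇒∃[o]m+o≡n le
      ... | d , refl = ≤-trans (m≤m+n _ (α * α))
            (≤-reflexive (trans (square α d) (cong (λ z → 2 * α * (α + d) + z * z) (sym (m+n∸m≡n α d)))))
        where
        square : ∀ α d → (α + d) * (α + d) + α * α ≡ 2 * α * (α + d) + d * d
        square = solve-∀

      -- Scaled by `2αβ`, the columns `u < U` cover the triangle up to `U`; the final square is the
      -- scaled area of the similar triangle that remains. At `U = M` it vanishes.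
      lower : ∀ M U → M * M ≤ 2 * (α * β) * ∑ (rowLength M) U + (M ∸ α * U) * (M ∸ α * U)
      lower M zero    = ≤-reflexive (sym (trans (cong₂ _+_ (*-zeroʳ (2 * (α * β)))
        (cong₂ _*_ (cong (M ∸_) (*-zeroʳ α)) (cong (M ∸_) (*-zeroʳ α)))) refl))
      lower M (suc U) rewrite ∸-step M U = ≤-trans (lower M U)
        (≤-trans (+-monoʳ-≤ (2 * (α * β) * s) (≤-trans (square-step x) (+-monoˡ-≤ y (*-monoʳ-≤ (2 * α) (ceil-lower β x)))))
          (≤-reflexive (collect α β s (ceil β x) y)))
        where
        s = ∑ (rowLength M) U
        x = M ∸ α * U
        y = (x ∸ α) * (x ∸ α)
        collect : ∀ α β s r y → 2 * (α * β) * s + (2 * α * (β * r) + y) ≡ 2 * (α * β) * (r + s) + y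
        collect = solve-∀

      -- Rounding up adds less than `β` to a column. Enlarging the leg by `α + β` pays for this,
      -- because `2α(d + β) + (d + β)² + α² = (d + α + β)²`, where `d` is the part of `M` left at
      -- column `U`.
      upper : ∀ M U → 2 * (α * β) * ∑ (rowLength M) U + (M + α + β ∸ α * U) * (M + α + β ∸ α * U)
                      ≤ (M + α + β) * (M + α + β)
      upper M zero rewrite *-zeroʳ (2 * (α * β)) | *-zeroʳ α = ≤-refl
      upper M (suc U) with α * U <? M
      -- Past the hypotenuse the row is empty and the remaining square can only shrink.
      ... | no nlt = ≤-trans (+-mono-≤ (≤-reflexive (cong (λ r → 2 * (α * β) * (r + ∑ (rowLength M) U)) row≡0))
                       (*-mono-≤ shrink shrink)) (upper M U)
        where
        row≡0 : rowLength M U ≡ 0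
        row≡0 = trans (cong (λ x → ceil β x) (m≤n⇒m∸n≡0 (≮⇒≥ nlt))) (ceil-zero β)
        shrink : M + α + β ∸ α * suc U ≤ M + α + β ∸ α * U
        shrink = ∸-monoʳ-≤ (M + α + β) (*-monoʳ-≤ α (n≤1+n U))
      ... | yes lt with m≤n⇒∃[o]m+o≡n (<⇒≤ lt)
      ... | d , refl = ≤-trans bound (upper (α * U + d) U)
        where
        s = ∑ (rowLength (α * U + d)) U
        r = rowLength (α * U + d) U
        left : ∀ x d α β → x + d + α + β ≡ x + (d + α + β)
        left = solve-∀
        left′ : ∀ α U d β → α * U + d + α + β ≡ α * suc U + (d + β)
        left′ = solve-∀
        e₁ : α * U + d + α + β ∸ α * U ≡ d + α + β
        e₁ = trans (cong (_∸ α * U) (left (α * U) d α β)) (m+n∸m≡n (α * U) _)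
        e₂ : α * U + d + α + β ∸ α * suc U ≡ d + β
        e₂ = trans (cong (_∸ α * suc U) (left′ α U d β)) (m+n∸m≡n (α * suc U) _)
        r≤ : β * r ≤ d + β
        r≤ = ≤-trans (ceil-upper β (α * U + d ∸ α * U))
               (≤-trans (≤-reflexive (cong (_+ pred β) (m+n∸m≡n (α * U) d))) (+-monoʳ-≤ d (pred[n]≤n {β})))
        collect : ∀ α β r s x → 2 * (α * β) * (r + s) + x * x ≡ 2 * (α * β) * s + (2 * α * (β * r) + x * x)
        collect = solve-∀
        square : ∀ α d β → 2 * α * (d + β) + (d + β) * (d + β) + α * α ≡ (d + α + β) * (d + α + β)
        square = solve-∀
        bound : 2 * (α * β) * (r + s) + (α * U + d + α + β ∸ α * suc U) * (α * U + d + α + β ∸ α * suc U)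
                ≤ 2 * (α * β) * s + (α * U + d + α + β ∸ α * U) * (α * U + d + α + β ∸ α * U)
        bound rewrite e₁ | e₂ = ≤-trans (≤-reflexive (collect α β r s (d + β)))
          (+-monoʳ-≤ (2 * (α * β) * s) (≤-trans (+-monoˡ-≤ _ (*-monoʳ-≤ (2 * α) r≤))
            (≤-trans (m≤m+n _ (α * α)) (≤-reflexive (square α d β)))))

    length-below-lower : ∀ M → M * M ≤ 2 * (α * β) * length (below M)
    length-below-lower M rewrite length-below M = ≤-trans (lower M M)
      (≤-reflexive (trans (cong (λ z → 2 * (α * β) * ∑ (rowLength M) M + z * z) (m≤n⇒m∸n≡0 (m≤n*m M α))) (+-identityʳ _)))

    length-below-upper : ∀ M → 2 * (α * β) * length (below M) ≤ (M + α + β) * (M + α + β)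
    length-below-upper M rewrite length-below M = ≤-trans (m≤m+n _ _) (upper M M)

  -- The range of each level and the exact counts

  fib-mono-≤ : ∀ {m n} → m ≤ n → fib m ≤ fib n
  fib-mono-≤ {m} m≤n with m≤n⇒∃[o]m+o≡n m≤n
  ... | d , refl = ≤-trans (go d) (≤-reflexive (cong fib (+-comm d m)))
    where
    go : ∀ d → fib m ≤ fib (d + m)
    go zero    = ≤-refl
    go (suc d) = ≤-trans (go d) (fib-mono (d + m))

  -- The largest point of level `l` is the corner `x = y = fib l - 1`, of value
  -- `fib (2 + l) * fib (3 + l)`, which grows with `l`.
  point-≤ : ∀ {i l P} → l < i → InTriangle (fib l) P → point l P ≤ fib (1 + i) * fib (2 + i)
  point-≤ {i} {l} {x , y} l<i (y≤x , x<g) =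
    ≤-trans (+-mono-≤ (+-monoʳ-≤ _ (*-monoʳ-≤ (fib (1 + l)) x<g))
                      (*-monoʳ-≤ (fib (2 + l)) (≤-trans (s≤s y≤x) x<g)))
      (≤-trans (≤-reflexive (collect (fib (1 + l)) (fib l)))
        (*-mono-≤ (fib-mono-≤ (s≤s l<i)) (fib-mono-≤ (s≤s (s≤s l<i)))))
    where
    collect : ∀ A g → A * (A + g + A) + A * g + (A + g) * g ≡ (A + g) * (A + g + A)
    collect = solve-∀

  -- The corner `x = y = 0` has value `fib (1 + l) * fib (3 + l) + fib (3 + l)`, and this too grows
  -- with `l`.
  point-≥ : ∀ {i l} P → i ≤ l → fib (1 + i) * fib (3 + i) + fib (3 + i) ≤ point l P
  point-≥ {i} {l} (x , y) i≤l =
    ≤-trans (+-mono-≤ (*-mono-≤ (fib-mono-≤ (s≤s i≤l)) C≤C) C≤C)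
      (≤-trans (m≤m+n _ _) (≤-reflexive (collect (fib (1 + l)) (fib (2 + l)) x y)))
    where
    C≤C : fib (3 + i) ≤ fib (3 + l)
    C≤C = fib-mono-≤ (s≤s (s≤s (s≤s i≤l)))
    collect : ∀ A B x y → A * (B + A) + (B + A) + (A * x + B * y) ≡ A * (B + A) + A * suc x + B * suc y
    collect = solve-∀

  module Counting {n : ℕ} {S : List ℕ} (uniqueS : Unique S)
    (spec : ∀ m → (m ∈ S → 1 ≤ m × m ≤ n × HasTwoGood m) × (1 ≤ m × m ≤ n × HasTwoGood m → m ∈ S)) where

    private
      pt : ℕ × (ℕ × ℕ) → ℕ
      pt (l , P) = point l P

      ∈S⁻ : ∀ {m} → m ∈ S → m ≤ n × IsPoint m
      ∈S⁻ m∈ = let pm , m≤n , two = proj₁ (spec _) m∈ in m≤n , hasTwoGood-isPoint pm two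

      ∈S⁺ : ∀ l {P} → InTriangle (fib l) P → point l P ≤ n → point l P ∈ S
      ∈S⁺ l {P} tri le = proj₂ (spec _) (≤-trans (s≤s z≤n) (≤-trans (m≤n+m (fib 3) (fib 1 * fib 3)) (point-≥ {0} {l} P z≤n))
                                        , le , point-hasTwoGood l tri)

      pt-injective : ∀ {i l l′ P P′} → (l , P) ∈ levels i → (l′ , P′) ∈ levels i →
        point l P ≡ point l′ P′ → (l , P) ≡ (l′ , P′)
      pt-injective {i} {l} {l′} p q = point-injective {l} {l′} (proj₂ (∈-levels⁻ {i} p)) (proj₂ (∈-levels⁻ {i} q))

    -- No point lies between the top corner of level `i - 1` and the bottom corner of level `i`, so
    -- the count is constant there.
    count-full-levels : ∀ i → fib (1 + i) * fib (2 + i) ≤ n → n < fib (1 + i) * fib (3 + i) + fib (3 + i) →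
      length (levels i) ≡ length S
    count-full-levels i lo hi =
      length-bijection pt (unique-levels i) uniqueS (pt-injective {i}) into onto
      where
      into : ∀ {x} → x ∈ levels i → pt x ∈ S
      into {l , P} x∈ = let l<i , tri = ∈-levels⁻ {i} x∈ in ∈S⁺ l tri (≤-trans (point-≤ l<i tri) lo)
      onto : ∀ {m} → m ∈ S → ∃ λ x → x ∈ levels i × pt x ≡ m
      onto m∈ with ∈S⁻ m∈
      ... | m≤n , l , P , tri , refl with l <? i
      ... | yes l<i = (l , P) , ∈-levels⁺ l<i tri , refl
      ... | no l≮i  = ⊥-elim (<⇒≱ hi (≤-trans (point-≥ P (≮⇒≥ l≮i)) m≤n))

    module _ (j : ℕ) where
      private
        g A B C : ℕ
        g = fib j
        A = fib (1 + j)
        B = fib (2 + j)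
        C = fib (3 + j)

        instance
          A-nonZero : NonZero A
          A-nonZero = >-nonZero (fib-pos j)
          B-nonZero : NonZero B
          B-nonZero = >-nonZero (fib-pos (1 + j))
          C-nonZero : NonZero C
          C-nonZero = >-nonZero (fib-pos (2 + j))

        above : ∀ {l} P → j < l → B * fib (4 + j) < point l P
        above P j<l = ≤-trans (m<m+n _ (fib-pos (3 + j))) (point-≥ P j<l)

      module First = Staircase C A
      module Second = Staircase C B

      -- With `y = u` and `x = u + z` the side `y ≤ x` becomes `z ≥ 0`, and the value of a point has
      -- slopes `C` and `A`. Because `2AB = AC + Ag`, a point of value at most `n ≤ 2AB` satisfies
      -- `x < g` by itself, so the included part is a whole staircase.
      count-small-part : A * C ≤ n → n ≤ 2 * (A * B) →
        length (levels j) + length (First.below (suc n ∸ (A * C + C))) ≡ length S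
      count-small-part lo hi = trans (sym length-all)
          (length-bijection pt unique-all uniqueS (λ p q → inj (valid p) (valid q)) into onto)
        where
        M : ℕ
        -- The offset is the value at `u = z = 0`; the successor turns "at most `n`" into the strict
        -- inequality of the staircase.
        M = suc n ∸ (A * C + C)
        embed : ℕ × ℕ → ℕ × (ℕ × ℕ)
        embed (u , z) = j , (u + z , u)
        all : List (ℕ × (ℕ × ℕ))
        all = levels j ++ map embed (First.below M)
        length-all : length all ≡ length (levels j) + length (First.below M)
        length-all = trans (length-++ (levels j)) (cong (length (levels j) +_) (length-map embed (First.below M)))
        embed-injective : ∀ {x y} → embed x ≡ embed y → x ≡ y
        embed-injective {u , z} {u′ , z′} e with cong (λ x → proj₂ (proj₂ x)) e
        ... | refl = cong (u ,_) (+-cancelˡ-≡ u z z′ (cong (λ x → proj₁ (proj₂ x)) e))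
        unique-all : Unique all
        unique-all = ++⁺ (unique-levels j) (map⁺ embed-injective (First.unique-below M)) disjoint
          where
          disjoint : ∀ {x} → ¬ (x ∈ levels j × x ∈ map embed (First.below M))
          disjoint (p , q) with ∈-map⁻ embed q
          ... | _ , _ , refl = <-irrefl refl (proj₁ (∈-levels⁻ {j} p))
        point-embed : ∀ A B u z → A * (B + A) + A * suc (u + z) + B * suc u ≡ A * (B + A) + (B + A) + ((B + A) * u + A * z)
        point-embed = solve-∀
        double : ∀ A g → 2 * (A * (A + g)) ≡ A * (A + g + A) + A * g
        double = solve-∀
        reach : ∀ {u z} → (u , z) ∈ First.below M → point j (u + z , u) ≤ n
        reach {u} {z} uz∈ = s≤s⁻¹ (≤-trans (s≤s (≤-reflexive (trans (point-embed A B u z) (+-comm (A * C + C) _))))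
          (m<n∸o⇒m+o<n (First.∈-below⁻ {M} {u} {z} uz∈)))
        inside : ∀ {u z} → (u , z) ∈ First.below M → InTriangle g (u + z , u)
        inside {u} {z} uz∈ = m≤m+n u z , *-cancelˡ-≤ A (+-cancelˡ-≤ (A * C) _ _
          (≤-trans (m≤m+n _ (B * suc u)) (≤-trans (reach uz∈) (≤-trans hi (≤-reflexive (double A g))))))
        valid : ∀ {x} → x ∈ all → InTriangle (fib (proj₁ x)) (proj₂ x) × pt x ≤ n
        valid {x} x∈ with ∈-++⁻ (levels j) x∈
        ... | inj₁ p = let l<j , tri = ∈-levels⁻ {j} p in
                       tri , ≤-trans (point-≤ l<j tri) (≤-trans (*-monoʳ-≤ A (fib-mono (2 + j))) lo)
        ... | inj₂ q with ∈-map⁻ embed q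
        ... | (u , z) , uz∈ , refl = inside uz∈ , reach uz∈
        inj : ∀ {x y} → InTriangle (fib (proj₁ x)) (proj₂ x) × pt x ≤ n → InTriangle (fib (proj₁ y)) (proj₂ y) × pt y ≤ n →
          pt x ≡ pt y → x ≡ y
        inj {l , _} {l′ , _} (p , _) (q , _) = point-injective {l} {l′} p q
        into : ∀ {x} → x ∈ all → pt x ∈ S
        into {l , P} x∈ = let tri , le = valid x∈ in ∈S⁺ l tri le
        2A≤ : 2 * A ≤ fib (4 + j)
        2A≤ = +-mono-≤ (≤-trans (fib-mono (1 + j)) (fib-mono (2 + j))) (≤-trans (≤-reflexive (+-identityʳ A)) (fib-mono (1 + j)))
        swap₂ : ∀ A B → 2 * (A * B) ≡ B * (2 * A)
        swap₂ = solve-∀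
        onto : ∀ {m} → m ∈ S → ∃ λ x → x ∈ all × pt x ≡ m
        onto m∈ with ∈S⁻ m∈
        ... | m≤n , l , (x , y) , tri , refl with <-cmp l j
        ... | tri< l<j _ _ = (l , x , y) , ∈-++⁺ˡ (∈-levels⁺ l<j tri) , refl
        ... | tri> _ _ j<l = ⊥-elim (<⇒≱ (above (x , y) j<l) (≤-trans m≤n (≤-trans hi
                (≤-trans (≤-reflexive (swap₂ A B)) (*-monoʳ-≤ B 2A≤)))))
        ... | tri≈ _ refl _ with m≤n⇒∃[o]m+o≡n (proj₁ tri)
        ... | z , refl = embed (y , z) , ∈-++⁺ʳ (levels j) (∈-map⁺ embed (First.∈-below⁺ {M} {y} {z}
                (m+n≤o⇒m≤o∸n _ (s≤s (≤-trans (≤-reflexive (trans (+-comm _ (A * C + C)) (sym (point-embed A B y z)))) m≤n))))) , refl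

      -- Measured from the top corner by `u = g - 1 - x` and `v = x - y`, a point has value
      -- `BC - Cu - Bv`. Since `BC = 2AB + Bg`, the lower bound on `n` gives `BC - n ≤ Bg`, so
      -- `u + v < g`, the side `y ≥ 0`, holds throughout the excluded staircase.
      count-large-part : 2 * (A * B) ≤ n → n ≤ B * C →
        length (levels (suc j)) ≡ length S + length (Second.below (B * C ∸ n))
      count-large-part lo hi = trans
          (length-bijection pt (unique-levels (suc j)) unique-all (pt-injective {suc j}) into onto) length-all
        where
        M : ℕ
        M = B * C ∸ n
        n+M : n + M ≡ B * C
        n+M = m+[n∸m]≡n hi
        reflect : ℕ × ℕ → ℕ × ℕ
        reflect (u , v) = g ∸ suc u , g ∸ suc (u + v)
        reflected : ℕ × ℕ → ℕ
        reflected Q = point j (reflect Q)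
        all : List ℕ
        all = S ++ map reflected (Second.below M)
        length-all : length all ≡ length S + length (Second.below M)
        length-all = trans (length-++ S) (cong (length S +_) (length-map reflected (Second.below M)))
        factor : ∀ A g → (A + g) * (A + g + A) ≡ 2 * (A * (A + g)) + (A + g) * g
        factor = solve-∀
        inside : ∀ {u v} → (u , v) ∈ Second.below M → u + v < g
        inside {u} {v} uv∈ = *-cancelˡ-< B _ _ (≤-<-trans
          (≤-trans (≤-reflexive (*-distribˡ-+ B u v)) (+-monoˡ-≤ (B * v) (*-monoˡ-≤ u (fib-mono (2 + j)))))
          (≤-trans (Second.∈-below⁻ {M} {u} {v} uv∈) M≤Bg))
          where
          M≤Bg : M ≤ B * g
          M≤Bg = +-cancelˡ-≤ n _ _ (≤-trans (≤-reflexive n+M)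
            (≤-trans (≤-reflexive (factor A g)) (+-monoˡ-≤ (B * g) lo)))
        reflect-x : ∀ {u v} → u + v < g → suc u + (g ∸ suc u) ≡ g
        reflect-x lt = m+[n∸m]≡n (≤-trans (s≤s (m≤m+n _ _)) lt)
        reflect-y : ∀ {u v} → u + v < g → (g ∸ suc (u + v)) + v ≡ g ∸ suc u
        reflect-y {u} {v} lt = +-cancelˡ-≡ (suc u) _ _ (trans (rearrange (suc u) (g ∸ suc (u + v)) v)
          (trans (m+[n∸m]≡n lt) (sym (reflect-x lt))))
          where
          rearrange : ∀ a b c → a + (b + c) ≡ a + c + b
          rearrange = solve-∀
        tri-reflect : ∀ {u v} → u + v < g → InTriangle g (reflect (u , v))
        tri-reflect {u} {v} lt = ≤-trans (m≤m+n _ v) (≤-reflexive (reflect-y {u} {v} lt))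
                         , ≤-trans (s≤s (m≤n+m (g ∸ suc u) u)) (≤-reflexive (reflect-x {u} {v} lt))
        total : ∀ {u v x y} → suc u + x ≡ g → y + v ≡ x → point j (x , y) + (C * u + B * v) ≡ B * C
        total {u} {v} {x} {y} ex refl = trans (identity A B u v y) (trans (cong (λ z → A * C + C * z) ex) (close A g))
          where
          identity : ∀ A B u v y → A * (B + A) + A * suc (y + v) + B * suc y + ((B + A) * u + B * v)
                                  ≡ A * (B + A) + (B + A) * (suc (u + (y + v)))
          identity = solve-∀
          close : ∀ A g → A * (A + g + A) + (A + g + A) * g ≡ (A + g) * (A + g + A)
          close = solve-∀
        beyond : ∀ {Q} → Q ∈ Second.below M → n < reflected Q
        beyond {u , v} uv∈ = +-cancelʳ-< M n _ (≤-<-trans (≤-reflexive (trans n+M (sym (total {u} {v} (reflect-x {u} {v} (inside uv∈)) (reflect-y {u} {v} (inside uv∈))))))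
          (+-monoʳ-< (reflected (u , v)) (Second.∈-below⁻ {M} {u} {v} uv∈)))
        reflect-injective : ∀ {Q Q′} → Q ∈ Second.below M → Q′ ∈ Second.below M → reflected Q ≡ reflected Q′ → Q ≡ Q′
        reflect-injective {u , v} {u′ , v′} p q e = cong₂ _,_ u≡ v≡
          where
          same : reflect (u , v) ≡ reflect (u′ , v′)
          same = cong proj₂ (point-injective {j} {j} (tri-reflect {u} {v} (inside p)) (tri-reflect {u′} {v′} (inside q)) e)
          u≡ : u ≡ u′
          u≡ = suc-injective (+-cancelʳ-≡ (g ∸ suc u) _ _ (trans (reflect-x {u} {v} (inside p))
            (trans (sym (reflect-x {u′} {v′} (inside q))) (cong (suc u′ +_) (sym (cong proj₁ same))))))
          v≡ : v ≡ v′
          v≡ = +-cancelˡ-≡ (g ∸ suc (u + v)) _ _ (trans (reflect-y {u} {v} (inside p)) (trans (cong proj₁ same)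
            (trans (sym (reflect-y {u′} {v′} (inside q))) (cong (_+ v′) (sym (cong proj₂ same))))))
        unique-all : Unique all
        unique-all = ++⁺ uniqueS (unique-map-on reflected (Second.unique-below M) reflect-injective) disjoint
          where
          disjoint : ∀ {m} → ¬ (m ∈ S × m ∈ map reflected (Second.below M))
          disjoint (p , q) with ∈-map⁻ reflected q
          ... | Q , Q∈ , refl = <⇒≱ (beyond Q∈) (proj₁ (∈S⁻ p))
        into : ∀ {x} → x ∈ levels (suc j) → pt x ∈ all
        into {l , x , y} x∈ with ∈-levels⁻ {suc j} x∈
        ... | l<1+j , tri with point l (x , y) ≤? n
        ... | yes le = ∈-++⁺ˡ (∈S⁺ l tri le)
        ... | no nle with m≤n⇒m<n∨m≡n (s≤s⁻¹ l<1+j)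
        ... | inj₁ l<j = ⊥-elim (nle (≤-trans (point-≤ l<j tri) (≤-trans (m≤m+n _ _) lo)))
        ... | inj₂ refl with m≤n⇒∃[o]m+o≡n (proj₁ tri) | m≤n⇒∃[o]m+o≡n (proj₂ tri)
        ... | v , refl | u , eq = ∈-++⁺ʳ S (subst (_∈ map reflected (Second.below M)) same
                (∈-map⁺ reflected (Second.∈-below⁺ {M} {u} {v} uv<M)))
          where
          ex : suc u + (y + v) ≡ g
          ex = trans (cong suc (+-comm u (y + v))) eq
          uv<M : C * u + B * v < M
          uv<M = +-cancelˡ-< n _ _ (<-≤-trans (+-monoˡ-< (C * u + B * v) (≰⇒> nle))
            (≤-reflexive (trans (total {u} {v} ex refl) (sym n+M))))
          xe : g ∸ suc u ≡ y + v
          xe = trans (cong (_∸ suc u) (sym ex)) (m+n∸m≡n (suc u) (y + v))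
          rearrange : ∀ u y v → suc u + (y + v) ≡ suc (u + v) + y
          rearrange = solve-∀
          ye : g ∸ suc (u + v) ≡ y
          ye = trans (cong (_∸ suc (u + v)) (trans (sym ex) (rearrange u y v))) (m+n∸m≡n (suc (u + v)) y)
          same : reflected (u , v) ≡ point j (y + v , y)
          same = cong (point j) (cong₂ _,_ xe ye)
        onto : ∀ {m} → m ∈ all → ∃ λ x → x ∈ levels (suc j) × pt x ≡ m
        onto m∈ with ∈-++⁻ S m∈
        ... | inj₂ q with ∈-map⁻ reflected q
        ... | (u , v) , Q∈ , refl = (j , reflect (u , v)) , ∈-levels⁺ ≤-refl (tri-reflect {u} {v} (inside Q∈)) , refl
        onto m∈ | inj₁ p with ∈S⁻ p
        ... | m≤n , l , P , tri , refl with l ≤? j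
        ... | yes l≤j = (l , P) , ∈-levels⁺ (s≤s l≤j) tri , refl
        ... | no l≰j  = ⊥-elim (<⇒≱ (above P (≰⇒> l≰j)) (≤-trans m≤n (≤-trans hi (*-monoʳ-≤ B (fib-mono (3 + j))))))

  -- Integer estimates for the triangle counts

  Estimate : ℕ → ℕ → ℕ → ℕ → Set
  Estimate D M X t = 2 * D * t ≤ M * M + 4 * D * X × M * M ≤ 2 * D * t + 4 * D * X × t ≤ 5 * D

  -- `M₀` is the leg of the counted staircase and `M` the leg used in the asymptotics; a shift by
  -- `X` changes the square by at most `X (2 M₀ + X) ≤ 4 D X`. The crude bound `t ≤ 5 D` follows
  -- from `D² + 8 D² ≤ 10 D²` and later controls the replacement of `D` by a power of φ.
  estimate-from-squares : ∀ {D X M₀ M t} .{{_ : NonZero D}} → M₀ ≤ M → M ≤ M₀ + X → M ≤ D → X ≤ 2 * D →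
    M₀ * M₀ ≤ 2 * D * t → 2 * D * t ≤ (M₀ + X) * (M₀ + X) → Estimate D M X t
  estimate-from-squares {D} {X} {M₀} {M} {t} M₀≤M M≤ M≤D X≤2D lower upper =
    upper′ , ≤-trans (*-mono-≤ M≤ M≤) (≤-trans square≤ (+-monoˡ-≤ _ lower)) , *-cancelˡ-≤ (2 * D) {{m*n≢0 2 D}} t≤
    where
    expand : ∀ m x → (m + x) * (m + x) ≡ m * m + x * (2 * m + x)
    expand = solve-∀
    collect : ∀ D X → X * (2 * D + 2 * D) ≡ 4 * D * X
    collect = solve-∀
    square≤ : (M₀ + X) * (M₀ + X) ≤ M₀ * M₀ + 4 * D * X
    square≤ = ≤-trans (≤-reflexive (expand M₀ X)) (+-monoʳ-≤ (M₀ * M₀)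
      (≤-trans (*-monoʳ-≤ X (+-mono-≤ (*-monoʳ-≤ 2 (≤-trans M₀≤M M≤D)) X≤2D)) (≤-reflexive (collect D X))))
    upper′ : 2 * D * t ≤ M * M + 4 * D * X
    upper′ = ≤-trans upper (≤-trans square≤ (+-monoˡ-≤ _ (*-mono-≤ M₀≤M M₀≤M)))
    final : ∀ D → D * D + 4 * D * (2 * D) + D * D ≡ 2 * D * (5 * D)
    final = solve-∀
    t≤ : 2 * D * t ≤ 2 * D * (5 * D)
    t≤ = ≤-trans upper′ (≤-trans (+-mono-≤ (*-mono-≤ M≤D M≤D) (*-monoʳ-≤ (4 * D) X≤2D))
      (≤-trans (m≤m+n _ (D * D)) (≤-reflexive (final D))))

  module CountingEstimates {n : ℕ} {S : List ℕ} (uniqueS : Unique S)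
    (spec : ∀ m → (m ∈ S → 1 ≤ m × m ≤ n × HasTwoGood m) × (1 ≤ m × m ≤ n × HasTwoGood m → m ∈ S)) (j : ℕ) where

    open Counting uniqueS spec

    private
      A B C X : ℕ
      A = fib (1 + j)
      B = fib (2 + j)
      C = fib (3 + j)
      X = fib (4 + j)

      instance
        A-nonZero : NonZero A
        A-nonZero = >-nonZero (fib-pos j)
        B-nonZero : NonZero B
        B-nonZero = >-nonZero (fib-pos (1 + j))
        C-nonZero : NonZero C
        C-nonZero = >-nonZero (fib-pos (2 + j))

      X≤2kC : ∀ k .{{_ : NonZero k}} → X ≤ 2 * (k * C)
      X≤2kC k = +-mono-≤ (m≤n*m C k)
        (≤-trans (≤-trans (fib-mono (2 + j)) (m≤n*m C k)) (≤-reflexive (sym (+-identityʳ (k * C)))))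

    small-part : A * C ≤ n → n ≤ 2 * (A * B) →
      ∃ λ t → length S ≡ length (levels j) + t × Estimate (A * C) (n ∸ A * C) X t
    small-part lo hi = t , sym (count-small-part j lo hi)
      , estimate-from-squares {{m*n≢0 A C}} M₀≤M M≤ M≤D (X≤2kC A)
          (subst (λ D → M₀ * M₀ ≤ 2 * D * t) (*-comm C A) (First.length-below-lower j M₀))
          (≤-trans (subst (λ D → 2 * D * t ≤ (M₀ + C + A) * (M₀ + C + A)) (*-comm C A) (First.length-below-upper j M₀))
            (*-mono-≤ widen widen))
      where
      M₀ M t : ℕ
      M₀ = suc n ∸ (A * C + C)
      M = n ∸ A * C
      t = length (First.below j M₀)
      M₀≤M : M₀ ≤ M
      M₀≤M = ∸-monoʳ-≤ (suc n) (≤-trans (≤-reflexive (+-comm 1 (A * C))) (+-monoʳ-≤ (A * C) (fib-pos (2 + j))))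
      M≤ : M ≤ M₀ + X
      M≤ = ≤-trans (∸-monoˡ-≤ (A * C) (n≤1+n n)) (≤-trans (m≤n+m∸n (suc n ∸ A * C) C)
        (≤-trans (≤-reflexive (trans (+-comm C _) (cong (_+ C) (∸-+-assoc (suc n) (A * C) C)))) (+-monoʳ-≤ M₀ (m≤m+n C B))))
      M≤D : M ≤ A * C
      M≤D = m≤n+o⇒m∸n≤o n (A * C) (≤-trans hi (≤-trans (*-monoʳ-≤ 2 (*-monoʳ-≤ A (fib-mono (2 + j))))
        (≤-reflexive (cong (A * C +_) (+-identityʳ (A * C))))))
      -- The slopes add up to `C + A` and the two legs differ by at most `C`; `X = C + B` dominates
      -- both.
      widen : M₀ + C + A ≤ M₀ + X
      widen = ≤-trans (≤-reflexive (+-assoc M₀ C A)) (+-monoʳ-≤ M₀ (+-monoʳ-≤ C (fib-mono (1 + j))))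

    large-part : 2 * (A * B) ≤ n → n ≤ B * C →
      ∃ λ t → length (levels (suc j)) ≡ length S + t × Estimate (B * C) (B * C ∸ n) X t
    large-part lo hi = t , count-large-part j lo hi
      , estimate-from-squares {{m*n≢0 B C}} ≤-refl (m≤m+n M X) (m∸n≤m (B * C) n) (X≤2kC B)
          (subst (λ D → M * M ≤ 2 * D * t) (*-comm C B) (Second.length-below-lower j M))
          (subst₂ (λ D Y → 2 * D * t ≤ Y * Y) (*-comm C B) (+-assoc M C B) (Second.length-below-upper j M))
      where
      M t : ℕ
      M = B * C ∸ n
      t = length (Second.below j M)

module GoldenRings where
  open import Algebra.Bundles using (CommutativeRing; RawRing)
  open import Algebra.Solver.Ring.AlmostCommutativeRing using (fromCommutativeRing; _-Raw-AlmostCommutative⟶_)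
  open import Algebra.Structures using (IsCommutativeRing)
  open import Data.Empty using (⊥-elim)
  open import Data.Integer as ℤ using (ℤ; -[1+_]; +[1+_]; +0) renaming (+_ to pos)
  import Data.Integer.Properties as ℤ
  open import Data.List using (List; length)
  open import Data.List.Membership.Propositional using (_∈_)
  open import Data.List.Relation.Unary.Unique.Propositional using (Unique)
  open import Data.Maybe using (Maybe; just; nothing)
  open import Data.Nat as ℕ using (ℕ; zero; suc; z≤n; s≤s)
  import Data.Nat.Properties as ℕ
  open import Data.Product using (∃; _×_; _,_; proj₁; proj₂)
  open import Data.Product.Properties using (≡-dec)
  open import Defs using (HasTwoGood)
  open import Level using (0ℓ)
  open import Relation.Binary.PropositionalEquality using (_≡_; refl; sym; trans; cong; cong₂; subst; module ≡-Reasoning)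
  open import Relation.Nullary using (¬_; yes; no)
  open WalkCounting using (fib; fib-mono; fib-pos; levels; length-levels; Estimate; module Counting; module CountingEstimates)

  -- An abstract partially ordered ring containing φ

  record GoldenRing : Set₁ where
    infixl 6 _+_
    infixl 7 _*_
    infix  8 -_
    field
      Carrier : Set
      _+_ _*_ : Carrier → Carrier → Carrier
      -_      : Carrier → Carrier
      0# 1#   : Carrier
      isCommutativeRing : IsCommutativeRing _≡_ _+_ _*_ -_ 0# 1#
      fromℤ   : ℤ → Carrier
      fromℤ-+ : ∀ i j → fromℤ (i ℤ.+ j) ≡ fromℤ i + fromℤ j
      fromℤ-* : ∀ i j → fromℤ (i ℤ.* j) ≡ fromℤ i * fromℤ j
      fromℤ-neg : ∀ i → fromℤ (ℤ.- i) ≡ - fromℤ i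
      fromℤ-0 : fromℤ (pos 0) ≡ 0#
      fromℤ-1 : fromℤ (pos 1) ≡ 1#
      NonNeg  : Carrier → Set
      nonNeg-+ : ∀ {x y} → NonNeg x → NonNeg y → NonNeg (x + y)
      nonNeg-* : ∀ {x y} → NonNeg x → NonNeg y → NonNeg (x * y)
      nonNeg-square : ∀ x → NonNeg (x * x)
      nonNeg-ℕ : ∀ n → NonNeg (fromℤ (pos n))
      nonNeg-cancel : ∀ n {x} → NonNeg (fromℤ (pos (suc n)) * x) → NonNeg x
      -- The only negative statement about the order: contradictory inequalities are always combined
      -- to this one.
      ¬nonNeg-minus-one : ¬ NonNeg (fromℤ -[1+ 0 ])
      φ       : Carrier
      φ-square : φ * φ ≡ φ + 1#
      -- The convergents `8/5` and `13/8` of φ, close enough for every later estimate.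
      φ-lower : NonNeg (fromℤ (pos 5) * φ + fromℤ -[1+ 7 ])
      φ-upper : NonNeg (fromℤ (pos 13) + fromℤ -[1+ 7 ] * φ)
      √5′     : Carrier
      √5′-φ   : √5′ ≡ fromℤ (pos 2) * φ + fromℤ -[1+ 0 ]
      half′   : Carrier
      half′-half : fromℤ (pos 2) * half′ ≡ 1#
      inv     : Carrier → Carrier
      -- Exhibiting some inverse certifies the chosen one, so the abstract ring requires no test for
      -- zero.
      inv-unit : ∀ {x y} → x * y ≡ 1# → x * inv x ≡ 1#
      inv-ℕ   : ∀ n → fromℤ (pos (suc n)) * inv (fromℤ (pos (suc n))) ≡ 1#

    infixl 6 _-_
    _-_ : Carrier → Carrier → Carrier
    x - y = x + (- y)

    nat : ℕ → Carrier
    nat n = fromℤ (pos n)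

    pow : Carrier → ℕ → Carrier
    pow x zero    = 1#
    pow x (suc k) = x * pow x k

    commutativeRing : CommutativeRing 0ℓ 0ℓ
    commutativeRing = record { isCommutativeRing = isCommutativeRing }

    open IsCommutativeRing isCommutativeRing public
      using (+-assoc; +-comm; *-assoc; *-comm; *-identityˡ; *-identityʳ; +-identityˡ; +-identityʳ; distribˡ; distribʳ; zeroˡ; zeroʳ)

  -- Ring identities are checked by normalising polynomials with coefficients in ℤ[φ],
  -- so that φ² = φ + 1 is applied automatically.
  module Golden-Solver (G : GoldenRing) where
    open GoldenRing G
    private
      module CR = CommutativeRing commutativeRing
      open import Algebra.Properties.Ring CR.ring using (-‿distribˡ-*)
      open import Algebra.Properties.AbelianGroup CR.+-abelianGroup using (⁻¹-∙-comm)
      open import Algebra.Properties.CommutativeSemigroup CR.+-commutativeSemigroup using (interchange)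

    ℤ[φ] : RawRing 0ℓ 0ℓ
    ℤ[φ] = record
      { Carrier = ℤ × ℤ
      ; _≈_ = _≡_
      ; _+_ = λ { (a , b) (c , d) → a ℤ.+ c , b ℤ.+ d }
      ; _*_ = λ { (a , b) (c , d) → a ℤ.* c ℤ.+ b ℤ.* d , a ℤ.* d ℤ.+ b ℤ.* c ℤ.+ b ℤ.* d }
      ; -_  = λ { (a , b) → ℤ.- a , ℤ.- b }
      ; 0#  = pos 0 , pos 0
      ; 1#  = pos 1 , pos 0
      }

    private
      module Z = RawRing ℤ[φ]

      canonical : ℤ × ℤ → Carrier
      canonical (a , b) = fromℤ a + fromℤ b * φ

    -- Defined by cases so that constants evaluate to fromℤ a and φ definitionally.
    ⟦_⟧ᶜ : ℤ × ℤ → Carrier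
    ⟦ a  , +0 ⟧ᶜ       = fromℤ a
    ⟦ +0 , +[1+ 0 ] ⟧ᶜ = φ
    ⟦ a  , b ⟧ᶜ        = fromℤ a + fromℤ b * φ

    private
      ⟦⟧-canonical : ∀ x → ⟦ x ⟧ᶜ ≡ canonical x
      ⟦⟧-canonical (a , +0) = sym (trans (cong (λ z → fromℤ a + z * φ) fromℤ-0)
        (trans (cong (fromℤ a +_) (zeroˡ φ)) (+-identityʳ _)))
      ⟦⟧-canonical (+0 , +[1+ 0 ]) = sym (trans (cong₂ (λ y z → y + z * φ) fromℤ-0 fromℤ-1)
        (trans (+-identityˡ _) (*-identityˡ φ)))
      ⟦⟧-canonical (+0 , +[1+ suc n ])       = refl
      ⟦⟧-canonical (+[1+ m ] , +[1+ n ])     = refl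
      ⟦⟧-canonical (-[1+ m ] , +[1+ n ])     = refl
      ⟦⟧-canonical (+0 , -[1+ n ])           = refl
      ⟦⟧-canonical (+[1+ m ] , -[1+ n ])     = refl
      ⟦⟧-canonical (-[1+ m ] , -[1+ n ])     = refl

      canonical-+ : ∀ x y → canonical (x Z.+ y) ≡ canonical x + canonical y
      canonical-+ (a , b) (c , d) = trans
        (cong₂ _+_ (fromℤ-+ a c) (trans (cong (_* φ) (fromℤ-+ b d)) (distribʳ φ (fromℤ b) (fromℤ d))))
        (interchange _ _ _ _)

      canonical-neg : ∀ x → canonical (Z.- x) ≡ - canonical x
      canonical-neg (a , b) = trans
        (cong₂ _+_ (fromℤ-neg a) (trans (cong (_* φ) (fromℤ-neg b)) (sym (-‿distribˡ-* (fromℤ b) φ))))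
        (⁻¹-∙-comm _ _)

      canonical-* : ∀ x y → canonical (x Z.* y) ≡ canonical x * canonical y
      canonical-* (a , b) (c , d) = begin
        fromℤ (a ℤ.* c ℤ.+ b ℤ.* d) + fromℤ (a ℤ.* d ℤ.+ b ℤ.* c ℤ.+ b ℤ.* d) * φ
          ≡⟨ cong₂ (λ u v → u + v * φ)
               (trans (fromℤ-+ (a ℤ.* c) (b ℤ.* d)) (cong₂ _+_ (fromℤ-* a c) (fromℤ-* b d)))
               (trans (fromℤ-+ (a ℤ.* d ℤ.+ b ℤ.* c) (b ℤ.* d)) (cong₂ _+_
                 (trans (fromℤ-+ (a ℤ.* d) (b ℤ.* c)) (cong₂ _+_ (fromℤ-* a d) (fromℤ-* b c)))
                 (fromℤ-* b d))) ⟩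
        (p * r + q * t) + (p * t + q * r + q * t) * φ
          ≡⟨ cong (λ z → (p * r + q * t) + z) (trans (distribʳ φ _ _) (cong (_+ q * t * φ) (distribʳ φ _ _))) ⟩
        (p * r + q * t) + (p * t * φ + q * r * φ + q * t * φ)
          ≡⟨ cong ((p * r + q * t) +_) (+-comm _ _) ⟩
        (p * r + q * t) + (q * t * φ + (p * t * φ + q * r * φ))
          ≡⟨ +-assoc _ _ _ ⟩
        p * r + (q * t + (q * t * φ + (p * t * φ + q * r * φ)))
          ≡⟨ cong (p * r +_) (trans (sym (+-assoc _ _ _)) (cong (_+ (p * t * φ + q * r * φ)) (+-comm _ _))) ⟩
        p * r + ((q * t * φ + q * t) + (p * t * φ + q * r * φ))
          ≡⟨ cong (λ z → p * r + (z + (p * t * φ + q * r * φ))) merge ⟩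
        p * r + ((q * φ) * (t * φ) + (p * t * φ + q * r * φ))
          ≡⟨ cong (p * r +_) (+-comm _ _) ⟩
        p * r + (p * t * φ + q * r * φ + (q * φ) * (t * φ))
          ≡⟨ cong (p * r +_) (cong₂ _+_ (cong₂ _+_ (*-assoc p t φ) (xy-z q r φ)) refl) ⟩
        p * r + (p * (t * φ) + q * φ * r + (q * φ) * (t * φ))
          ≡⟨ cong (p * r +_) (+-assoc _ _ _) ⟩
        p * r + (p * (t * φ) + (q * φ * r + (q * φ) * (t * φ)))
          ≡⟨ sym (+-assoc _ _ _) ⟩
        p * r + p * (t * φ) + (q * φ * r + (q * φ) * (t * φ))
          ≡⟨ sym (cong₂ _+_ (distribˡ p r (t * φ)) (distribˡ (q * φ) r (t * φ))) ⟩
        p * (r + t * φ) + q * φ * (r + t * φ)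
          ≡⟨ sym (distribʳ (r + t * φ) p (q * φ)) ⟩
        (p + q * φ) * (r + t * φ) ∎
        where
        open ≡-Reasoning
        p = fromℤ a
        q = fromℤ b
        r = fromℤ c
        t = fromℤ d
        xy-z : ∀ x y z → x * y * z ≡ x * z * y
        xy-z x y z = trans (*-assoc x y z) (trans (cong (x *_) (*-comm y z)) (sym (*-assoc x z y)))
        -- The one place where `φ² = φ + 1` enters the solver.
        merge : q * t * φ + q * t ≡ (q * φ) * (t * φ)
        merge = trans (cong (q * t * φ +_) (sym (*-identityʳ (q * t))))
          (trans (sym (distribˡ (q * t) φ 1#)) (trans (cong (q * t *_) (sym φ-square))
            (trans (sym (*-assoc (q * t) φ φ)) (trans (cong (_* φ) (xy-z q t φ)) (*-assoc (q * φ) t φ)))))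

      morphism : ℤ[φ] -Raw-AlmostCommutative⟶ fromCommutativeRing commutativeRing
      morphism = record
        { ⟦_⟧    = ⟦_⟧ᶜ
        ; +-homo = λ x y → trans (⟦⟧-canonical (x Z.+ y)) (trans (canonical-+ x y)
                     (sym (cong₂ _+_ (⟦⟧-canonical x) (⟦⟧-canonical y))))
        ; *-homo = λ x y → trans (⟦⟧-canonical (x Z.* y)) (trans (canonical-* x y)
                     (sym (cong₂ _*_ (⟦⟧-canonical x) (⟦⟧-canonical y))))
        ; -‿homo = λ x → trans (⟦⟧-canonical (Z.- x)) (trans (canonical-neg x)
                     (sym (cong -_ (⟦⟧-canonical x))))
        ; 0-homo = fromℤ-0
        ; 1-homo = fromℤ-1
        }

      weakly-≟ : ∀ x y → Maybe (⟦ x ⟧ᶜ ≡ ⟦ y ⟧ᶜ)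
      weakly-≟ x y with ≡-dec ℤ._≟_ ℤ._≟_ x y
      ... | yes eq = just (cong ⟦_⟧ᶜ eq)
      ... | no _   = nothing

    open import Algebra.Solver.Ring ℤ[φ] (fromCommutativeRing commutativeRing) morphism weakly-≟ public
      using (solve; _:=_; _:+_; _:*_; _:-_; :-_; con; Polynomial)

    :φ : ∀ {n} → Polynomial n
    :φ = con (pos 0 , pos 1)

    # : ∀ {n} → ℕ → Polynomial n
    # k = con (pos k , pos 0)

  -- Approximation of Fibonacci products by powers of φ

  module Estimates (G : GoldenRing) where
    open GoldenRing G
    open Golden-Solver G

    infix 4 _≤_
    _≤_ : Carrier → Carrier → Set
    x ≤ y = NonNeg (y - x)

    nonNeg-≡ : ∀ {x y} → x ≡ y → NonNeg x → NonNeg y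
    nonNeg-≡ = subst NonNeg

    ≤-trans : ∀ {x y z} → x ≤ y → y ≤ z → x ≤ z
    ≤-trans {x} {y} {z} p q = nonNeg-≡ (solve 3 (λ x y z → (y :- x) :+ (z :- y) := z :- x) refl x y z) (nonNeg-+ p q)

    *-monoˡ-≤ : ∀ {x y} z → NonNeg z → x ≤ y → z * x ≤ z * y
    *-monoˡ-≤ {x} {y} z pz p = nonNeg-≡ (solve 3 (λ x y z → z :* (y :- x) := z :* y :- z :* x) refl x y z) (nonNeg-* pz p)

    nat-+ : ∀ m n → nat (m ℕ.+ n) ≡ nat m + nat n
    nat-+ m n = fromℤ-+ (pos m) (pos n)

    nat-* : ∀ m n → nat (m ℕ.* n) ≡ nat m * nat n
    nat-* m n = trans (cong fromℤ (ℤ.pos-* m n)) (fromℤ-* (pos m) (pos n))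

    nat-mono : ∀ {m n} → m ℕ.≤ n → nat m ≤ nat n
    nat-mono {m} m≤n with ℕ.m≤n⇒∃[o]m+o≡n m≤n
    ... | d , refl = nonNeg-≡ (sym (trans (cong (λ z → z - nat m) (nat-+ m d))
                       (solve 2 (λ x y → (x :+ y) :- x := y) refl (nat m) (nat d)))) (nonNeg-ℕ d)

    -- A failure means `m ≥ n + 1`, and `5n + 4 - 5(n + 1) = -1`. The 4 is the slack available to
    -- the errors in the Binet formula.
    nat-≤-from-gap : ∀ m n → nat 5 * nat m ≤ nat 5 * nat n + nat 4 → m ℕ.≤ n
    nat-≤-from-gap m n p with m ℕ.≤? n
    ... | yes m≤n = m≤n
    ... | no m≰n with ℕ.m≤n⇒∃[o]m+o≡n (ℕ.≰⇒> m≰n)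
    ... | d , refl = ⊥-elim (¬nonNeg-minus-one (nonNeg-≡ (trans
            (cong (λ z → nat 5 * nat n + nat 4 - nat 5 * z + nat 5 * nat d)
              (trans (nat-+ (suc n) d) (cong (λ z → z + nat d) (nat-+ 1 n))))
            (solve 2 (λ n d → # 5 :* n :+ # 4 :- # 5 :* (# 1 :+ n :+ d) :+ # 5 :* d := con (-[1+ 0 ] , pos 0))
              refl (nat n) (nat d)))
            (nonNeg-+ p (nonNeg-* (nonNeg-ℕ 5) (nonNeg-ℕ d)))))

    Abs : Carrier → Carrier → Set
    Abs x r = NonNeg (r - x) × NonNeg (r + x)

    abs-≡ : ∀ {x y r q} → x ≡ y → r ≡ q → Abs x r → Abs y q
    abs-≡ refl refl p = p

    abs-+ : ∀ {x y r q} → Abs x r → Abs y q → Abs (x + y) (r + q)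
    abs-+ {x} {y} {r} {q} (p₁ , p₂) (q₁ , q₂) =
        nonNeg-≡ (solve 4 (λ x y r q → (r :- x) :+ (q :- y) := (r :+ q) :- (x :+ y)) refl x y r q) (nonNeg-+ p₁ q₁)
      , nonNeg-≡ (solve 4 (λ x y r q → (r :+ x) :+ (q :+ y) := (r :+ q) :+ (x :+ y)) refl x y r q) (nonNeg-+ p₂ q₂)

    abs-neg : ∀ {x r} → Abs x r → Abs (- x) r
    abs-neg {x} {r} (p₁ , p₂) = nonNeg-≡ (solve 2 (λ x r → r :+ x := r :- (:- x)) refl x r) p₂ , p₁

    -- Twice `r q ∓ x y` is a sum of two products of nonnegative factors; this replaces a case
    -- distinction on signs, as the abstract order is not assumed total.
    abs-* : ∀ {x y r q} → Abs x r → Abs y q → Abs (x * y) (r * q)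
    abs-* {x} {y} {r} {q} (p₁ , p₂) (q₁ , q₂) =
        nonNeg-cancel 1 (nonNeg-≡ (solve 4 (λ x y r q →
          (r :- x) :* (q :+ y) :+ (r :+ x) :* (q :- y) := # 2 :* (r :* q :- x :* y)) refl x y r q)
          (nonNeg-+ (nonNeg-* p₁ q₂) (nonNeg-* p₂ q₁)))
      , nonNeg-cancel 1 (nonNeg-≡ (solve 4 (λ x y r q →
          (r :- x) :* (q :- y) :+ (r :+ x) :* (q :+ y) := # 2 :* (r :* q :+ x :* y)) refl x y r q)
          (nonNeg-+ (nonNeg-* p₁ q₁) (nonNeg-* p₂ q₂)))

    abs-weaken : ∀ {x r q} → r ≤ q → Abs x r → Abs x q
    abs-weaken {x} {r} {q} r≤q (p₁ , p₂) =
        nonNeg-≡ (solve 3 (λ x r q → (q :- r) :+ (r :- x) := q :- x) refl x r q) (nonNeg-+ r≤q p₁)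
      , nonNeg-≡ (solve 3 (λ x r q → (q :- r) :+ (r :+ x) := q :+ x) refl x r q) (nonNeg-+ r≤q p₂)

    abs-nonNeg : ∀ {x r} → NonNeg x → x ≤ r → Abs x r
    abs-nonNeg {x} {r} px p = p
      , nonNeg-≡ (solve 2 (λ x r → (r :- x) :+ (x :+ x) := r :+ x) refl x r) (nonNeg-+ p (nonNeg-+ px px))

    abs-square : ∀ {x r} → Abs x r → x * x ≤ r * r
    abs-square {x} {r} (p₁ , p₂) =
      nonNeg-≡ (solve 2 (λ x r → (r :- x) :* (r :+ x) := r :* r :- x :* x) refl x r) (nonNeg-* p₁ p₂)

    abs-ℕ : ∀ n → Abs (nat n) (nat n)
    abs-ℕ n = abs-nonNeg (nonNeg-ℕ n) (nonNeg-≡ (solve 1 (λ x → # 0 := x :- x) refl (nat n)) (nonNeg-ℕ 0))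

    ≤-abs : ∀ {x y r} → Abs (x - y) r → x ≤ y + r
    ≤-abs {x} {y} {r} (p , _) = nonNeg-≡ (solve 3 (λ x y r → r :- (x :- y) := (y :+ r) :- x) refl x y r) p

    ≥-abs : ∀ {x y r} → Abs (x - y) r → y ≤ x + r
    ≥-abs {x} {y} {r} (_ , p) = nonNeg-≡ (solve 3 (λ x y r → r :+ (x :- y) := (x :+ r) :- y) refl x y r) p

    minus-plus : ∀ x → x - nat 1 + nat 1 ≡ x
    minus-plus = solve 1 (λ x → x :- # 1 :+ # 1 := x) refl

    nonNeg-φ : NonNeg φ
    nonNeg-φ = nonNeg-cancel 4 (nonNeg-≡ (solve 1 (λ x → # 5 :* x :+ con (-[1+ 7 ] , pos 0) :+ # 8 := # 5 :* x) refl φ)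
      (nonNeg-+ φ-lower (nonNeg-ℕ 8)))

    1≤φ : nat 1 ≤ φ
    1≤φ = nonNeg-cancel 4 (nonNeg-≡ (solve 1 (λ x → # 5 :* x :+ con (-[1+ 7 ] , pos 0) :+ # 3 := # 5 :* (x :- # 1)) refl φ)
      (nonNeg-+ φ-lower (nonNeg-ℕ 3)))

    φ≤2 : φ ≤ nat 2
    φ≤2 = nonNeg-cancel 7 (nonNeg-≡ (solve 1 (λ x → # 13 :+ con (-[1+ 7 ] , pos 0) :* x :+ # 3 := # 8 :* (# 2 :- x)) refl φ)
      (nonNeg-+ φ-upper (nonNeg-ℕ 3)))

    pow-φ≥1 : ∀ k → nat 1 ≤ pow φ k
    pow-φ≥1 zero    = nonNeg-≡ (trans (solve 1 (λ x → # 0 := x :- x) refl (nat 1)) (cong (λ z → z - nat 1) fromℤ-1)) (nonNeg-ℕ 0)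
    pow-φ≥1 (suc k) = nonNeg-≡ (solve 1 (λ x → :φ :* (x :- # 1) :+ (:φ :- # 1) := :φ :* x :- # 1) refl (pow φ k))
      (nonNeg-+ (nonNeg-* nonNeg-φ (pow-φ≥1 k)) 1≤φ)

    -- With a, b consecutive Fibonacci numbers, σ and δ are the Cassini form and the conjugate power ψʲ.
    module Fibonacci (j : ℕ) where
      a b s δ σ : Carrier
      a = nat (fib j)
      b = nat (fib (suc j))
      s = a * (φ - nat 1) + b
      δ = b - a * φ
      σ = b * b - a * b - a * a

    open Fibonacci using (s; δ; σ)

    private
      fib-step : ∀ j → nat (fib (2 ℕ.+ j)) ≡ nat (fib (1 ℕ.+ j)) + nat (fib j)
      fib-step j = nat-+ (fib (1 ℕ.+ j)) (fib j)

    s-suc : ∀ j → s (suc j) ≡ φ * s j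
    s-suc j = trans (cong (λ z → Fibonacci.b j * (φ - nat 1) + z) (fib-step j))
      (solve 2 (λ a b → b :* (:φ :- # 1) :+ (b :+ a) := :φ :* (a :* (:φ :- # 1) :+ b)) refl (nat (fib j)) (nat (fib (suc j))))

    -- `s j` is the familiar `F(j) φ + F(j-1)` with `F(j-1)` eliminated, so that `j = 0` needs no
    -- convention.
    pow-s : ∀ j → pow φ j ≡ s j
    pow-s zero    = trans (sym fromℤ-1) (solve 0 (# 1 := # 0 :* (:φ :- # 1) :+ # 1) refl)
    pow-s (suc j) = trans (cong (φ *_) (pow-s j)) (sym (s-suc j))

    s≥1 : ∀ j → nat 1 ≤ s j
    s≥1 j = subst (nat 1 ≤_) (pow-s j) (pow-φ≥1 j)

    -- Each step multiplies `δ` by `1 - φ`, which has absolute value at most 1.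
    abs-δ : ∀ j → Abs (δ j) (nat 1)
    abs-δ zero    = abs-≡ (solve 0 (# 1 := # 1 :- # 0 :* :φ) refl) refl (abs-ℕ 1)
    abs-δ (suc j) = abs-≡
      (trans (solve 2 (λ a b → (# 1 :- :φ) :* (b :- a :* :φ) := (b :+ a) :- b :* :φ) refl (nat (fib j)) (nat (fib (suc j))))
        (cong (λ z → z - nat (fib (suc j)) * φ) (sym (fib-step j))))
      (solve 0 (# 1 :* # 1 := # 1) refl)
      (abs-* ψ-abs (abs-δ j))
      where
      ψ-abs : Abs (nat 1 - φ) (nat 1)
      ψ-abs = nonNeg-≡ (solve 0 (:φ := # 1 :- (# 1 :- :φ)) refl) nonNeg-φ
            , nonNeg-≡ (solve 0 (# 2 :- :φ := # 1 :+ (# 1 :- :φ)) refl) φ≤2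

    -- Cassini's identity, reduced to what is needed: `σ` starts at 1 and changes sign at each step.
    abs-σ : ∀ j → Abs (σ j) (nat 1)
    abs-σ zero    = abs-≡ (solve 0 (# 1 := # 1 :* # 1 :- # 0 :* # 1 :- # 0 :* # 0) refl) refl (abs-ℕ 1)
    abs-σ (suc j) = abs-≡
      (trans (solve 2 (λ a b → :- (b :* b :- a :* b :- a :* a) := (b :+ a) :* (b :+ a) :- b :* (b :+ a) :- b :* b)
               refl (nat (fib j)) (nat (fib (suc j))))
        (cong (λ z → z * z - nat (fib (suc j)) * z - nat (fib (suc j)) * nat (fib (suc j))) (sym (fib-step j))))
      refl (abs-neg (abs-σ j))

    abs-δ² : ∀ j → Abs (δ j * δ j) (nat 1)
    abs-δ² j = abs-≡ refl (solve 0 (# 1 :* # 1 := # 1) refl) (abs-* (abs-δ j) (abs-δ j))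

    private
      abs-combination : ∀ j c d {k} → Abs c (nat 1) → Abs d (nat k) → Abs (c * (δ j * δ j) + d * σ j) (nat 1 + nat k)
      abs-combination j c d {k} pc pd = abs-+
        (abs-≡ refl (solve 0 (# 1 :* # 1 := # 1) refl) (abs-* pc (abs-δ² j)))
        (abs-≡ refl (solve 1 (λ k → k :* # 1 := k) refl (nat k)) (abs-* pd (abs-σ j)))

      nat-AB : ∀ j → nat (fib (1 ℕ.+ j) ℕ.* fib (2 ℕ.+ j)) ≡ nat (fib (1 ℕ.+ j)) * (nat (fib (1 ℕ.+ j)) + nat (fib j))
      nat-AB j = trans (nat-* (fib (1 ℕ.+ j)) (fib (2 ℕ.+ j))) (cong (nat (fib (1 ℕ.+ j)) *_) (fib-step j))

      nat-C : ∀ j → nat (fib (3 ℕ.+ j)) ≡ nat (fib (1 ℕ.+ j)) + nat (fib j) + nat (fib (1 ℕ.+ j))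
      nat-C j = trans (fib-step (1 ℕ.+ j)) (cong (_+ nat (fib (1 ℕ.+ j))) (fib-step j))

      nat-AC : ∀ j → nat (fib (1 ℕ.+ j) ℕ.* fib (3 ℕ.+ j))
                   ≡ nat (fib (1 ℕ.+ j)) * (nat (fib (1 ℕ.+ j)) + nat (fib j) + nat (fib (1 ℕ.+ j)))
      nat-AC j = trans (nat-* (fib (1 ℕ.+ j)) (fib (3 ℕ.+ j))) (cong (nat (fib (1 ℕ.+ j)) *_) (nat-C j))

      nat-BC : ∀ j → nat (fib (2 ℕ.+ j) ℕ.* fib (3 ℕ.+ j))
                   ≡ (nat (fib (1 ℕ.+ j)) + nat (fib j)) * (nat (fib (1 ℕ.+ j)) + nat (fib j) + nat (fib (1 ℕ.+ j)))
      nat-BC j = trans (nat-* (fib (2 ℕ.+ j)) (fib (3 ℕ.+ j))) (cong₂ _*_ (fib-step j) (nat-C j))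

    φ³ φ⁴ φ⁵ : Carrier
    φ³ = nat 2 * φ + nat 1
    φ⁴ = nat 3 * φ + nat 2
    φ⁵ = nat 5 * φ + nat 3

    private
      abs-minus-one : Abs (fromℤ -[1+ 0 ]) (nat 1)
      abs-minus-one = nonNeg-≡ (solve 0 (# 2 := # 1 :- con (-[1+ 0 ] , pos 0)) refl) (nonNeg-ℕ 2)
                    , nonNeg-≡ (solve 0 (# 0 := # 1 :+ con (-[1+ 0 ] , pos 0)) refl) (nonNeg-ℕ 0)

      abs-ψ³ : Abs (nat 3 - nat 2 * φ) (nat 1)
      abs-ψ³ = nonNeg-≡ (solve 0 (# 2 :* (:φ :- # 1) := # 1 :- (# 3 :- # 2 :* :φ)) refl) (nonNeg-* (nonNeg-ℕ 2) 1≤φ)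
             , nonNeg-≡ (solve 0 (# 2 :* (# 2 :- :φ) := # 1 :+ (# 3 :- # 2 :* :φ)) refl) (nonNeg-* (nonNeg-ℕ 2) φ≤2)

      abs-ψ⁴ : Abs (nat 5 - nat 3 * φ) (nat 1)
      abs-ψ⁴ = nonNeg-cancel 4 (nonNeg-≡ (solve 0 (# 3 :* (# 5 :* :φ :+ con (-[1+ 7 ] , pos 0)) :+ # 4 := # 5 :* (# 1 :- (# 5 :- # 3 :* :φ))) refl)
                 (nonNeg-+ (nonNeg-* (nonNeg-ℕ 3) φ-lower) (nonNeg-ℕ 4)))
             , nonNeg-≡ (solve 0 (# 3 :* (# 2 :- :φ) := # 1 :+ (# 5 :- # 3 :* :φ)) refl) (nonNeg-* (nonNeg-ℕ 3) φ≤2)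

      abs-ψ⁵ : Abs (nat 8 - nat 5 * φ) (nat 1)
      abs-ψ⁵ = nonNeg-≡ (solve 0 (# 5 :* :φ :+ con (-[1+ 7 ] , pos 0) :+ # 1 := # 1 :- (# 8 :- # 5 :* :φ)) refl)
                 (nonNeg-+ φ-lower (nonNeg-ℕ 1))
             , nonNeg-cancel 7 (nonNeg-≡ (solve 0 (# 5 :* (# 13 :+ con (-[1+ 7 ] , pos 0) :* :φ) :+ # 7 := # 8 :* (# 1 :+ (# 8 :- # 5 :* :φ))) refl)
                 (nonNeg-+ (nonNeg-* (nonNeg-ℕ 5) φ-upper) (nonNeg-ℕ 7)))

    -- By Binet, `5 F(m) F(n)` is `φ^(m+n) + ψ^(m+n)` plus or minus the Lucas number `L(n-m)`, where
    -- `ψ = 1 - φ`. As `L(1) = 1` and `L(2) = 3`, the errors of this and the next two products are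
    -- bounded by `1 + 1`, `1 + 3` and `1 + 1`.
    approx-AB : ∀ j → Abs (nat 5 * nat (fib (1 ℕ.+ j) ℕ.* fib (2 ℕ.+ j)) - φ³ * (s j * s j)) (nat 2)
    approx-AB j = abs-≡
      (sym (trans (cong (λ z → nat 5 * z - φ³ * (s j * s j)) (nat-AB j))
        (solve 2 (λ a b → let s = a :* (:φ :- # 1) :+ b ; δ = b :- a :* :φ ; σ = b :* b :- a :* b :- a :* a in
          # 5 :* (b :* (b :+ a)) :- (# 2 :* :φ :+ # 1) :* (s :* s) := (# 3 :- # 2 :* :φ) :* (δ :* δ) :+ # 1 :* σ)
          refl (nat (fib j)) (nat (fib (1 ℕ.+ j))))))
      (solve 0 (# 1 :+ # 1 := # 2) refl)
      (abs-combination j (nat 3 - nat 2 * φ) (nat 1) abs-ψ³ (abs-ℕ 1))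

    approx-AC : ∀ j → Abs (nat 5 * nat (fib (1 ℕ.+ j) ℕ.* fib (3 ℕ.+ j)) - φ⁴ * (s j * s j)) (nat 4)
    approx-AC j = abs-≡
      (sym (trans (cong (λ z → nat 5 * z - φ⁴ * (s j * s j)) (nat-AC j))
        (solve 2 (λ a b → let s = a :* (:φ :- # 1) :+ b ; δ = b :- a :* :φ ; σ = b :* b :- a :* b :- a :* a in
          # 5 :* (b :* (b :+ a :+ b)) :- (# 3 :* :φ :+ # 2) :* (s :* s) := (# 5 :- # 3 :* :φ) :* (δ :* δ) :+ # 3 :* σ)
          refl (nat (fib j)) (nat (fib (1 ℕ.+ j))))))
      (solve 0 (# 1 :+ # 3 := # 4) refl)
      (abs-combination j (nat 5 - nat 3 * φ) (nat 3) abs-ψ⁴ (abs-ℕ 3))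

    approx-BC : ∀ j → Abs (nat 5 * nat (fib (2 ℕ.+ j) ℕ.* fib (3 ℕ.+ j)) - φ⁵ * (s j * s j)) (nat 2)
    approx-BC j = abs-≡
      (sym (trans (cong (λ z → nat 5 * z - φ⁵ * (s j * s j)) (nat-BC j))
        (solve 2 (λ a b → let s = a :* (:φ :- # 1) :+ b ; δ = b :- a :* :φ ; σ = b :* b :- a :* b :- a :* a in
          # 5 :* ((b :+ a) :* (b :+ a :+ b)) :- (# 5 :* :φ :+ # 3) :* (s :* s)
            := (# 8 :- # 5 :* :φ) :* (δ :* δ) :+ con (-[1+ 0 ] , pos 0) :* σ)
          refl (nat (fib j)) (nat (fib (1 ℕ.+ j))))))
      (solve 0 (# 1 :+ # 1 := # 2) refl)
      (abs-combination j (nat 8 - nat 5 * φ) (fromℤ -[1+ 0 ]) abs-ψ⁵ abs-minus-one)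

    fib-suc≤s : ∀ j → nat (fib (suc j)) ≤ s j
    fib-suc≤s j = nonNeg-≡ (solve 2 (λ a b → a :* (:φ :- # 1) := (a :* (:φ :- # 1) :+ b) :- b) refl (nat (fib j)) (nat (fib (suc j))))
      (nonNeg-* (nonNeg-ℕ (fib j)) 1≤φ)

    -- `F(j+4) = 3 F(j+1) + 2 F(j) ≤ 5 F(j+1)`.
    fib-4≤5s : ∀ j → nat (fib (4 ℕ.+ j)) ≤ nat 5 * s j
    fib-4≤5s j = nonNeg-≡ (trans
        (solve 3 (λ a b s → # 5 :* (s :- b) :+ # 2 :* (b :- a) := # 5 :* s :- (b :+ a :+ b :+ (b :+ a)))
          refl (nat (fib j)) (nat (fib (suc j))) (s j))
        (cong (λ z → nat 5 * s j - z) (sym (trans (fib-step (2 ℕ.+ j)) (cong₂ _+_ (nat-C j) (fib-step j))))))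
      (nonNeg-+ (nonNeg-* (nonNeg-ℕ 5) (fib-suc≤s j)) (nonNeg-* (nonNeg-ℕ 2) (nat-mono (fib-mono j))))

    -- The quadratic part of the exact count is `φ⁻¹ s²` up to bounded conjugate terms; the linear
    -- term `5 F(i+1)` is the true source of an error of order √n.
    levels-estimate : ∀ i → Abs (nat 10 * nat (length (levels i)) - (φ - nat 1) * (s i * s i)) (nat 13 * s i)
    levels-estimate i = abs-weaken bound (abs-≡ (sym decomposition) refl
      (abs-+ (abs-+ (abs-+ (abs-* abs-−φ (abs-δ² i)) (abs-σ i)) abs-b) (abs-neg (abs-ℕ 5))))
      where
      a = nat (fib i)
      b = nat (fib (suc i))
      L = nat (length (levels i))
      count : nat 2 * L + (a * a + nat 1) ≡ a * b + b
      count = trans (sym (trans (nat-+ (2 ℕ.* length (levels i)) (fib i ℕ.* fib i ℕ.+ 1))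
          (cong₂ _+_ (nat-* 2 (length (levels i))) (trans (nat-+ (fib i ℕ.* fib i) 1) (cong (_+ nat 1) (nat-* (fib i) (fib i)))))))
        (trans (cong nat (length-levels i))
          (trans (nat-+ (fib i ℕ.* fib (suc i)) (fib (suc i))) (cong (_+ b) (nat-* (fib i) (fib (suc i))))))
      10L : nat 10 * L ≡ nat 5 * (a * b + b) - nat 5 * (a * a + nat 1)
      10L = trans (solve 2 (λ L a → # 10 :* L := # 5 :* (# 2 :* L :+ (a :* a :+ # 1)) :- # 5 :* (a :* a :+ # 1)) refl L a)
        (cong (λ z → nat 5 * z - nat 5 * (a * a + nat 1)) count)
      decomposition : nat 10 * L - (φ - nat 1) * (s i * s i) ≡ (- φ) * (δ i * δ i) + σ i + nat 5 * b + - nat 5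
      decomposition = trans (cong (λ z → z - (φ - nat 1) * (s i * s i)) 10L)
        (solve 2 (λ a b → let s = a :* (:φ :- # 1) :+ b ; δ = b :- a :* :φ ; σ = b :* b :- a :* b :- a :* a in
          # 5 :* (a :* b :+ b) :- # 5 :* (a :* a :+ # 1) :- (:φ :- # 1) :* (s :* s)
            := (:- :φ) :* (δ :* δ) :+ σ :+ # 5 :* b :+ :- # 5) refl a b)
      abs-−φ : Abs (- φ) (nat 2)
      abs-−φ = abs-neg (abs-nonNeg nonNeg-φ φ≤2)
      abs-b : Abs (nat 5 * b) (nat 5 * s i)
      abs-b = abs-nonNeg (nonNeg-* (nonNeg-ℕ 5) (nonNeg-ℕ (fib (suc i)))) (*-monoˡ-≤ (nat 5) (nonNeg-ℕ 5) (fib-suc≤s i))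
      bound : nat 2 * nat 1 + nat 1 + nat 5 * s i + nat 5 ≤ nat 13 * s i
      bound = nonNeg-≡ (solve 1 (λ s → # 8 :* (s :- # 1) := # 13 :* s :- (# 2 :* # 1 :+ # 1 :+ # 5 :* s :+ # 5)) refl (s i))
        (nonNeg-* (nonNeg-ℕ 8) (s≥1 i))

    -- Since 5D ≈ Φ and 5M ≈ w, the relation 2Dt ≈ M² reads 10t ≈ w²/Φ.
    triangle-estimate : ∀ {D t M X Φ e w} →
      NonNeg D → NonNeg t → NonNeg X → NonNeg e → NonNeg w →
      Abs (nat 2 * D * t - M * M) (nat 4 * D * X) → t ≤ nat 5 * D →
      Φ * e ≡ nat 1 → e ≤ nat 1 → w ≤ Φ → Abs (nat 5 * D - Φ) (nat 4) → Abs (nat 5 * M - w) (nat 4) →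
      Abs (nat 10 * t - w * w * e) (nat 224 + nat 100 * X)
    triangle-estimate {D} {t} {M} {X} {Φ} {e} {w} pD pt pX pe pw absθ t≤5D Φe e≤1 w≤Φ absκ absλ =
      abs-≡ (sym decomposition) total
        (abs-+ (abs-+ (abs-+
          (abs-* (abs-* (abs-ℕ 2) absλ) abs-we)
          (abs-* (abs-* absλ absλ) abs-e))
          (abs-* (abs-ℕ 25) abs-eθ))
          (abs-neg (abs-* (abs-* (abs-ℕ 10) absκ) abs-te)))
      where
      κ ε θ : Carrier
      κ = nat 5 * D - Φ
      ε = nat 5 * M - w
      θ = nat 2 * D * t - M * M
      -- Substitute `5D = Φ + κ` and `5M = w + ε` into `2Dt = M² + θ`, multiplied by `25 e`, and use
      -- `Φ e = 1`.
      decomposition : nat 10 * t - w * w * e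
        ≡ nat 2 * ε * (w * e) + ε * ε * e + nat 25 * (e * θ) + - (nat 10 * κ * (t * e))
      decomposition = trans
        (trans (solve 3 (λ t w e → # 10 :* t :- w :* w :* e := # 10 :* t :* # 1 :- w :* w :* e) refl t w e)
          (cong (λ z → nat 10 * t * z - w * w * e) (sym Φe)))
        (solve 6 (λ D t M Φ e w → let κ = # 5 :* D :- Φ ; ε = # 5 :* M :- w ; θ = # 2 :* D :* t :- M :* M in
          # 10 :* t :* (Φ :* e) :- w :* w :* e
            := # 2 :* ε :* (w :* e) :+ ε :* ε :* e :+ # 25 :* (e :* θ) :+ :- (# 10 :* κ :* (t :* e))) refl D t M Φ e w)
      abs-e : Abs e (nat 1)
      abs-e = abs-nonNeg pe e≤1
      abs-we : Abs (w * e) (nat 1)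
      abs-we = abs-nonNeg (nonNeg-* pw pe) (nonNeg-≡
        (trans (solve 3 (λ Φ w e → (Φ :- w) :* e := Φ :* e :- w :* e) refl Φ w e) (cong (λ z → z - w * e) Φe))
        (nonNeg-* w≤Φ pe))
      κe≤4 : κ * e ≤ nat 4
      κe≤4 = proj₁ (abs-≡ refl (solve 0 (# 4 :* # 1 := # 4) refl) (abs-* absκ abs-e))
      De≤1 : D * e ≤ nat 1
      De≤1 = nonNeg-cancel 4 (nonNeg-≡ (trans
        (solve 3 (λ D Φ e → # 4 :- (# 5 :* D :- Φ) :* e := # 4 :+ Φ :* e :- # 5 :* (D :* e)) refl D Φ e)
        (trans (cong (λ z → nat 4 + z - nat 5 * (D * e)) Φe)
          (solve 1 (λ y → # 4 :+ # 1 :- # 5 :* y := # 5 :* (# 1 :- y)) refl (D * e)))) κe≤4)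
      abs-te : Abs (t * e) (nat 5)
      abs-te = abs-nonNeg (nonNeg-* pt pe) (nonNeg-≡
        (solve 3 (λ D t e → (# 5 :* D :- t) :* e :+ # 5 :* (# 1 :- D :* e) := # 5 :- t :* e) refl D t e)
        (nonNeg-+ (nonNeg-* t≤5D pe) (nonNeg-* (nonNeg-ℕ 5) De≤1)))
      abs-eθ : Abs (e * θ) (nat 4 * X)
      abs-eθ = abs-weaken (nonNeg-≡
          (solve 3 (λ D X e → # 4 :* X :* (# 1 :- D :* e) := # 4 :* X :- e :* (# 4 :* D :* X)) refl D X e)
          (nonNeg-* (nonNeg-* (nonNeg-ℕ 4) pX) De≤1))
        (abs-* (abs-nonNeg pe (nonNeg-≡ (solve 1 (λ e → # 0 := e :- e) refl e) (nonNeg-ℕ 0))) absθ)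
      total : nat 2 * nat 4 * nat 1 + nat 4 * nat 4 * nat 1 + nat 25 * (nat 4 * X) + nat 10 * nat 4 * nat 5 ≡ nat 224 + nat 100 * X
      total = solve 1 (λ X → # 2 :* # 4 :* # 1 :+ # 4 :* # 4 :* # 1 :+ # 25 :* (# 4 :* X) :+ # 10 :* # 4 :* # 5 := # 224 :+ # 100 :* X) refl X

    -- With `N` the positive integer `suc n`, `10 N x = E` gives `100 N² x² ≤ k² s² ≤ 5 k² N`; the
    -- remaining `95 k² N` is slack, and `100 N` is cancelled.
    error-bound : ∀ {k n s E x} → s * s ≤ nat 5 * nat (suc n) → Abs E (nat k * s) → nat 10 * (nat (suc n) * x) ≡ E →
      nat (suc n) * x * x ≤ nat (k ℕ.* k)
    error-bound {k} {n} {s} {_} {x} s²≤ absE refl = nonNeg-cancel 99 (nonNeg-cancel n (nonNeg-≡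
        (trans (solve 4 (λ k N s x →
            (k :* s) :* (k :* s) :- (# 10 :* (N :* x)) :* (# 10 :* (N :* x)) :+ k :* k :* (# 5 :* N :- s :* s) :+ # 95 :* ((k :* k) :* N)
            := N :* (# 100 :* (k :* k :- N :* x :* x))) refl (nat k) (nat (suc n)) s x)
          (cong (λ z → nat (suc n) * (nat 100 * (z - nat (suc n) * x * x))) (sym (nat-* k k))))
        (nonNeg-+ (nonNeg-+ (abs-square absE) (nonNeg-* (nonNeg-* (nonNeg-ℕ k) (nonNeg-ℕ k)) s²≤))
          (nonNeg-* (nonNeg-ℕ 95) (nonNeg-* (nonNeg-* (nonNeg-ℕ k) (nonNeg-ℕ k)) (nonNeg-ℕ (suc n)))))))

  -- From c to the powers of φ, and the three main terms

  module Asymptotics (G : GoldenRing) where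
    open GoldenRing G
    open Golden-Solver G
    open Estimates G
    open Fibonacci using (s)

    φ⁻¹′ : Carrier
    φ⁻¹′ = φ - 1#

    private
      φ⁻¹≡ : φ⁻¹′ ≡ φ - nat 1
      φ⁻¹≡ = cong (λ z → φ - z) (sym fromℤ-1)

    pow-inverse : ∀ k → pow φ k * pow φ⁻¹′ k ≡ nat 1
    pow-inverse zero    = trans (cong₂ _*_ (sym fromℤ-1) (sym fromℤ-1)) (solve 0 (# 1 :* # 1 := # 1) refl)
    pow-inverse (suc k) = trans (cong (λ z → φ * pow φ k * (z * pow φ⁻¹′ k)) φ⁻¹≡)
      (trans (solve 2 (λ x y → :φ :* x :* ((:φ :- # 1) :* y) := x :* y) refl (pow φ k) (pow φ⁻¹′ k)) (pow-inverse k))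

    pow-φ⁻¹-nonNeg : ∀ k → NonNeg (pow φ⁻¹′ k)
    pow-φ⁻¹-nonNeg zero    = nonNeg-≡ fromℤ-1 (nonNeg-ℕ 1)
    pow-φ⁻¹-nonNeg (suc k) = nonNeg-* (nonNeg-≡ (sym φ⁻¹≡) 1≤φ) (pow-φ⁻¹-nonNeg k)

    pow-φ⁻¹-≤1 : ∀ k → pow φ⁻¹′ k ≤ nat 1
    pow-φ⁻¹-≤1 zero    = nonNeg-≡ (trans (solve 0 (# 0 := # 1 :- # 1) refl) (cong (λ z → nat 1 - z) fromℤ-1)) (nonNeg-ℕ 0)
    pow-φ⁻¹-≤1 (suc k) = nonNeg-≡
      (trans (solve 1 (λ y → (# 1 :- y) :+ (# 2 :- :φ) :* y := # 1 :- (:φ :- # 1) :* y) refl (pow φ⁻¹′ k))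
        (cong (λ z → nat 1 - z * pow φ⁻¹′ k) (sym φ⁻¹≡)))
      (nonNeg-+ (pow-φ⁻¹-≤1 k) (nonNeg-* φ≤2 (pow-φ⁻¹-nonNeg k)))

    pow-+ : ∀ m n → pow φ (m ℕ.+ n) ≡ pow φ m * pow φ n
    pow-+ zero    n = sym (*-identityˡ (pow φ n))
    pow-+ (suc m) n = trans (cong (φ *_) (pow-+ m n)) (sym (*-assoc φ (pow φ m) (pow φ n)))

    pow-double : ∀ j → pow φ (j ℕ.+ j) ≡ s j * s j
    pow-double j = trans (pow-+ j j) (cong₂ _*_ (pow-s j) (pow-s j))

    pow-3 : ∀ j → pow φ (3 ℕ.+ (j ℕ.+ j)) ≡ φ³ * (s j * s j)
    pow-3 j = trans (cong (λ z → φ * (φ * (φ * z))) (pow-double j))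
      (solve 1 (λ x → :φ :* (:φ :* (:φ :* x)) := (# 2 :* :φ :+ # 1) :* x) refl (s j * s j))

    pow-4 : ∀ j → pow φ (4 ℕ.+ (j ℕ.+ j)) ≡ φ⁴ * (s j * s j)
    pow-4 j = trans (cong (φ *_) (pow-3 j))
      (solve 1 (λ x → :φ :* ((# 2 :* :φ :+ # 1) :* x) := (# 3 :* :φ :+ # 2) :* x) refl (s j * s j))

    nonNeg-√5 : NonNeg √5′
    nonNeg-√5 = nonNeg-≡ (trans (solve 0 (:φ :+ (:φ :- # 1) := # 2 :* :φ :+ con (-[1+ 0 ] , pos 0)) refl) (sym √5′-φ))
      (nonNeg-+ nonNeg-φ 1≤φ)

    √5-square : √5′ * √5′ ≡ nat 5
    √5-square = trans (cong₂ _*_ √5′-φ √5′-φ)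
      (solve 0 ((# 2 :* :φ :+ con (-[1+ 0 ] , pos 0)) :* (# 2 :* :φ :+ con (-[1+ 0 ] , pos 0)) := # 5) refl)

    √5-inv : √5′ * inv √5′ ≡ nat 1
    √5-inv = trans (inv-unit {√5′} {√5′ * inv (nat 5)}
        (trans (sym (*-assoc √5′ √5′ (inv (nat 5)))) (trans (cong (_* inv (nat 5)) √5-square) (inv-ℕ 4))))
      (sym fromℤ-1)

    -- Φ and e stand for φᵖ and φ⁻ᵖ.
    module Scale (n′ : ℕ) (Φ e : Carrier) (Φe : Φ * e ≡ nat 1) (nonNeg-Φ : NonNeg Φ) where
      n = suc n′
      N = nat n
      c = √5′ * N * e

      private
        √5c : √5′ * c ≡ nat 5 * N * e
        √5c = trans (solve 3 (λ r N e → r :* (r :* N :* e) := (r :* r) :* N :* e) refl √5′ N e)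
          (cong (λ z → z * N * e) √5-square)

        scale : ∀ k → (nat 5 * N * e - k) * Φ ≡ nat 5 * N - k * Φ
        scale k = trans (solve 4 (λ N e k Φ → (# 5 :* N :* e :- k) :* Φ := # 5 :* N :* (Φ :* e) :- k :* Φ) refl N e k Φ)
          (trans (cong (λ z → nat 5 * N * z - k * Φ) Φe)
            (solve 3 (λ N k Φ → # 5 :* N :* # 1 :- k :* Φ := # 5 :* N :- k :* Φ) refl N k Φ))

        clear : ∀ k → √5′ * (c - k * inv √5′) ≡ nat 5 * N * e - k
        clear k = trans (solve 4 (λ r c k i → r :* (c :- k :* i) := r :* c :- k :* (r :* i)) refl √5′ c k (inv √5′))
          (trans (cong₂ (λ y z → y - k * z) √5c √5-inv)
            (solve 2 (λ y k → y :- k :* # 1 := y :- k) refl (nat 5 * N * e) k))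

      -- Since `√5 c Φ = 5 N`, multiplication by `√5 Φ` removes `c`, √5 and the inverse at once.
      below-scale : ∀ k → k * inv √5′ ≤ c → k * Φ ≤ nat 5 * N
      below-scale k p = nonNeg-≡ (trans (cong (_* Φ) (clear k)) (scale k))
        (nonNeg-* (nonNeg-* nonNeg-√5 p) nonNeg-Φ)

      below-one : inv √5′ ≤ c → nat 1 * Φ ≤ nat 5 * N
      below-one p = below-scale (nat 1) (subst (_≤ c) (solve 1 (λ x → x := # 1 :* x) refl (inv √5′)) p)

      above-scale : ∀ k → c ≤ k * inv √5′ → nat 5 * N ≤ k * Φ
      above-scale k p = nonNeg-≡
        (trans (solve 4 (λ r c ki Φ → r :* (ki :- c) :* Φ := :- (r :* (c :- ki) :* Φ)) refl √5′ c (k * inv √5′) Φ)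
          (trans (cong -_ (trans (cong (_* Φ) (clear k)) (scale k)))
            (solve 2 (λ x y → :- (x :- y) := y :- x) refl (nat 5 * N) (k * Φ))))
        (nonNeg-* (nonNeg-* nonNeg-√5 p) nonNeg-Φ)

      -- Otherwise `5 N ≤ φ Φ ≤ φ³ < 5`, against `N ≥ 1`. The multipliers 4, `4 φ` and 20, together
      -- with `8 φ ≤ 13`, make the combination collapse to -3.
      too-small : Φ ≤ φ + nat 1 → ¬ (c ≤ φ * inv √5′)
      too-small Φ≤ hi = ¬nonNeg-minus-one (nonNeg-cancel 2 (nonNeg-≡
        (solve 2 (λ N Φ → (# 4 :* (:φ :* Φ :- # 5 :* N) :+ # 4 :* (:φ :* ((:φ :+ # 1) :- Φ)) :+ # 20 :* (N :- # 1)) :+ (# 13 :+ con (-[1+ 7 ] , pos 0) :* :φ)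
           := # 3 :* con (-[1+ 0 ] , pos 0)) refl N Φ)
        (nonNeg-+ (nonNeg-+ (nonNeg-+ (nonNeg-* (nonNeg-ℕ 4) (above-scale φ hi)) (nonNeg-* (nonNeg-ℕ 4) (nonNeg-* nonNeg-φ Φ≤)))
          (nonNeg-* (nonNeg-ℕ 20) (nat-mono (s≤s z≤n)))) φ-upper)))

      -- The denominators of the main terms all have the form `10 u N e` with a unit `u`. An
      -- explicit inverse assembled from the factors identifies the value of `inv`.
      inv-scale : ∀ {u u′ W} → u * u′ ≡ nat 1 → W ≡ nat 10 * u * N * e → nat 10 * N * inv W ≡ u′ * Φ
      inv-scale {u} {u′} {W} uu′ refl = begin
        nat 10 * N * inv W                               ≡⟨ solve 2 (λ N y → # 10 :* N :* y := # 10 :* N :* y :* (# 1 :* # 1)) refl N (inv W) ⟩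
        nat 10 * N * inv W * (nat 1 * nat 1)             ≡⟨ cong (λ z → nat 10 * N * inv W * z) (sym (cong₂ _*_ uu′ Φe)) ⟩
        nat 10 * N * inv W * ((u * u′) * (Φ * e))        ≡⟨ solve 6 (λ N y u u′ Φ e → # 10 :* N :* y :* ((u :* u′) :* (Φ :* e)) := ((# 10 :* u :* N :* e) :* y) :* (u′ :* Φ)) refl N (inv W) u u′ Φ e ⟩
        (W * inv W) * (u′ * Φ)                           ≡⟨ cong (_* (u′ * Φ)) (inv-unit {W} {inv (nat 10) * inv N * u′ * Φ} unit) ⟩
        1# * (u′ * Φ)                                    ≡⟨ *-identityˡ _ ⟩
        u′ * Φ ∎
        where
        open ≡-Reasoning
        unit : W * (inv (nat 10) * inv N * u′ * Φ) ≡ 1#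
        unit = trans (solve 8 (λ t i N ν u u′ Φ e → (t :* u :* N :* e) :* (i :* ν :* u′ :* Φ) := (t :* i) :* (N :* ν) :* (u :* u′) :* (Φ :* e))
                       refl (nat 10) (inv (nat 10)) N (inv N) u u′ Φ e)
          (trans (cong₂ _*_ (cong₂ _*_ (cong₂ _*_ (trans (inv-ℕ 9) (sym fromℤ-1)) (trans (inv-ℕ n′) (sym fromℤ-1))) uu′) Φe)
            (trans (solve 0 (# 1 :* # 1 :* # 1 :* # 1 := # 1) refl) fromℤ-1))

      private
        N-inv : N * inv N ≡ nat 1
        N-inv = trans (inv-ℕ n′) (sym fromℤ-1)

        inverse-2√5c : nat 10 * N * inv (nat 2 * √5′ * c) ≡ Φ
        inverse-2√5c = trans (inv-scale {nat 1} {nat 1} (solve 0 (# 1 :* # 1 := # 1) refl)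
            (trans (solve 2 (λ r c → # 2 :* r :* c := # 2 :* (r :* c)) refl √5′ c)
              (trans (cong (nat 2 *_) √5c) (solve 2 (λ N e → # 2 :* (# 5 :* N :* e) := # 10 :* # 1 :* N :* e) refl N e))))
          (solve 1 (λ x → # 1 :* x := x) refl Φ)

      -- The factor `10 N` clears both the division by n and the denominator containing `c`;
      -- `5 - 3φ` is φ⁻⁴.
      error-odd : ∀ t {p₄} → p₄ ≡ φ⁴ →
        nat 10 * (N * (t * inv N - inv (nat 2 * √5′ * p₄ * c))) ≡ nat 10 * t - (nat 5 - nat 3 * φ) * Φ
      error-odd t {p₄} refl = trans
        (solve 4 (λ N t ν y → # 10 :* (N :* (t :* ν :- y)) := # 10 :* t :* (N :* ν) :- # 10 :* N :* y) refl N t (inv N) (inv (nat 2 * √5′ * φ⁴ * c)))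
        (trans (cong₂ (λ u v → nat 10 * t * u - v) N-inv
            (inv-scale {φ⁴} {nat 5 - nat 3 * φ} (solve 0 ((# 3 :* :φ :+ # 2) :* (# 5 :- # 3 :* :φ) := # 1) refl)
              (trans (solve 3 (λ r p c → # 2 :* r :* p :* c := # 2 :* p :* (r :* c)) refl √5′ φ⁴ c)
                (trans (cong (λ z → nat 2 * φ⁴ * z) √5c)
                  (solve 3 (λ p N e → # 2 :* p :* (# 5 :* N :* e) := # 10 :* p :* N :* e) refl φ⁴ N e)))))
          (solve 2 (λ t z → # 10 :* t :* # 1 :- z := # 10 :* t :- z) refl t ((nat 5 - nat 3 * φ) * Φ)))

      private
        halves : ∀ k → nat 10 * (N * (half′ * √5′ * k * c)) ≡ nat 25 * k * (N * N * e)
        halves k = trans (solve 5 (λ N h r k c → # 10 :* (N :* (h :* r :* k :* c)) := # 5 :* k :* N :* (# 2 :* h) :* (r :* c)) refl N half′ √5′ k c)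
          (trans (cong₂ (λ u v → nat 5 * k * N * u * v) (trans half′-half (sym fromℤ-1)) √5c)
            (solve 3 (λ k N e → # 5 :* k :* N :* # 1 :* (# 5 :* N :* e) := # 25 :* k :* (N :* N :* e)) refl k N e))

        Φ²e : Φ * Φ * e ≡ Φ
        Φ²e = trans (*-assoc Φ Φ e) (trans (cong (Φ *_) Φe) (solve 1 (λ x → x :* # 1 := x) refl Φ))

        expand-square : ∀ k → (nat 5 * N - k * Φ) * (nat 5 * N - k * Φ) * e ≡ nat 25 * (N * N * e) - nat 10 * k * N + k * k * Φ
        expand-square k = trans (solve 4 (λ N k Φ e → (# 5 :* N :- k :* Φ) :* (# 5 :* N :- k :* Φ) :* e
              := # 25 :* (N :* N :* e) :- # 10 :* k :* N :* (Φ :* e) :+ k :* k :* (Φ :* Φ :* e)) refl N k Φ e)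
          (trans (cong₂ (λ u v → nat 25 * (N * N * e) - nat 10 * k * N * u + k * k * v) Φe Φ²e)
            (solve 4 (λ N k Φ z → # 25 :* z :- # 10 :* k :* N :* # 1 :+ k :* k :* Φ := # 25 :* z :- # 10 :* k :* N :+ k :* k :* Φ) refl N k Φ (N * N * e)))

      -- The terms in `N²`, `N` and `Φ` complete to `(5N - Φ)² e`, the contribution of the included
      -- triangle. What is left, `φ⁻⁵ Φ`, belongs to the full levels.
      error-even₁ : ∀ t {q₅} → q₅ ≡ nat 5 * φ - nat 8 →
        nat 10 * (N * (t * inv N - (half′ * √5′ * c + (nat 1 + q₅) * inv (nat 2 * √5′ * c) - nat 1)))
          ≡ nat 10 * t - (nat 5 * φ - nat 8) * Φ - (nat 5 * N - Φ) * (nat 5 * N - Φ) * e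
      error-even₁ t refl = trans
        (solve 6 (λ N t ν h c y → # 10 :* (N :* (t :* ν :- (h :* c :+ (# 1 :+ (# 5 :* :φ :- # 8)) :* y :- # 1)))
            := # 10 :* t :* (N :* ν) :- # 10 :* (N :* (h :* # 1 :* c)) :- (# 5 :* :φ :- # 7) :* (# 10 :* N :* y) :+ # 10 :* N)
          refl N t (inv N) (half′ * √5′) c (inv (nat 2 * √5′ * c)))
        (trans (cong₂ (λ (u , v) w → nat 10 * t * u - v - (nat 5 * φ - nat 7) * w + nat 10 * N)
            (cong₂ _,_ N-inv (halves (nat 1))) inverse-2√5c)
          (trans (solve 4 (λ N t Φ z → # 10 :* t :* # 1 :- # 25 :* # 1 :* z :- (# 5 :* :φ :- # 7) :* Φ :+ # 10 :* N
                := # 10 :* t :- (# 5 :* :φ :- # 8) :* Φ :- (# 25 :* z :- # 10 :* # 1 :* N :+ # 1 :* # 1 :* Φ)) refl N t Φ (N * N * e))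
            (cong (λ z → nat 10 * t - (nat 5 * φ - nat 8) * Φ - z)
              (trans (sym (expand-square (nat 1)))
                (solve 3 (λ N Φ e → (# 5 :* N :- # 1 :* Φ) :* (# 5 :* N :- # 1 :* Φ) :* e := (# 5 :* N :- Φ) :* (# 5 :* N :- Φ) :* e) refl N Φ e)))))

      -- The square is now completed around `φ Φ`, whose inverse is `(φ - 1) e`; it stands for the
      -- excluded triangle and has the opposite sign. The full levels account for `φ⁻³ Φ`.
      error-even₂ : ∀ t {q₁ q₂} → q₁ ≡ φ - nat 1 → q₂ ≡ nat 2 - φ →
        nat 10 * (N * (t * inv N - (nat 1 - half′ * √5′ * q₁ * c - (nat 1 + q₂) * inv (nat 2 * √5′ * c))))
          ≡ nat 10 * t - (nat 2 * φ - nat 3) * Φ + (φ * Φ - nat 5 * N) * (φ * Φ - nat 5 * N) * ((φ - nat 1) * e)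
      error-even₂ t refl refl = trans
        (solve 5 (λ N t ν g y → # 10 :* (N :* (t :* ν :- (# 1 :- g :- (# 1 :+ (# 2 :- :φ)) :* y)))
            := # 10 :* t :* (N :* ν) :+ # 10 :* (N :* g) :+ (# 3 :- :φ) :* (# 10 :* N :* y) :- # 10 :* N)
          refl N t (inv N) (half′ * √5′ * (φ - nat 1) * c) (inv (nat 2 * √5′ * c)))
        (trans (cong₂ (λ (u , v) w → nat 10 * t * u + v + (nat 3 - φ) * w - nat 10 * N)
            (cong₂ _,_ N-inv (halves (φ - nat 1))) inverse-2√5c)
          (trans (solve 4 (λ N t Φ z → # 10 :* t :* # 1 :+ # 25 :* (:φ :- # 1) :* z :+ (# 3 :- :φ) :* Φ :- # 10 :* N
                := # 10 :* t :- (# 2 :* :φ :- # 3) :* Φ :+ (:φ :- # 1) :* (# 25 :* z :- # 10 :* :φ :* N :+ :φ :* :φ :* Φ)) refl N t Φ (N * N * e))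
            (trans (cong (λ z → nat 10 * t - (nat 2 * φ - nat 3) * Φ + (φ - nat 1) * z) (sym (expand-square φ)))
              (solve 4 (λ N x Φ e → x :+ (:φ :- # 1) :* ((# 5 :* N :- :φ :* Φ) :* (# 5 :* N :- :φ :* Φ) :* e)
                := x :+ (:φ :* Φ :- # 5 :* N) :* (:φ :* Φ :- # 5 :* N) :* ((:φ :- # 1) :* e)) refl N (nat 10 * t - (nat 2 * φ - nat 3) * Φ) Φ e))))

    private
      gap-below : ∀ m n {Y} → Abs (nat 5 * nat m - Y) (nat 4) → Y ≤ nat 5 * nat n → m ℕ.≤ n
      gap-below m n {Y} approx p = nat-≤-from-gap m n (≤-trans (≤-abs approx)
        (nonNeg-≡ (solve 3 (λ y n k → n :- y := (n :+ k) :- (y :+ k)) refl Y (nat 5 * nat n) (nat 4)) p))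

      gap-above : ∀ m n {Y} → Abs (nat 5 * nat m - Y) (nat 4) → nat 5 * nat n ≤ Y → n ℕ.≤ m
      gap-above m n {Y} approx p = nat-≤-from-gap n m (≤-trans p (≥-abs approx))

      2≤4 : nat 2 ≤ nat 4
      2≤4 = nat-mono (s≤s (s≤s z≤n))

      approx-2AB : ∀ j → Abs (nat 5 * nat (2 ℕ.* (fib (1 ℕ.+ j) ℕ.* fib (2 ℕ.+ j))) - nat 2 * (φ³ * (s j * s j))) (nat 4)
      approx-2AB j = abs-≡
        (trans (solve 2 (λ x y → # 2 :* (# 5 :* x :- y) := # 5 :* (# 2 :* x) :- # 2 :* y) refl (nat (fib (1 ℕ.+ j) ℕ.* fib (2 ℕ.+ j))) (φ³ * (s j * s j)))
          (cong (λ z → nat 5 * z - nat 2 * (φ³ * (s j * s j))) (sym (nat-* 2 (fib (1 ℕ.+ j) ℕ.* fib (2 ℕ.+ j))))))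
        (solve 0 (# 2 :* # 2 := # 4) refl)
        (abs-* (abs-ℕ 2) (approx-AB j))

      abs-estimate : ∀ {D M X t} → Estimate D M X t →
        Abs (nat 2 * nat D * nat t - nat M * nat M) (nat 4 * nat D * nat X) × nat t ≤ nat 5 * nat D
      abs-estimate {D} {M} {X} {t} (upper , lower , t≤) =
          ( nonNeg-≡ (trans (cong₂ _-_ (trans (nat-+ (M ℕ.* M) (4 ℕ.* D ℕ.* X)) (cong₂ _+_ MM 4DX)) 2Dt)
              (solve 3 (λ m x d → (m :+ x) :- d := x :- (d :- m)) refl (nat M * nat M) (nat 4 * nat D * nat X) (nat 2 * nat D * nat t)))
              (nat-mono upper)
          , nonNeg-≡ (trans (cong₂ _-_ (trans (nat-+ (2 ℕ.* D ℕ.* t) (4 ℕ.* D ℕ.* X)) (cong₂ _+_ 2Dt 4DX)) MM)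
              (solve 3 (λ m x d → (d :+ x) :- m := x :+ (d :- m)) refl (nat M * nat M) (nat 4 * nat D * nat X) (nat 2 * nat D * nat t)))
              (nat-mono lower))
        , nonNeg-≡ (cong (λ z → z - nat t) (nat-* 5 D)) (nat-mono t≤)
        where
        MM : nat (M ℕ.* M) ≡ nat M * nat M
        MM = nat-* M M
        4DX : nat (4 ℕ.* D ℕ.* X) ≡ nat 4 * nat D * nat X
        4DX = trans (nat-* (4 ℕ.* D) X) (cong (_* nat X) (nat-* 4 D))
        2Dt : nat (2 ℕ.* D ℕ.* t) ≡ nat 2 * nat D * nat t
        2Dt = trans (nat-* (2 ℕ.* D) t) (cong (_* nat t) (nat-* 2 D))

      nat-∸ : ∀ {m n} → m ℕ.≤ n → nat (n ℕ.∸ m) ≡ nat n - nat m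
      nat-∸ {m} {n} m≤n = trans (solve 2 (λ x y → x := (x :+ y) :- y) refl (nat (n ℕ.∸ m)) (nat m))
        (cong (λ z → z - nat m) (trans (sym (nat-+ (n ℕ.∸ m) m)) (cong nat (ℕ.m∸n+n≡m m≤n))))

      nonNeg-s : ∀ j → NonNeg (s j)
      nonNeg-s j = nonNeg-≡ (minus-plus (s j)) (nonNeg-+ (s≥1 j) (nonNeg-ℕ 1))

      nonNeg-φ³ss : ∀ j → NonNeg (φ³ * (s j * s j))
      nonNeg-φ³ss j = nonNeg-* (nonNeg-+ (nonNeg-* (nonNeg-ℕ 2) nonNeg-φ) (nonNeg-ℕ 1)) (nonNeg-* (nonNeg-s j) (nonNeg-s j))

      -- `F(j+4) ≤ 5 s` and `1 ≤ s` bound the two summands by `500 s` and `224 s`.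
      triangle-radius : ∀ j → nat 224 + nat 100 * nat (fib (4 ℕ.+ j)) ≤ nat 724 * s j
      triangle-radius j = nonNeg-≡ (solve 2 (λ s X → # 224 :* (s :- # 1) :+ # 100 :* (# 5 :* s :- X) := # 724 :* s :- (# 224 :+ # 100 :* X)) refl (s j) (nat (fib (4 ℕ.+ j))))
        (nonNeg-+ (nonNeg-* (nonNeg-ℕ 224) (s≥1 j)) (nonNeg-* (nonNeg-ℕ 100) (fib-4≤5s j)))

    -- The size of the counted set in the three cases

    module Cases {n : ℕ} {S : List ℕ} (uniqueS : Unique S)
      (spec : ∀ m → (m ∈ S → 1 ℕ.≤ m × m ℕ.≤ n × HasTwoGood m) × (1 ℕ.≤ m × m ℕ.≤ n × HasTwoGood m → m ∈ S)) where

      private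
        N = nat n
        size = nat (length S)

      -- The window of an odd exponent lies within the stretch where exactly the levels below `i`
      -- count. The error is only `13 s`; 750 is the constant shared by the three cases.
      size-odd : ∀ i → φ³ * (s i * s i) ≤ nat 5 * N → nat 5 * N ≤ φ⁴ * (s i * s i) →
        Abs (nat 10 * size - (φ - nat 1) * (s i * s i)) (nat 750 * s i)
      size-odd i lo hi = abs-weaken
        (nonNeg-≡ (solve 1 (λ s → # 737 :* s := # 750 :* s :- # 13 :* s) refl (s i)) (nonNeg-* (nonNeg-ℕ 737) (nonNeg-s i)))
        (abs-≡ (cong (λ z → nat 10 * nat z - (φ - nat 1) * (s i * s i)) full) refl (levels-estimate i))
        where
        open Counting uniqueS spec
        full : length (levels i) ≡ length S
        full = count-full-levels i
          (gap-below (fib (1 ℕ.+ i) ℕ.* fib (2 ℕ.+ i)) n (abs-weaken 2≤4 (approx-AB i)) lo)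
          (ℕ.≤-<-trans (gap-above (fib (1 ℕ.+ i) ℕ.* fib (3 ℕ.+ i)) n (approx-AC i) hi) (ℕ.m<m+n _ (fib-pos (2 ℕ.+ i))))

      module _ (j : ℕ) where
        private
          A B C D D′ : ℕ
          A = fib (1 ℕ.+ j)
          B = fib (2 ℕ.+ j)
          C = fib (3 ℕ.+ j)
          D = A ℕ.* C
          D′ = B ℕ.* C

        open CountingEstimates uniqueS spec j

        size-even₁ : ∀ {e} → φ⁴ * (s j * s j) * e ≡ nat 1 → NonNeg e → e ≤ nat 1 →
          φ⁴ * (s j * s j) ≤ nat 5 * N → nat 5 * N ≤ nat 2 * (φ³ * (s j * s j)) →
          Abs (nat 10 * size - (φ - nat 1) * (s j * s j) - (nat 5 * N - φ⁴ * (s j * s j)) * (nat 5 * N - φ⁴ * (s j * s j)) * e) (nat 750 * s j)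
        size-even₁ {e} Φe pe e≤1 lo hi = bound (small-part (gap-below D n (approx-AC j) lo)
             (gap-above (2 ℕ.* (A ℕ.* B)) n (approx-2AB j) hi))
          where
          w : Carrier
          w = nat 5 * N - φ⁴ * (s j * s j)
          w≤Φ : w ≤ φ⁴ * (s j * s j)
          -- Up to the threshold `w` is at most `(2φ³ - φ⁴) s²`, and `2φ⁴ - 2φ³ = 2(φ + 1)` is
          -- nonnegative.
          w≤Φ = nonNeg-≡ (solve 2 (λ x n → (# 2 :* ((# 2 :* :φ :+ # 1) :* x) :- n) :+ # 2 :* ((:φ :+ # 1) :* x)
                  := (# 3 :* :φ :+ # 2) :* x :- (n :- (# 3 :* :φ :+ # 2) :* x)) refl (s j * s j) (nat 5 * N))
            (nonNeg-+ hi (nonNeg-* (nonNeg-ℕ 2) (nonNeg-* (nonNeg-+ nonNeg-φ (nonNeg-ℕ 1)) (nonNeg-* (nonNeg-s j) (nonNeg-s j)))))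
          abs-M : Abs (nat 5 * nat (n ℕ.∸ D) - w) (nat 4)
          abs-M = abs-≡ (trans (solve 3 (λ D n x → :- (# 5 :* D :- x) := # 5 :* (n :- D) :- (# 5 :* n :- x)) refl (nat D) N (φ⁴ * (s j * s j)))
                    (cong (λ z → nat 5 * z - w) (sym (nat-∸ (gap-below D n (approx-AC j) lo))))) refl
                  (abs-neg (approx-AC j))
          bound : (∃ λ t → length S ≡ length (levels j) ℕ.+ t × Estimate D (n ℕ.∸ D) (fib (4 ℕ.+ j)) t) →
            Abs (nat 10 * size - (φ - nat 1) * (s j * s j) - w * w * e) (nat 750 * s j)
          bound (t , size≡ , est) = let bounds = abs-estimate {D} {n ℕ.∸ D} {fib (4 ℕ.+ j)} {t} est in abs-weaken
            (nonNeg-≡ (solve 1 (λ s → # 13 :* s := # 750 :* s :- (# 13 :* s :+ # 724 :* s)) refl (s j)) (nonNeg-* (nonNeg-ℕ 13) (nonNeg-s j)))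
            (abs-≡ (trans (solve 4 (λ L t x z → (# 10 :* L :- x) :+ (# 10 :* t :- z) := # 10 :* (L :+ t) :- x :- z) refl
                     (nat (length (levels j))) (nat t) ((φ - nat 1) * (s j * s j)) (w * w * e))
                   (cong (λ z → nat 10 * z - (φ - nat 1) * (s j * s j) - w * w * e)
                     (trans (sym (nat-+ (length (levels j)) t)) (cong nat (sym size≡))))) refl
              (abs-+ (levels-estimate j) (abs-weaken (triangle-radius j)
                (triangle-estimate (nonNeg-ℕ D) (nonNeg-ℕ t) (nonNeg-ℕ (fib (4 ℕ.+ j))) pe lo
                  (proj₁ bounds) (proj₂ bounds) Φe e≤1 w≤Φ (approx-AC j) abs-M))))

        -- Level `j` is first counted in full, so the levels give `φ⁻¹ (φ s)² = φ s²` with error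
        -- `13 φ s ≤ 26 s`. Adding `724 s` for the missing triangle yields the constant 750.
        size-even₂ : ∀ {e} → φ⁵ * (s j * s j) * e ≡ nat 1 → NonNeg e → e ≤ nat 1 →
          nat 2 * (φ³ * (s j * s j)) ≤ nat 5 * N → nat 5 * N ≤ φ⁵ * (s j * s j) →
          Abs (nat 10 * size - φ * (s j * s j) + (φ⁵ * (s j * s j) - nat 5 * N) * (φ⁵ * (s j * s j) - nat 5 * N) * e) (nat 750 * s j)
        size-even₂ {e} Φe pe e≤1 lo hi = bound (large-part (gap-below (2 ℕ.* (A ℕ.* B)) n (approx-2AB j) lo)
             (gap-above D′ n (abs-weaken 2≤4 (approx-BC j)) hi))
          where
          w : Carrier
          w = φ⁵ * (s j * s j) - nat 5 * N
          w≤Φ : w ≤ φ⁵ * (s j * s j)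
          w≤Φ = nonNeg-≡ (solve 2 (λ x n → n := x :- (x :- n)) refl (φ⁵ * (s j * s j)) (nat 5 * N))
            (nonNeg-* (nonNeg-ℕ 5) (nonNeg-ℕ n))
          abs-M : Abs (nat 5 * nat (D′ ℕ.∸ n) - w) (nat 4)
          abs-M = abs-≡ (trans (solve 3 (λ D n x → # 5 :* D :- x := # 5 :* (D :- n) :- (x :- # 5 :* n)) refl (nat D′) N (φ⁵ * (s j * s j)))
                    (cong (λ z → nat 5 * z - w) (sym (nat-∸ (gap-above D′ n (abs-weaken 2≤4 (approx-BC j)) hi))))) refl
                  (abs-weaken 2≤4 (approx-BC j))
          bound : (∃ λ t → length (levels (suc j)) ≡ length S ℕ.+ t × Estimate D′ (D′ ℕ.∸ n) (fib (4 ℕ.+ j)) t) →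
            Abs (nat 10 * size - φ * (s j * s j) + w * w * e) (nat 750 * s j)
          bound (t , size≡ , est) = let bounds = abs-estimate {D′} {D′ ℕ.∸ n} {fib (4 ℕ.+ j)} {t} est in abs-weaken
            (nonNeg-≡ (solve 1 (λ s → # 13 :* ((# 2 :- :φ) :* s) := # 750 :* s :- (# 13 :* (:φ :* s) :+ # 724 :* s)) refl (s j))
              (nonNeg-* (nonNeg-ℕ 13) (nonNeg-* φ≤2 (nonNeg-s j))))
            (abs-≡ (trans (cong₂ (λ L y → nat 10 * L - (φ - nat 1) * (y * y) + - (nat 10 * nat t - w * w * e))
                       (trans (cong nat size≡) (nat-+ (length S) t)) (s-suc j))
                     (solve 4 (λ L t s z → # 10 :* (L :+ t) :- (:φ :- # 1) :* ((:φ :* s) :* (:φ :* s)) :+ :- (# 10 :* t :- z)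
                       := # 10 :* L :- :φ :* (s :* s) :+ z) refl size (nat t) (s j) (w * w * e)))
                   (cong (λ y → nat 13 * y + nat 724 * s j) (s-suc j))
              (abs-+ (levels-estimate (suc j)) (abs-neg (abs-weaken (triangle-radius j)
                (triangle-estimate (nonNeg-ℕ D′) (nonNeg-ℕ t) (nonNeg-ℕ (fib (4 ℕ.+ j))) pe hi
                  (proj₁ bounds) (proj₂ bounds) Φe e≤1 w≤Φ (abs-weaken 2≤4 (approx-BC j)) abs-M)))))

    -- Error bounds for the density

    module Conclusions {n′ : ℕ} {S : List ℕ} (uniqueS : Unique S)
      (spec : ∀ m → (m ∈ S → 1 ℕ.≤ m × m ℕ.≤ suc n′ × HasTwoGood m) × (1 ℕ.≤ m × m ℕ.≤ suc n′ × HasTwoGood m → m ∈ S)) where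

      open Cases uniqueS spec

      private
        N = nat (suc n′)
        size = nat (length S)

        small-ratio : ∀ j {k} → NonNeg (k - nat 1) → k * (s j * s j) ≤ nat 5 * N → s j * s j ≤ nat 5 * N
        small-ratio j {k} k≥1 = ≤-trans (nonNeg-≡ (solve 2 (λ k x → (k :- # 1) :* x := k :* x :- x) refl k (s j * s j))
          (nonNeg-* k≥1 (nonNeg-* (nonNeg-s j) (nonNeg-s j))))

        drop-one : ∀ x → nat 1 * x ≤ nat 5 * N → x ≤ nat 5 * N
        drop-one x = subst (_≤ nat 5 * N) (solve 1 (λ x → # 1 :* x := x) refl x)

      conclude-odd : ∀ i {p₄} → p₄ ≡ φ⁴ → let c = √5′ * N * pow φ⁻¹′ (3 ℕ.+ (i ℕ.+ i)) in
        inv √5′ ≤ c → c ≤ φ * inv √5′ →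
        let x = size * inv N - inv (nat 2 * √5′ * p₄ * c) in N * x * x ≤ nat (750 ℕ.* 750)
      conclude-odd i p₄≡ lo hi = error-bound {750} {n′} (small-ratio i k≥1 lo′) (size-odd i lo′ hi′)
        (trans (error-odd size p₄≡)
          (solve 2 (λ z x → z :- (# 5 :- # 3 :* :φ) :* ((# 2 :* :φ :+ # 1) :* x) := z :- (:φ :- # 1) :* x) refl (nat 10 * size) (s i * s i)))
        where
        Φ e : Carrier
        Φ = φ³ * (s i * s i)
        e = pow φ⁻¹′ (3 ℕ.+ (i ℕ.+ i))
        Φe : Φ * e ≡ nat 1
        Φe = trans (cong (_* e) (sym (pow-3 i))) (pow-inverse (3 ℕ.+ (i ℕ.+ i)))
        open Scale n′ Φ e Φe (nonNeg-φ³ss i) hiding (n; N)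
        lo′ : Φ ≤ nat 5 * N
        lo′ = drop-one Φ (below-one lo)
        hi′ : nat 5 * N ≤ φ⁴ * (s i * s i)
        hi′ = subst (nat 5 * N ≤_) (solve 1 (λ x → :φ :* ((# 2 :* :φ :+ # 1) :* x) := (# 3 :* :φ :+ # 2) :* x) refl (s i * s i)) (above-scale φ hi)
        k≥1 : NonNeg (φ³ - nat 1)
        k≥1 = nonNeg-≡ (solve 0 (# 2 :* :φ := # 2 :* :φ :+ # 1 :- # 1) refl) (nonNeg-* (nonNeg-ℕ 2) nonNeg-φ)

      module _ (j : ℕ) where
        private
          Φ e : Carrier
          Φ = φ⁴ * (s j * s j)
          e = pow φ⁻¹′ (4 ℕ.+ (j ℕ.+ j))
          Φe : Φ * e ≡ nat 1
          Φe = trans (cong (_* e) (sym (pow-4 j))) (pow-inverse (4 ℕ.+ (j ℕ.+ j)))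
          φ⁴≥1 : NonNeg (φ⁴ - nat 1)
          φ⁴≥1 = nonNeg-≡ (solve 0 (# 3 :* :φ :+ # 1 := # 3 :* :φ :+ # 2 :- # 1) refl) (nonNeg-+ (nonNeg-* (nonNeg-ℕ 3) nonNeg-φ) (nonNeg-ℕ 1))
          nonNeg-Φ : NonNeg Φ
          nonNeg-Φ = nonNeg-* (nonNeg-+ (nonNeg-* (nonNeg-ℕ 3) nonNeg-φ) (nonNeg-ℕ 2)) (nonNeg-* (nonNeg-s j) (nonNeg-s j))
          open Scale n′ Φ e Φe nonNeg-Φ hiding (n; N)
          -- `1 + φ⁻³ = 2 φ⁻¹`, so on the scale of `5n` the threshold is the main term of `5 · 2AB`.
          threshold-scale : ∀ {q₃} → q₃ ≡ nat 2 * φ - nat 3 → (nat 1 + q₃) * Φ ≡ nat 2 * (φ³ * (s j * s j))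
          threshold-scale refl = solve 1 (λ x → (# 1 :+ (# 2 :* :φ :- # 3)) :* ((# 3 :* :φ :+ # 2) :* x) := # 2 :* ((# 2 :* :φ :+ # 1) :* x)) refl (s j * s j)

        conclude-even₁ : ∀ {q₃ q₅} → q₃ ≡ nat 2 * φ - nat 3 → q₅ ≡ nat 5 * φ - nat 8 →
          inv √5′ ≤ c → c ≤ (nat 1 + q₃) * inv √5′ →
          let x = size * inv N - (half′ * √5′ * c + (nat 1 + q₅) * inv (nat 2 * √5′ * c) - nat 1) in N * x * x ≤ nat (750 ℕ.* 750)
        conclude-even₁ {q₃} {q₅} q₃≡ q₅≡ lo thr = error-bound {750} {n′} (small-ratio j φ⁴≥1 lo′)
          (size-even₁ j {e} Φe (pow-φ⁻¹-nonNeg (4 ℕ.+ (j ℕ.+ j))) (pow-φ⁻¹-≤1 (4 ℕ.+ (j ℕ.+ j))) lo′ thr′)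
          (trans (error-even₁ size q₅≡)
            (solve 3 (λ z x y → z :- (# 5 :* :φ :- # 8) :* ((# 3 :* :φ :+ # 2) :* x) :- y := z :- (:φ :- # 1) :* x :- y) refl
              (nat 10 * size) (s j * s j) ((nat 5 * N - Φ) * (nat 5 * N - Φ) * e)))
          where
          lo′ : Φ ≤ nat 5 * N
          lo′ = drop-one Φ (below-one lo)
          thr′ : nat 5 * N ≤ nat 2 * (φ³ * (s j * s j))
          thr′ = subst (nat 5 * N ≤_) (threshold-scale q₃≡) (above-scale (nat 1 + q₃) thr)

        conclude-even₂ : ∀ {q₁ q₂ q₃} → q₁ ≡ φ - nat 1 → q₂ ≡ nat 2 - φ → q₃ ≡ nat 2 * φ - nat 3 →
          inv √5′ ≤ c → c ≤ φ * inv √5′ → (nat 1 + q₃) * inv √5′ ≤ c →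
          let x = size * inv N - (nat 1 - half′ * √5′ * q₁ * c - (nat 1 + q₂) * inv (nat 2 * √5′ * c)) in N * x * x ≤ nat (750 ℕ.* 750)
        conclude-even₂ {q₁} {q₂} {q₃} q₁≡ q₂≡ q₃≡ lo hi thr = error-bound {750} {n′} (small-ratio j φ⁴≥1 (drop-one Φ (below-one lo)))
          (size-even₂ j {e′} Φe′ (nonNeg-* 1≤φ pe) e′≤1 thr′ hi′)
          (trans (error-even₂ size q₁≡ q₂≡)
            (solve 4 (λ z x n e → z :- (# 2 :* :φ :- # 3) :* ((# 3 :* :φ :+ # 2) :* x) :+ (:φ :* ((# 3 :* :φ :+ # 2) :* x) :- n) :* (:φ :* ((# 3 :* :φ :+ # 2) :* x) :- n) :* e
              := z :- :φ :* x :+ ((# 5 :* :φ :+ # 3) :* x :- n) :* ((# 5 :* :φ :+ # 3) :* x :- n) :* e) refl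
              (nat 10 * size) (s j * s j) (nat 5 * N) e′))
          where
          -- One more factor φ⁻¹ inverts `φ⁵ s² = φ Φ`, the main term of `5BC`.
          e′ : Carrier
          e′ = (φ - nat 1) * e
          pe : NonNeg e
          pe = pow-φ⁻¹-nonNeg (4 ℕ.+ (j ℕ.+ j))
          e′≤1 : e′ ≤ nat 1
          e′≤1 = nonNeg-≡ (solve 1 (λ e → (# 1 :- e) :+ (# 2 :- :φ) :* e := # 1 :- (:φ :- # 1) :* e) refl e)
            (nonNeg-+ (pow-φ⁻¹-≤1 (4 ℕ.+ (j ℕ.+ j))) (nonNeg-* φ≤2 pe))
          Φe′ : φ⁵ * (s j * s j) * e′ ≡ nat 1
          Φe′ = trans (solve 2 (λ x e → (# 5 :* :φ :+ # 3) :* x :* ((:φ :- # 1) :* e) := (# 3 :* :φ :+ # 2) :* x :* e) refl (s j * s j) e) Φe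
          thr′ : nat 2 * (φ³ * (s j * s j)) ≤ nat 5 * N
          thr′ = subst (_≤ nat 5 * N) (threshold-scale q₃≡) (below-scale (nat 1 + q₃) thr)
          hi′ : nat 5 * N ≤ φ⁵ * (s j * s j)
          hi′ = subst (nat 5 * N ≤_) (solve 1 (λ x → :φ :* ((# 3 :* :φ :+ # 2) :* x) := (# 5 :* :φ :+ # 3) :* x) refl (s j * s j)) (above-scale φ hi)

-- The order and the inverses of ℚ(√5)

module QuadraticField where
  open import Algebra.Structures using (IsCommutativeRing)
  open import Data.Empty using (⊥-elim)
  open import Data.Integer as ℤ using (ℤ; +_; -[1+_])
  import Data.Integer.Properties as ℤ
  open import Data.Nat using (suc)
  open import Data.Product using (_×_; _,_; proj₂)
  open import Data.Rational as ℚ using (ℚ; 0ℚ; 1ℚ; _+_; _*_; _-_; -_; _≤_; _<_; 1/_; NonZero; ≢-nonZero; positive; nonNegative)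
  open import Data.Rational.Properties
  open import Data.Rational.Solver using (module +-*-Solver)
  import Data.Rational.Unnormalised as ℚᵘ
  import Data.Rational.Unnormalised.Properties as ℚᵘ
  open import Data.Sum using (_⊎_; inj₁; inj₂)
  open import Defs
  open import Relation.Binary.PropositionalEquality using (_≡_; _≢_; refl; sym; trans; cong; cong₂; subst; subst₂)
  open import Relation.Binary.PropositionalEquality.Properties using (isEquivalence)
  open import Relation.Nullary using (¬_; yes; no)
  open import Relation.Nullary.Decidable using (toWitness)
  open GoldenRings using (GoldenRing)

  open +-*-Solver using (solve; _:=_; _:+_; _:*_; _:-_; :-_; con)

  private
    five = (+ 5) ℚ./ 1

  NN : ℚ → Set
  NN x = 0ℚ ≤ x

  nn-≡ : ∀ {x y} → x ≡ y → NN x → NN y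
  nn-≡ = subst NN

  nn-+ : ∀ {x y} → NN x → NN y → NN (x + y)
  nn-+ = +-mono-≤

  nn-* : ∀ {x y} → NN x → NN y → NN (x * y)
  nn-* {x} {y} p q = nonNegative⁻¹ (x * y) {{nonNeg*nonNeg⇒nonNeg x {{nonNegative p}} y {{nonNegative q}}}}

  nn-total : ∀ x → NN x ⊎ NN (- x)
  nn-total x with ≤-total 0ℚ x
  ... | inj₁ p = inj₁ p
  ... | inj₂ p = inj₂ (neg-antimono-≤ p)

  nn-square : ∀ x → NN (x * x)
  nn-square x with nn-total x
  ... | inj₁ p = nn-* p p
  ... | inj₂ p = nn-≡ (solve 1 (λ x → (:- x) :* (:- x) := x :* x) refl x) (nn-* p p)

  ≤⇒nn : ∀ {x y} → x ≤ y → NN (y - x)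
  ≤⇒nn {x} {y} p = subst (_≤ y - x) (+-inverseʳ x) (+-monoˡ-≤ (- x) p)

  nn⇒≤ : ∀ {x y} → NN (y - x) → x ≤ y
  nn⇒≤ {x} {y} p = subst₂ _≤_ (+-identityˡ x) (solve 2 (λ x y → (y :- x) :+ x := y) refl x y) (+-monoˡ-≤ x p)

  nn-five : NN five
  nn-five = toWitness {a? = 0ℚ ℚ.≤? five} _

  -- `1/p = (1/p)² p` is nonnegative because squares are.
  nn-divide : ∀ p .{{_ : NonZero p}} {x} → NN p → NN (p * x) → NN x
  nn-divide p {x} pp q = nn-≡ (trans (sym (*-assoc (1/ p) p x)) (trans (cong (_* x) (*-inverseˡ p)) (*-identityˡ x)))
    (nn-* (nn-≡ (trans (*-assoc (1/ p) (1/ p) p) (trans (cong (1/ p *_) (*-inverseˡ p)) (*-identityʳ (1/ p))))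
      (nn-* (nn-square (1/ p)) pp)) q)

  -- Otherwise `-(x + y)` and `x - y = 2x - (x + y)` are both positive, and so is their product
  -- `y² - x²`.
  abs-from-squares : ∀ {x y} → NN x → NN (x * x - y * y) → NN (x + y)
  abs-from-squares {x} {y} px p with 0ℚ ℚ.≤? x + y
  ... | yes q = q
  ... | no ¬q = ⊥-elim (<-irrefl refl (<-≤-trans (positive⁻¹ (u * v) {{pos*pos⇒pos u {{positive 0<u}} v {{positive 0<v}}}}) uv≤0))
    where
    u v : ℚ
    u = - (x + y)
    v = x + x + u
    0<u : 0ℚ < u
    0<u = neg-antimono-< (≰⇒> ¬q)
    0<v : 0ℚ < v
    0<v = +-mono-≤-< (nn-+ px px) 0<u
    uv≤0 : u * v ≤ 0ℚ
    uv≤0 = nn⇒≤ (nn-≡ (solve 2 (λ x y → let u = :- (x :+ y) in x :* x :- y :* y := con 0ℚ :- u :* (x :+ x :+ u)) refl x y) p)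

  -- For z = a + b√5, Inner says a ≥ √5 ∣b∣ and Outer says √5 b ≥ ∣a∣; together they cover z ≥ 0.
  Inner Outer : K → Set
  Inner (a , b) = NN a × NN (a * a - five * (b * b))
  Outer (a , b) = NN b × NN (five * (b * b) - a * a)

  fromNonNegK : ∀ x → NonNegK x → Inner x ⊎ Outer x
  fromNonNegK (a , b) (inj₁ (pa , pb)) with nn-total (a * a - five * (b * b))
  ... | inj₁ p = inj₁ (pa , p)
  ... | inj₂ p = inj₂ (pb , nn-≡ (solve 2 (λ u v → :- (u :- v) := v :- u) refl (a * a) (five * (b * b))) p)
  fromNonNegK (a , b) (inj₂ (inj₁ (pa , _ , le))) = inj₁ (pa , ≤⇒nn le)
  fromNonNegK (a , b) (inj₂ (inj₂ (_ , pb , le))) = inj₂ (<⇒≤ pb , ≤⇒nn le)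

  innerNonNegK : ∀ x → Inner x → NonNegK x
  innerNonNegK (a , b) (pa , p) with 0ℚ ℚ.≤? b
  ... | yes pb = inj₁ (pa , pb)
  ... | no ¬pb = inj₂ (inj₁ (pa , ≰⇒> ¬pb , nn⇒≤ p))

  outerNonNegK : ∀ x → Outer x → NonNegK x
  outerNonNegK (a , b) (pb , p) with 0ℚ ℚ.≤? a | 0ℚ ℚ.<? b
  ... | yes pa | _       = inj₁ (pa , pb)
  ... | no ¬pa | yes 0<b = inj₂ (inj₂ (≰⇒> ¬pa , 0<b , nn⇒≤ p))
  -- Here `b = 0`, so `5b² ≥ a²` contradicts `a < 0`.
  ... | no ¬pa | no b≮0  = ⊥-elim (<-irrefl refl (<-≤-trans
          (positive⁻¹ (- a * - a) {{pos*pos⇒pos (- a) {{positive 0<-a}} (- a) {{positive 0<-a}}}})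
          (nn⇒≤ (nn-≡ (trans (cong (λ b → five * (b * b) - a * a) (≤-antisym (≮⇒≥ b≮0) pb))
            (solve 1 (λ a → con five :* (con 0ℚ :* con 0ℚ) :- a :* a := con 0ℚ :- (:- a) :* (:- a)) refl a)) p))))
    where
    0<-a : 0ℚ < - a
    0<-a = neg-antimono-< (≰⇒> ¬pa)

  private
    -- The two norm conditions combine to `(a c)² ≥ (5 b d)²`; the next two lemmas compare squares
    -- in the same way.
    inner-inner : ∀ {a b c d} → Inner (a , b) → Inner (c , d) → NN (a * c + five * (b * d))
    inner-inner {a} {b} {c} {d} (pa , p) (pc , q) = abs-from-squares (nn-* pa pc)
      (nn-≡ (solve 4 (λ a b c d → let f = con five in
          (a :* a :- f :* (b :* b)) :* (c :* c) :+ f :* (b :* b) :* (c :* c :- f :* (d :* d))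
          := a :* c :* (a :* c) :- f :* (b :* d) :* (f :* (b :* d))) refl a b c d)
        (nn-+ (nn-* p (nn-square c)) (nn-* (nn-* nn-five (nn-square b)) q)))

    outer-outer : ∀ {a b c d} → Outer (a , b) → Outer (c , d) → NN (five * (b * d) + a * c)
    outer-outer {a} {b} {c} {d} (pb , p) (pd , q) = abs-from-squares (nn-* nn-five (nn-* pb pd))
      (nn-≡ (solve 4 (λ a b c d → let f = con five in
          f :* (b :* b) :* (f :* (d :* d) :- c :* c) :+ (f :* (b :* b) :- a :* a) :* (c :* c)
          := f :* (b :* d) :* (f :* (b :* d)) :- a :* c :* (a :* c)) refl a b c d)
        (nn-+ (nn-* (nn-* nn-five (nn-square b)) q) (nn-* p (nn-square c))))

    inner-outer : ∀ {a b c d} → Inner (a , b) → Outer (c , d) → NN (a * d + b * c)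
    inner-outer {a} {b} {c} {d} (pa , p) (pd , q) = abs-from-squares (nn-* pa pd)
      (nn-≡ (solve 4 (λ a b c d → let f = con five in
          (a :* a :- f :* (b :* b)) :* (d :* d) :+ b :* b :* (f :* (d :* d) :- c :* c)
          := a :* d :* (a :* d) :- b :* c :* (b :* c)) refl a b c d)
        (nn-+ (nn-* p (nn-square d)) (nn-* (nn-square b) q)))

    double : ∀ {x} → NN x → NN (x + x)
    double p = nn-+ p p

    inner-+ : ∀ {x y} → Inner x → Inner y → Inner (x +K y)
    inner-+ {a , b} {c , d} P@(pa , p) Q@(pc , q) = nn-+ pa pc
      , nn-≡ (solve 4 (λ a b c d → let f = con five ; i = a :* c :+ f :* ((:- b) :* d) in
          (a :* a :- f :* (b :* b)) :+ (c :* c :- f :* (d :* d)) :+ (i :+ i)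
          := (a :+ c) :* (a :+ c) :- f :* ((b :+ d) :* (b :+ d))) refl a b c d)
        (nn-+ (nn-+ p q) (double (inner-inner {a} { - b} {c} {d}
          (pa , nn-≡ (solve 2 (λ a b → a :* a :- con five :* (b :* b) := a :* a :- con five :* ((:- b) :* (:- b))) refl a b) p) Q)))

    outer-+ : ∀ {x y} → Outer x → Outer y → Outer (x +K y)
    outer-+ {a , b} {c , d} P@(pb , p) Q@(pd , q) = nn-+ pb pd
      , nn-≡ (solve 4 (λ a b c d → let f = con five ; i = f :* (b :* d) :+ (:- a) :* c in
          (f :* (b :* b) :- a :* a) :+ (f :* (d :* d) :- c :* c) :+ (i :+ i)
          := f :* ((b :+ d) :* (b :+ d)) :- (a :+ c) :* (a :+ c)) refl a b c d)
        (nn-+ (nn-+ p q) (double (outer-outer { - a} {b} {c} {d}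
          (pb , nn-≡ (solve 2 (λ a b → con five :* (b :* b) :- a :* a := con five :* (b :* b) :- (:- a) :* (:- a)) refl a b) p) Q)))

    -- From `0 ≤ a ≤ -c` follows `5d² ≥ c² ≥ a² ≥ 5b²`, which settles the sign of `b + d`.
    mixed-outer : ∀ {a b c d} → Inner (a , b) → Outer (c , d) → NN (- (a + c)) → Outer (a + c , b + d)
    mixed-outer {a} {b} {c} {d} P@(pa , p) (pd , q) neg = b+d , dominates (nn-total N)
      where
      N : ℚ
      N = (a + c) * (a + c) - five * ((b + d) * (b + d))
      b+d : NN (b + d)
      b+d = nn-≡ (+-comm d b) (abs-from-squares pd (nn-divide five nn-five
        (nn-≡ (solve 4 (λ a b c d → let f = con five ; u = :- (a :+ c) in
            (f :* (d :* d) :- c :* c) :+ u :* (a :+ a :+ u) :+ (a :* a :- f :* (b :* b))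
            := f :* (d :* d :- b :* b)) refl a b c d)
          (nn-+ (nn-+ q (nn-* neg (nn-+ (double pa) neg))) p))))
      swap : ∀ x y → - (x - y) ≡ y - x
      swap = solve 2 (λ x y → :- (x :- y) := y :- x) refl
      dominates : NN N ⊎ NN (- N) → NN (five * ((b + d) * (b + d)) - (a + c) * (a + c))
      dominates (inj₂ r) = nn-≡ (swap ((a + c) * (a + c)) (five * ((b + d) * (b + d)))) r
      -- If the norm `N` of the sum is nonnegative, then `(-(a + c) , b + d)` is inner, and pairing
      -- it with `(a , b)` shows `N ≤ 0` all the same.
      dominates (inj₁ r) = nn-≡ (solve 4 (λ a b c d → let f = con five ; i = (:- (a :+ c)) :* a :+ f :* ((b :+ d) :* b) in
            (f :* (d :* d) :- c :* c) :+ (a :* a :- f :* (b :* b)) :+ (i :+ i)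
            := f :* ((b :+ d) :* (b :+ d)) :- (a :+ c) :* (a :+ c)) refl a b c d)
          (nn-+ (nn-+ q p) (double (inner-inner { - (a + c)} {b + d} {a} {b}
            (neg , nn-≡ (solve 2 (λ u v → u :* u :- v := (:- u) :* (:- u) :- v) refl (a + c) (five * ((b + d) * (b + d)))) r) P)))

    -- The mirror image of `mixed-outer`: `0 ≤ d ≤ -b` yields `a² ≥ 5b² ≥ 5d² ≥ c²`.
    mixed-inner : ∀ {a b c d} → Inner (a , b) → Outer (c , d) → NN (- (b + d)) → Inner (a + c , b + d)
    mixed-inner {a} {b} {c} {d} (pa , p) Q@(pd , q) neg = a+c , dominates (nn-total N)
      where
      N : ℚ
      N = (a + c) * (a + c) - five * ((b + d) * (b + d))
      a+c : NN (a + c)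
      a+c = abs-from-squares pa
        (nn-≡ (solve 4 (λ a b c d → let f = con five ; u = :- (b :+ d) in
            (a :* a :- f :* (b :* b)) :+ f :* (u :* (d :+ d :+ u)) :+ (f :* (d :* d) :- c :* c)
            := a :* a :- c :* c) refl a b c d)
          (nn-+ (nn-+ p (nn-* nn-five (nn-* neg (nn-+ (double pd) neg)))) q))
      dominates : NN N ⊎ NN (- N) → NN N
      dominates (inj₁ r) = r
      dominates (inj₂ r) = nn-≡ (solve 4 (λ a b c d → let f = con five ; i = f :* ((:- (b :+ d)) :* d) :+ (a :+ c) :* c in
            (a :* a :- f :* (b :* b)) :+ (f :* (d :* d) :- c :* c) :+ (i :+ i)
            := (a :+ c) :* (a :+ c) :- f :* ((b :+ d) :* (b :+ d))) refl a b c d)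
          (nn-+ (nn-+ p q) (double (outer-outer {a + c} { - (b + d)} {c} {d}
            (neg , nn-≡ (solve 2 (λ u v → :- (u :- con five :* (v :* v)) := con five :* ((:- v) :* (:- v)) :- u) refl ((a + c) * (a + c)) (b + d)) r) Q)))

    mixed-+ : ∀ {x y} → Inner x → Outer y → NonNegK (x +K y)
    mixed-+ {a , b} {c , d} P Q with nn-total (a + c) | nn-total (b + d)
    ... | inj₁ p | inj₁ q = inj₁ (p , q)
    ... | inj₂ p | _      = outerNonNegK _ (mixed-outer {a} {b} {c} {d} P Q p)
    ... | inj₁ _ | inj₂ q = innerNonNegK _ (mixed-inner {a} {b} {c} {d} P Q q)

  +K-comm : ∀ x y → x +K y ≡ y +K x
  +K-comm (a , b) (c , d) = cong₂ _,_ (+-comm a c) (+-comm b d)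

  nonNegK-+ : ∀ {x y} → NonNegK x → NonNegK y → NonNegK (x +K y)
  nonNegK-+ {x} {y} p q with fromNonNegK x p | fromNonNegK y q
  ... | inj₁ P | inj₁ Q = innerNonNegK _ (inner-+ {x} {y} P Q)
  ... | inj₂ P | inj₂ Q = outerNonNegK _ (outer-+ {x} {y} P Q)
  ... | inj₁ P | inj₂ Q = mixed-+ {x} {y} P Q
  ... | inj₂ P | inj₁ Q = subst NonNegK (+K-comm y x) (mixed-+ {y} {x} Q P)

  *K-comm : ∀ x y → x *K y ≡ y *K x
  *K-comm (a , b) (c , d) = cong₂ _,_ (cong₂ (λ u v → u + five * v) (*-comm a c) (*-comm b d))
    (trans (+-comm (a * d) (b * c)) (cong₂ _+_ (*-comm b c) (*-comm a d)))

  normK-* : ∀ x y → normK (x *K y) ≡ normK x * normK y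
  normK-* (a , b) (c , d) = solve 4 (λ a b c d → let f = con five in
    (a :* c :+ f :* (b :* d)) :* (a :* c :+ f :* (b :* d)) :- f :* ((a :* d :+ b :* c) :* (a :* d :+ b :* c))
    := (a :* a :- f :* (b :* b)) :* (c :* c :- f :* (d :* d))) refl a b c d

  private
    inner-*-outer : ∀ {x y} → Inner x → Outer y → Outer (x *K y)
    inner-*-outer {a , b} {c , d} P@(_ , p) Q@(_ , q) = inner-outer {a} {b} {c} {d} P Q
      , nn-≡ (solve 4 (λ a b c d → let f = con five in
          (a :* a :- f :* (b :* b)) :* (f :* (d :* d) :- c :* c)
          := f :* ((a :* d :+ b :* c) :* (a :* d :+ b :* c)) :- (a :* c :+ f :* (b :* d)) :* (a :* c :+ f :* (b :* d))) refl a b c d)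
        (nn-* p q)

  -- Multiplicativity of the norm decides the kind of the product: equal kinds give an inner
  -- element, different kinds an outer one.
  nonNegK-* : ∀ {x y} → NonNegK x → NonNegK y → NonNegK (x *K y)
  nonNegK-* {x@(a , b)} {y@(c , d)} p q with fromNonNegK x p | fromNonNegK y q
  ... | inj₁ P | inj₁ Q = innerNonNegK _ (inner-inner {a} {b} {c} {d} P Q
        , nn-≡ (sym (normK-* x y)) (nn-* (proj₂ P) (proj₂ Q)))
  ... | inj₁ P | inj₂ Q = outerNonNegK _ (inner-*-outer {x} {y} P Q)
  ... | inj₂ P | inj₁ Q = subst NonNegK (*K-comm y x) (outerNonNegK _ (inner-*-outer {y} {x} Q P))
  ... | inj₂ P | inj₂ Q = innerNonNegK _
        ( nn-≡ (+-comm (five * (b * d)) (a * c)) (outer-outer {a} {b} {c} {d} P Q)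
        , nn-≡ (trans (solve 4 (λ a b c d → (b :- a) :* (d :- c) := (a :- b) :* (c :- d)) refl
                  (a * a) (five * (b * b)) (c * c) (five * (d * d))) (sym (normK-* x y)))
            (nn-* (proj₂ P) (proj₂ Q)))

  nonNegK-square : ∀ x → NonNegK (x *K x)
  nonNegK-square x@(a , b) = innerNonNegK (x *K x)
    ( nn-+ (nn-square a) (nn-* nn-five (nn-square b))
    , nn-≡ (sym (normK-* x x)) (nn-square (normK x)))

  isCommutativeRingK : IsCommutativeRing _≡_ _+K_ _*K_ (λ x → -K x) (ι 0ℚ) (ι 1ℚ)
  isCommutativeRingK = record
    { isRing = record
      { +-isAbelianGroup = record
        { isGroup = record
          { isMonoid = record
            { isSemigroup = record
              { isMagma = record { isEquivalence = isEquivalence ; ∙-cong = cong₂ _+K_ }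
              ; assoc = λ { (a , b) (c , d) (e , f) → cong₂ _,_ (+-assoc a c e) (+-assoc b d f) } }
            ; identity = (λ { (a , b) → cong₂ _,_ (+-identityˡ a) (+-identityˡ b) })
                       , (λ { (a , b) → cong₂ _,_ (+-identityʳ a) (+-identityʳ b) }) }
          ; inverse = (λ { (a , b) → cong₂ _,_ (+-inverseˡ a) (+-inverseˡ b) })
                    , (λ { (a , b) → cong₂ _,_ (+-inverseʳ a) (+-inverseʳ b) })
          ; ⁻¹-cong = cong (λ x → -K x) }
        ; comm = +K-comm }
      ; *-cong = cong₂ _*K_
      ; *-assoc = λ { (a , b) (c , d) (e , f) → cong₂ _,_
          (solve 6 (λ a b c d e f → let v = con five in
            (a :* c :+ v :* (b :* d)) :* e :+ v :* ((a :* d :+ b :* c) :* f)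
            := a :* (c :* e :+ v :* (d :* f)) :+ v :* (b :* (c :* f :+ d :* e))) refl a b c d e f)
          (solve 6 (λ a b c d e f → let v = con five in
            (a :* c :+ v :* (b :* d)) :* f :+ (a :* d :+ b :* c) :* e
            := a :* (c :* f :+ d :* e) :+ b :* (c :* e :+ v :* (d :* f))) refl a b c d e f) }
      ; *-identity = identityˡ , (λ x → trans (*K-comm x (ι 1ℚ)) (identityˡ x))
      ; distrib = distribˡ
                , (λ x y z → trans (*K-comm (y +K z) x) (trans (distribˡ x y z) (cong₂ _+K_ (*K-comm x y) (*K-comm x z)))) }
    ; *-comm = *K-comm }
    where
    identityˡ : ∀ x → ι 1ℚ *K x ≡ x
    identityˡ (a , b) = cong₂ _,_
      (solve 2 (λ a b → con 1ℚ :* a :+ con five :* (con 0ℚ :* b) := a) refl a b)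
      (solve 2 (λ a b → con 1ℚ :* b :+ con 0ℚ :* a := b) refl a b)
    distribˡ : ∀ x y z → x *K (y +K z) ≡ x *K y +K x *K z
    distribˡ (a , b) (c , d) (e , f) = cong₂ _,_
      (solve 6 (λ a b c d e f → let v = con five in
        a :* (c :+ e) :+ v :* (b :* (d :+ f)) := a :* c :+ v :* (b :* d) :+ (a :* e :+ v :* (b :* f))) refl a b c d e f)
      (solve 6 (λ a b c d e f →
        a :* (d :+ f) :+ b :* (c :+ e) := a :* d :+ b :* c :+ (a :* f :+ b :* e)) refl a b c d e f)

  private
    i/1 : ∀ i → ℚ.toℚᵘ (i ℚ./ 1) ℚᵘ.≃ ℚᵘ.mkℚᵘ i 0
    i/1 i = toℚᵘ-fromℚᵘ (ℚᵘ.mkℚᵘ i 0)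

  /1-+ : ∀ i j → (i ℤ.+ j) ℚ./ 1 ≡ i ℚ./ 1 + j ℚ./ 1
  /1-+ i j = toℚᵘ-injective (ℚᵘ.≃-trans (i/1 (i ℤ.+ j)) (ℚᵘ.≃-sym
    (ℚᵘ.≃-trans (toℚᵘ-homo-+ (i ℚ./ 1) (j ℚ./ 1)) (ℚᵘ.≃-trans (ℚᵘ.+-cong (i/1 i) (i/1 j))
      (ℚᵘ.*≡* (cong (ℤ._* + 1) (cong₂ ℤ._+_ (ℤ.*-identityʳ i) (ℤ.*-identityʳ j))))))))

  /1-* : ∀ i j → (i ℤ.* j) ℚ./ 1 ≡ (i ℚ./ 1) * (j ℚ./ 1)
  /1-* i j = toℚᵘ-injective (ℚᵘ.≃-trans (i/1 (i ℤ.* j)) (ℚᵘ.≃-sym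
    (ℚᵘ.≃-trans (toℚᵘ-homo-* (i ℚ./ 1) (j ℚ./ 1)) (ℚᵘ.*-cong (i/1 i) (i/1 j)))))

  /1-neg : ∀ i → (ℤ.- i) ℚ./ 1 ≡ - (i ℚ./ 1)
  /1-neg i = toℚᵘ-injective (ℚᵘ.≃-trans (i/1 (ℤ.- i)) (ℚᵘ.≃-sym
    (ℚᵘ.≃-trans (toℚᵘ-homo‿- (i ℚ./ 1)) (ℚᵘ.-‿cong (i/1 i)))))

  /1-nonZero : ∀ n → NonZero ((+ suc n) ℚ./ 1)
  /1-nonZero n = ≢-nonZero λ eq → absurd (ℚᵘ.≃-trans (ℚᵘ.≃-sym (i/1 (+ suc n))) (toℚᵘ-cong eq))
    where
    absurd : ¬ (ℚᵘ.mkℚᵘ (+ suc n) 0 ℚᵘ.≃ ℚᵘ.0ℚᵘ)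
    absurd (ℚᵘ.*≡* ())

  nn-/1 : ∀ n → NN ((+ n) ℚ./ 1)
  nn-/1 n = nonNegative⁻¹ ((+ n) ℚ./ 1) {{normalize-nonNeg n 1}}

  ι-* : ∀ p q → ι p *K ι q ≡ ι (p * q)
  ι-* p q = cong₂ _,_ (solve 2 (λ p q → p :* q :+ con five :* (con 0ℚ :* con 0ℚ) := p :* q) refl p q)
                      (solve 2 (λ p q → p :* con 0ℚ :+ con 0ℚ :* q := con 0ℚ) refl p q)

  ι-nonNeg : ∀ {p} → NN p → NonNegK (ι p)
  ι-nonNeg p = inj₁ (p , ≤-refl)

  -- The norms of `x` and `y` multiply to the norm of 1, so the default branch of `invK` for norm
  -- zero is not reached.
  invK-unit : ∀ {x y} → x *K y ≡ ι 1ℚ → x *K invK x ≡ ι 1ℚ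
  invK-unit {x@(a , b)} {y} xy with normK x ≟ 0ℚ
  ... | yes eq = ⊥-elim (absurd (trans (sym (trans (normK-* x y) (trans (cong (_* normK y) eq) (*-zeroˡ (normK y))))) (cong normK xy)))
    where
    absurd : 0ℚ ≢ 1ℚ
    absurd ()
  ... | no ne = cong₂ _,_
      (trans (solve 3 (λ a b r → a :* (a :* r) :+ con five :* (b :* ((:- b) :* r)) := (a :* a :- con five :* (b :* b)) :* r) refl a b r)
        (*-inverseʳ (normK x)))
      (solve 3 (λ a b r → a :* ((:- b) :* r) :+ b :* (a :* r) := con 0ℚ) refl a b r)
    where
    instance
      _ = ≢-nonZero ne
    r = 1/ normK x

  -- K and its order, boxed: K is a record with η, so that Agda would otherwise unfold
  -- every arithmetic expression into its rational components.
  data Boxed : Set where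
    [_] : K → Boxed

  data BoxedNonNeg : Boxed → Set where
    box : ∀ x → NonNegK x → BoxedNonNeg [ x ]

  unbox : ∀ x → BoxedNonNeg [ x ] → NonNegK x
  unbox x (box .x p) = p

  private
    infixl 6 _⊕_
    infixl 7 _⊗_
    _⊕_ _⊗_ : Boxed → Boxed → Boxed
    [ x ] ⊕ [ y ] = [ x +K y ]
    [ x ] ⊗ [ y ] = [ x *K y ]

    ⊖_ : Boxed → Boxed
    ⊖ [ x ] = [ -K x ]

    module CR = IsCommutativeRing isCommutativeRingK

    isCommutativeRingBoxed : IsCommutativeRing _≡_ _⊕_ _⊗_ ⊖_ [ ι 0ℚ ] [ ι 1ℚ ]
    isCommutativeRingBoxed = record
      { isRing = record
        { +-isAbelianGroup = record
          { isGroup = record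
            { isMonoid = record
              { isSemigroup = record
                { isMagma = record { isEquivalence = isEquivalence ; ∙-cong = cong₂ _⊕_ }
                ; assoc = λ { [ x ] [ y ] [ z ] → cong [_] (CR.+-assoc x y z) } }
              ; identity = (λ { [ x ] → cong [_] (CR.+-identityˡ x) }) , (λ { [ x ] → cong [_] (CR.+-identityʳ x) }) }
            ; inverse = (λ { [ x ] → cong [_] (CR.-‿inverseˡ x) }) , (λ { [ x ] → cong [_] (CR.-‿inverseʳ x) })
            ; ⁻¹-cong = cong ⊖_ }
          ; comm = λ { [ x ] [ y ] → cong [_] (CR.+-comm x y) } }
        ; *-cong = cong₂ _⊗_
        ; *-assoc = λ { [ x ] [ y ] [ z ] → cong [_] (CR.*-assoc x y z) }
        ; *-identity = (λ { [ x ] → cong [_] (CR.*-identityˡ x) }) , (λ { [ x ] → cong [_] (CR.*-identityʳ x) })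
        ; distrib = (λ { [ x ] [ y ] [ z ] → cong [_] (CR.distribˡ x y z) })
                  , (λ { [ x ] [ y ] [ z ] → cong [_] (CR.distribʳ x y z) }) }
      ; *-comm = λ { [ x ] [ y ] → cong [_] (CR.*-comm x y) } }

    unbox-≡ : ∀ {x y} → [ x ] ≡ [ y ] → x ≡ y
    unbox-≡ refl = refl

    invBoxed : Boxed → Boxed
    invBoxed [ x ] = [ invK x ]

    recip : ∀ n → ℚ
    recip n = 1/_ ((+ suc n) ℚ./ 1) {{/1-nonZero n}}

    recip-spec : ∀ n → ιℕ (suc n) *K ι (recip n) ≡ ι 1ℚ
    recip-spec n = trans (ι-* ((+ suc n) ℚ./ 1) (recip n)) (cong ι (*-inverseʳ ((+ suc n) ℚ./ 1) {{/1-nonZero n}}))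

    nonNegK-cancel : ∀ n {x} → NonNegK (ιℕ (suc n) *K x) → NonNegK x
    nonNegK-cancel n {x} p = subst NonNegK
      (trans (sym (CR.*-assoc (ι (recip n)) (ιℕ (suc n)) x))
        (trans (cong (_*K x) (trans (*K-comm (ι (recip n)) (ιℕ (suc n))) (recip-spec n))) (CR.*-identityˡ x)))
      (nonNegK-* {ι (recip n)} {ιℕ (suc n) *K x} (ι-nonNeg (nn-divide ((+ suc n) ℚ./ 1) {{/1-nonZero n}} (nn-/1 (suc n))
        (subst NN (sym (*-inverseʳ ((+ suc n) ℚ./ 1) {{/1-nonZero n}})) (toWitness {a? = 0ℚ ℚ.≤? 1ℚ} _)))) p)

    minus-one : ¬ NonNegK (ι (-[1+ 0 ] ℚ./ 1))
    minus-one (inj₁ (ℚ.*≤* () , _))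
    minus-one (inj₂ (inj₁ (ℚ.*≤* () , _)))
    minus-one (inj₂ (inj₂ (_ , ℚ.*<* (ℤ.+<+ ()) , _)))

  golden : GoldenRing
  golden = record
    { Carrier = Boxed ; _+_ = _⊕_ ; _*_ = _⊗_ ; -_ = ⊖_ ; 0# = [ ι 0ℚ ] ; 1# = [ ι 1ℚ ]
    ; isCommutativeRing = isCommutativeRingBoxed
    ; fromℤ = λ i → [ ι (i ℚ./ 1) ]
    ; fromℤ-+ = λ i j → cong (λ q → [ q , 0ℚ ]) (/1-+ i j)
    ; fromℤ-* = λ i j → cong [_] (trans (cong ι (/1-* i j)) (sym (ι-* (i ℚ./ 1) (j ℚ./ 1))))
    ; fromℤ-neg = λ i → cong (λ q → [ q , 0ℚ ]) (/1-neg i)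
    ; fromℤ-0 = refl
    ; fromℤ-1 = refl
    ; NonNeg = BoxedNonNeg
    ; nonNeg-+ = λ { (box x p) (box y q) → box (x +K y) (nonNegK-+ {x} {y} p q) }
    ; nonNeg-* = λ { (box x p) (box y q) → box (x *K y) (nonNegK-* {x} {y} p q) }
    ; nonNeg-square = λ { [ x ] → box (x *K x) (nonNegK-square x) }
    ; nonNeg-ℕ = λ n → box (ιℕ n) (ι-nonNeg (nn-/1 n))
    ; nonNeg-cancel = λ { n {[ x ]} p → box x (nonNegK-cancel n {x} (unbox _ p)) }
    ; ¬nonNeg-minus-one = λ p → minus-one (unbox _ p)
    ; φ = [ φ ]
    ; φ-square = refl
    ; φ-lower = box _ (inj₂ (inj₂ (toWitness {a? = _ ℚ.<? _} _ , toWitness {a? = _ ℚ.<? _} _ , toWitness {a? = _ ℚ.≤? _} _)))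
    ; φ-upper = box _ (inj₂ (inj₁ (toWitness {a? = _ ℚ.≤? _} _ , toWitness {a? = _ ℚ.<? _} _ , toWitness {a? = _ ℚ.≤? _} _)))
    ; √5′ = [ √5 ]
    ; √5′-φ = refl
    ; half′ = [ ι half ]
    ; half′-half = refl
    ; inv = invBoxed
    ; inv-unit = λ { {[ x ]} {[ y ]} eq → cong [_] (invK-unit {x} {y} (unbox-≡ eq)) }
    ; inv-ℕ = λ n → cong [_] (invK-unit {ιℕ (suc n)} {ι (recip n)} (recip-spec n))
    }

open import Defs
open import Data.Nat using (ℕ; zero; suc; _≤_; _*_; _+_)
open import Data.Integer using (ℤ; +_; -[1+_]) renaming (-_ to -ℤ_)
open import Data.List using (List; length)
open import Data.List.Membership.Propositional using (_∈_)
open import Data.List.Relation.Unary.Unique.Propositional using (Unique)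
open import Data.Product using (Σ; ∃; _×_; _,_)
open import Relation.Nullary using (¬_)
open import Data.Empty using (⊥-elim)
open import Data.Nat.Divisibility using (_∣_; divides; ∣m+n∣m⇒∣n; ∣m∣n⇒∣m+n; ∣-refl)
import Data.Nat.Properties as ℕ
open import Data.Rational using (1ℚ)
open import Data.Sum using (_⊎_; inj₁; inj₂)
open import Relation.Binary.PropositionalEquality using (_≡_; refl; sym; trans; cong; cong₂; subst)
open GoldenRings using (GoldenRing; module Estimates; module Asymptotics)
open QuadraticField using (golden; [_]; box; unbox)

private
  module G = GoldenRing golden
  module E = Estimates golden
  open Asymptotics golden

-- Return to the unboxed field and the choice of exponent

pow-boxed : ∀ x k → G.pow [ x ] k ≡ [ powK x k ]
pow-boxed x zero    = refl
pow-boxed x (suc k) = cong ([ x ] G.*_) (pow-boxed x k)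

parity : ∀ r → (∃ λ i → r ≡ i + i) ⊎ (∃ λ i → r ≡ suc (i + i))
parity zero    = inj₁ (0 , refl)
parity (suc r) with parity r
... | inj₁ (i , refl) = inj₂ (i , refl)
... | inj₂ (i , refl) = inj₁ (suc i , cong suc (sym (ℕ.+-suc i i)))

double-even : ∀ i → 2 ∣ i + i
double-even i = divides i (trans (cong (λ z → i + z) (sym (ℕ.+-identityʳ i))) (ℕ.*-comm 2 i))

odd-not-even : ∀ i → ¬ (2 ∣ suc (i + i))
odd-not-even i p = absurd (∣m+n∣m⇒∣n (subst (2 ∣_) (ℕ.+-comm 1 (i + i)) p) (double-even i))
  where
  absurd : ¬ (2 ∣ 1)
  absurd (divides zero ())
  absurd (divides (suc q) ())

-- For exponents `p ≤ 0` the powers trade places: `e` is `φᵏ` and `Φ` is `φ⁻ᵏ ≤ 1`, too small for a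
-- positive n.
exponent-positive : ∀ n′ k {e} → e ≡ powK φ k → ¬ ((√5 *K ιℕ (suc n′) *K e) ≤K (φ *K invK √5))
exponent-positive n′ k refl hi = Scale.too-small n′ (G.pow φ⁻¹′ k) (G.pow [ φ ] k)
  (trans (G.*-comm (G.pow φ⁻¹′ k) (G.pow [ φ ] k)) (pow-inverse k)) (pow-φ⁻¹-nonNeg k)
  (E.≤-trans (pow-φ⁻¹-≤1 k) (E.nonNeg-≡ {[ φ ]} refl E.nonNeg-φ))
  (subst (λ e → [ √5 ] G.* G.nat (suc n′) G.* e E.≤ [ φ ] G.* G.inv [ √5 ]) (sym (pow-boxed φ k)) (box _ hi))

-- Meant for `p = 1` and `p = 2`, the positive exponents with `φᵖ ≤ φ² = φ + 1`.
exponent-≥3 : ∀ n′ k → G.pow [ φ ] k E.≤ [ φ ] G.+ G.nat 1 → ∀ {e} → e ≡ powK φ⁻¹ k →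
  ¬ ((√5 *K ιℕ (suc n′) *K e) ≤K (φ *K invK √5))
exponent-≥3 n′ k small refl hi = Scale.too-small n′ (G.pow [ φ ] k) (G.pow φ⁻¹′ k)
  (pow-inverse k) (E.nonNeg-≡ (E.minus-plus (G.pow [ φ ] k)) (G.nonNeg-+ (E.pow-φ≥1 k) (G.nonNeg-ℕ 1))) small
  (subst (λ e → [ √5 ] G.* G.nat (suc n′) G.* e E.≤ [ φ ] G.* G.inv [ √5 ]) (sym (pow-boxed φ⁻¹ k)) (box _ hi))

nat-boxed : ∀ n → [ ιℕ n ] ≡ G.nat n
nat-boxed n = refl

minus-boxed : ∀ x y → [ x -K y ] ≡ [ x ] G.- [ y ]
minus-boxed x y = refl

≤-boxed : ∀ x y → x ≤K y → [ x ] E.≤ [ y ]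
≤-boxed x y p = box (y -K x) p

errBound-unboxed : ∀ C n x → G.nat n G.* [ x ] G.* [ x ] E.≤ G.nat (C * C) → ErrBound C n x
errBound-unboxed C n x p = unbox (ιℕ (C * C) -K ιℕ n *K x *K x) p

inverse-boxed : ∀ c → [ invK (ιℕ 2 *K √5 *K c) ] ≡ G.inv (G.nat 2 G.* [ √5 ] G.* [ c ])
inverse-boxed c = refl

mainOdd-boxed : ∀ c → [ mainOdd c ] ≡ G.inv (G.nat 2 G.* [ √5 ] G.* [ φ^ (+ 4) ] G.* [ c ])
mainOdd-boxed c = refl

mainEven₁-boxed : ∀ c → [ mainEven₁ c ] ≡
  [ ι half ] G.* [ √5 ] G.* [ c ] G.+ (G.nat 1 G.+ [ φ^ (-ℤ (+ 5)) ]) G.* G.inv (G.nat 2 G.* [ √5 ] G.* [ c ]) G.- G.nat 1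
mainEven₁-boxed c = trans (minus-boxed (ι half *K √5 *K c +K (ι 1ℚ +K φ^ (-ℤ (+ 5))) *K y) (ι 1ℚ))
  (cong (λ z → [ ι half *K √5 *K c ] G.+ [ ι 1ℚ +K φ^ (-ℤ (+ 5)) ] G.* z G.- G.nat 1) (inverse-boxed c))
  where
  y = invK (ιℕ 2 *K √5 *K c)

mainEven₂-boxed : ∀ c → [ mainEven₂ c ] ≡
  G.nat 1 G.- [ ι half ] G.* [ √5 ] G.* [ φ^ (-ℤ (+ 1)) ] G.* [ c ] G.- (G.nat 1 G.+ [ φ^ (-ℤ (+ 2)) ]) G.* G.inv (G.nat 2 G.* [ √5 ] G.* [ c ])
mainEven₂-boxed c = trans (minus-boxed (ι 1ℚ -K x) ((ι 1ℚ +K φ^ (-ℤ (+ 2))) *K y))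
  (cong₂ G._-_ (minus-boxed (ι 1ℚ) x) (cong ([ ι 1ℚ +K φ^ (-ℤ (+ 2)) ] G.*_) (inverse-boxed c)))
  where
  x = ι half *K √5 *K φ^ (-ℤ (+ 1)) *K c
  y = invK (ιℕ 2 *K √5 *K c)

tval-boxed : ∀ m n x → [ Tval m n -K x ] ≡ G.nat m G.* G.inv (G.nat n) G.- [ x ]
tval-boxed m n x = minus-boxed (Tval m n) x

threshold-boxed : [ threshold ] ≡ (G.nat 1 G.+ [ φ^ (-ℤ (+ 3)) ]) G.* G.inv [ √5 ]
threshold-boxed = refl

c-boxed : ∀ n k {e} → e ≡ powK φ⁻¹ k → [ √5 *K ιℕ n *K e ] ≡ [ √5 ] G.* G.nat n G.* G.pow φ⁻¹′ k
c-boxed n k refl = cong₂ (λ y z → [ √5 ] G.* y G.* z) (nat-boxed n) (sym (pow-boxed φ⁻¹ k))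

module _ {n′ : ℕ} {S : List ℕ} (uniqueS : Unique S)
  (spec : ∀ m → (m ∈ S → 1 ≤ m × m ≤ suc n′ × HasTwoGood m) × (1 ≤ m × m ≤ suc n′ × HasTwoGood m → m ∈ S))
  (c : K) where
  private
    open Conclusions uniqueS spec
    n = suc n′
    N = G.nat n
    L = length S
    T = Tval L n

    transfer : ∀ {main X} → [ main ] ≡ X → let x = G.nat L G.* G.inv N G.- X in
      N G.* x G.* x E.≤ G.nat (750 * 750) → ErrBound 750 n (T -K main)
    transfer {main} refl p = errBound-unboxed 750 n (T -K main)
      (subst (λ x → N G.* x G.* x E.≤ G.nat (750 * 750)) (sym (tval-boxed L n main)) p)

    above : ∀ {x X C′} → [ c ] ≡ C′ → [ x ] ≡ X → x ≤K c → X E.≤ C′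
    above {x} refl refl = ≤-boxed x c

    below : ∀ {x X C′} → [ c ] ≡ C′ → [ x ] ≡ X → c ≤K x → C′ E.≤ X
    below {x} refl refl = ≤-boxed c x

  bound-odd : ∀ i → [ c ] ≡ [ √5 ] G.* N G.* G.pow φ⁻¹′ (3 + (i + i)) →
    invK √5 ≤K c → c ≤K (φ *K invK √5) → ErrBound 750 n (T -K mainOdd c)
  bound-odd i c≡ lo hi = transfer {mainOdd c}
    (trans (mainOdd-boxed c) (cong (λ z → G.inv (G.nat 2 G.* [ √5 ] G.* [ φ^ (+ 4) ] G.* z)) c≡))
    (conclude-odd i refl (above {invK √5} c≡ refl lo) (below {φ *K invK √5} c≡ refl hi))

  bound-even₁ : ∀ j → [ c ] ≡ [ √5 ] G.* N G.* G.pow φ⁻¹′ (4 + (j + j)) →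
    invK √5 ≤K c → c ≤K threshold → ErrBound 750 n (T -K mainEven₁ c)
  bound-even₁ j c≡ lo thr = transfer {mainEven₁ c}
    (trans (mainEven₁-boxed c) (cong (λ z → [ ι half ] G.* [ √5 ] G.* z
      G.+ (G.nat 1 G.+ [ φ^ (-ℤ (+ 5)) ]) G.* G.inv (G.nat 2 G.* [ √5 ] G.* z) G.- G.nat 1) c≡))
    (conclude-even₁ j refl refl (above {invK √5} c≡ refl lo) (below {threshold} c≡ threshold-boxed thr))

  bound-even₂ : ∀ j → [ c ] ≡ [ √5 ] G.* N G.* G.pow φ⁻¹′ (4 + (j + j)) →
    invK √5 ≤K c → c ≤K (φ *K invK √5) → threshold ≤K c → ErrBound 750 n (T -K mainEven₂ c)
  bound-even₂ j c≡ lo hi thr = transfer {mainEven₂ c}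
    (trans (mainEven₂-boxed c) (cong (λ z → G.nat 1 G.- [ ι half ] G.* [ √5 ] G.* [ φ^ (-ℤ (+ 1)) ] G.* z
      G.- (G.nat 1 G.+ [ φ^ (-ℤ (+ 2)) ]) G.* G.inv (G.nat 2 G.* [ √5 ] G.* z)) c≡))
    (conclude-even₂ j refl refl refl (above {invK √5} c≡ refl lo) (below {φ *K invK √5} c≡ refl hi)
      (above {threshold} c≡ threshold-boxed thr))

-- For `p = 3 + 2i` exactly the levels below `i` count, and for `p = 4 + 2j` the level `j` is cut;
-- the other exponents contradict the upper bound on c.
data Exponent (p : ℤ) : Set where
  nonPositive : ∀ k → φ^ (-ℤ p) ≡ powK φ k → Exponent p
  small       : ∀ k → G.pow [ φ ] k E.≤ [ φ ] G.+ G.nat 1 → φ^ (-ℤ p) ≡ powK φ⁻¹ k → Exponent p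
  odd         : ∀ i → ¬ Even p → φ^ (-ℤ p) ≡ powK φ⁻¹ (3 + (i + i)) → Exponent p
  even        : ∀ j → Even p → φ^ (-ℤ p) ≡ powK φ⁻¹ (4 + (j + j)) → Exponent p

exponent : ∀ p → Exponent p
exponent -[1+ k ]       = nonPositive (suc k) refl
exponent (+ 0)          = nonPositive 0 refl
exponent (+ 1)          = small 1 (E.nonNeg-≡ {G.nat 1} refl (G.nonNeg-ℕ 1)) refl
exponent (+ 2)          = small 2 (E.nonNeg-≡ {G.nat 0} refl (G.nonNeg-ℕ 0)) refl
exponent (+ suc (suc (suc r))) with parity r
... | inj₁ (i , refl) = odd i (λ p → odd-not-even i (∣m+n∣m⇒∣n p ∣-refl)) refl
... | inj₂ (j , refl) = even j (∣m∣n⇒∣m+n (divides 2 refl) (double-even j)) refl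

by-exponent : (n′ : ℕ) → let n = suc n′ in
  (S : List ℕ) → Unique S →
  (∀ m → (m ∈ S → 1 ≤ m × m ≤ n × HasTwoGood m) × (1 ≤ m × m ≤ n × HasTwoGood m → m ∈ S)) →
  (p : ℤ) → Exponent p → let c = √5 *K ιℕ n *K φ^ (-ℤ p) ; T = Tval (length S) n in
  invK √5 ≤K c → c ≤K (φ *K invK √5) →
  (¬ Even p → ErrBound 750 n (T -K mainOdd c))
  × (Even p → c ≤K threshold → ErrBound 750 n (T -K mainEven₁ c))
  × (Even p → threshold ≤K c → ErrBound 750 n (T -K mainEven₂ c))
by-exponent n′ S uniqueS spec p (nonPositive k e≡) lo hi = ⊥-elim (exponent-positive n′ k e≡ hi)
by-exponent n′ S uniqueS spec p (small k le e≡) lo hi = ⊥-elim (exponent-≥3 n′ k le e≡ hi)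
by-exponent n′ S uniqueS spec p (odd i ¬even e≡) lo hi =
    (λ _ → bound-odd uniqueS spec (√5 *K ιℕ (suc n′) *K φ^ (-ℤ p)) i (c-boxed (suc n′) (3 + (i + i)) e≡) lo hi)
  , (λ even → ⊥-elim (¬even even))
  , (λ even → ⊥-elim (¬even even))
by-exponent n′ S uniqueS spec p (even j isEven e≡) lo hi =
    (λ ¬even → ⊥-elim (¬even isEven))
  , (λ _ thr → bound-even₁ uniqueS spec (√5 *K ιℕ (suc n′) *K φ^ (-ℤ p)) j (c-boxed (suc n′) (4 + (j + j)) e≡) lo thr)
  , (λ _ thr → bound-even₂ uniqueS spec (√5 *K ιℕ (suc n′) *K φ^ (-ℤ p)) j (c-boxed (suc n′) (4 + (j + j)) e≡) lo hi thr)

theorem2 : Σ ℕ λ C → (n : ℕ) → 1 ≤ n →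
    (S : List ℕ) → Unique S →
    (∀ m → (m ∈ S → 1 ≤ m × m ≤ n × HasTwoGood m) × (1 ≤ m × m ≤ n × HasTwoGood m → m ∈ S)) →
    (p : ℤ) →
    invK √5 ≤K (√5 *K ιℕ n *K φ^ (-ℤ p)) →
    (√5 *K ιℕ n *K φ^ (-ℤ p)) <K (φ *K invK √5) →
    (¬ Even p → ErrBound C n (Tval (length S) n -K mainOdd (√5 *K ιℕ n *K φ^ (-ℤ p))))
    × (Even p → (√5 *K ιℕ n *K φ^ (-ℤ p)) ≤K threshold →
    ErrBound C n (Tval (length S) n -K mainEven₁ (√5 *K ιℕ n *K φ^ (-ℤ p))))
    × (Even p → threshold ≤K (√5 *K ιℕ n *K φ^ (-ℤ p)) →
    ErrBound C n (Tval (length S) n -K mainEven₂ (√5 *K ιℕ n *K φ^ (-ℤ p))))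
theorem2 = 750 , λ where
  (suc n′) _ S uniqueS spec p lo (hi , _) → by-exponent n′ S uniqueS spec p (exponent p) lo hi
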